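{- The problem Saving $k$-Vertices is $W[1]$-hard when parameterized by $k+l$, where $k$ is the number of vertices to be saved and $l$ is the distance of the input graph to split graphs (the size of the given modulator $X$ to the class of split graphs).
   Context: All graphs are undirected, connected (for input graphs $G$), finite and simple. $G\setminus X$ denotes the graph obtained from $G$ by deleting the vertices of $X$. A graph is a split graph if its vertices can be partitioned into a clique and an independent set. Firefighting process on $(G,s)$: at time $0$ a fire starts at $s$. At each subsequent time step $i=1,2,\ldots$, the firefighter permanently defends one vertex that is not burning, and then the fire spreads from every burning vertex to all its undefended neighbors. The process stops when the fire can no longer spread. A vertex is saved if it is not burned at the end (defended vertices count as saved). Saving $k$-Vertices, for a graph class $\mathcal F$: the input is a graph $G$, a vertex $s\in V(G)$, a set $X\subseteq V(G)$ (a modulator) with $G\setminus X\in\mathcal F$, and an integer $k$; the question is whether there is a strategy of the firefighter that saves at least $k$ vertices when the fire starts at $s$. Here $l=|X|$. $W[1]$-hardness is with respect to parameterized reductions: a parameterized reduction from $P$ to $Q$ maps instances of $P$ with parameter $p$ to equivalent instances of $Q$ with parameter at most $h(p)$, in time $f(p)$ times a polynomial in the input size, for computable $f,h$. -}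

module Defs where

open import Data.Bool.Base using (Bool; true; false; T; not; if_then_else_)
open import Data.Bool.Properties using (T?)
open import Data.Bool.ListAction using (and; or)
open import Data.Fin.Base using (Fin; toℕ)
open import Data.Fin.Properties using (any?)
open import Data.Fin.Subset using (Subset; _∈_; _∉_; _∪_; ⁅_⁆; ⊥; ∁; ∣_∣; Nonempty)
open import Data.Fin.Subset.Properties using (_∈?_)
open import Data.List.Base using (List; []; _∷_; foldr)
open import Data.Nat.Base using (ℕ; zero; suc; _+_; _*_; _^_; _⊔_; _≤_; _<ᵇ_)
open import Data.Product.Base using (Σ-syntax; ∃; ∃-syntax; _×_; _,_; proj₁)
open import Data.Vec.Base as Vec using (Vec; []; _∷_; lookup; tabulate; replicate)
open import Function.Base using (_on_)
open import Function.Bundles using (_⇔_)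
open import Relation.Binary.Construct.Closure.ReflexiveTransitive using (Star)
open import Relation.Binary.PropositionalEquality using (_≡_; _≢_)
open import Relation.Nullary using (¬_)
open import Relation.Nullary.Decidable using (does; ¬?; _×-dec_; _⊎-dec_)

infixr 5 _∙_

data Tree : Set where
  nil : Tree
  _∙_ : Tree → Tree → Tree

size : Tree → ℕ
size nil     = 1
size (x ∙ y) = suc (size x + size y)

hd : Tree → Tree
hd nil     = nil
hd (x ∙ _) = x

tl : Tree → Tree
tl nil     = nil
tl (_ ∙ y) = y

-- The model of computation is the WHILE language over binary trees
-- (N. D. Jones, "Computability and Complexity"), written point-free: a program
-- transforms a single tree, and several variables are kept as a tuple.
-- A test counts as false exactly when its value is nil.

infixr 9 _⨾_

data Program : Set where
  idₚ nilₚ hdₚ tlₚ : Program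
  _⨾_              : Program → Program → Program
  ⟨_,_⟩            : Program → Program → Program
  ifₚ              : (test yes no : Program) → Program
  while            : (test body : Program) → Program

-- p ⊢ x ⇓ y [ t ] : on input x, program p halts with output y in time t.
-- Basic operations cost the size of their argument.  With unit costs, iterating
-- ⟨ idₚ , idₚ ⟩ would build a tree of exponential size in linear time; here the
-- running time is never smaller than the size of the output, and it agrees with
-- Turing machine time up to a polynomial.

infix 4 _⊢_⇓_[_]

data _⊢_⇓_[_] : Program → Tree → Tree → ℕ → Set where
  ⇓id    : ∀ {x} → idₚ ⊢ x ⇓ x [ size x ]
  ⇓nil   : ∀ {x} → nilₚ ⊢ x ⇓ nil [ size x ]
  ⇓hd    : ∀ {x} → hdₚ ⊢ x ⇓ hd x [ size x ]
  ⇓tl    : ∀ {x} → tlₚ ⊢ x ⇓ tl x [ size x ]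
  ⇓seq   : ∀ {p q x y z a b} →
           p ⊢ x ⇓ y [ a ] → q ⊢ y ⇓ z [ b ] → p ⨾ q ⊢ x ⇓ z [ suc (a + b) ]
  ⇓pair  : ∀ {p q x y z a b} →
           p ⊢ x ⇓ y [ a ] → q ⊢ x ⇓ z [ b ] → ⟨ p , q ⟩ ⊢ x ⇓ y ∙ z [ suc (a + b) ]
  ⇓yes   : ∀ {c p q x u v y a b} →
           c ⊢ x ⇓ u ∙ v [ a ] → p ⊢ x ⇓ y [ b ] → ifₚ c p q ⊢ x ⇓ y [ suc (a + b) ]
  ⇓no    : ∀ {c p q x y a b} →
           c ⊢ x ⇓ nil [ a ] → q ⊢ x ⇓ y [ b ] → ifₚ c p q ⊢ x ⇓ y [ suc (a + b) ]
  ⇓exit  : ∀ {c p x a} →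
           c ⊢ x ⇓ nil [ a ] → while c p ⊢ x ⇓ x [ suc a ]
  ⇓again : ∀ {c p x u v y z a b d} →
           c ⊢ x ⇓ u ∙ v [ a ] → p ⊢ x ⇓ y [ b ] → while c p ⊢ y ⇓ z [ d ] →
           while c p ⊢ x ⇓ z [ suc (a + b + d) ]

⌜_⌝ᴺ : ℕ → Tree
⌜ zero ⌝ᴺ  = nil
⌜ suc n ⌝ᴺ = nil ∙ ⌜ n ⌝ᴺ

⌜_⌝ᴮ : Bool → Tree
⌜ false ⌝ᴮ = nil
⌜ true ⌝ᴮ  = nil ∙ nil

⌜_⌝ⱽ : ∀ {n} → Vec Tree n → Tree
⌜ [] ⌝ⱽ     = nil
⌜ x ∷ xs ⌝ⱽ = x ∙ ⌜ xs ⌝ⱽ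

⌜_⌝ˢ : ∀ {n} → Subset n → Tree
⌜ p ⌝ˢ = ⌜ Vec.map ⌜_⌝ᴮ p ⌝ⱽ

Computable : (ℕ → ℕ) → Set
Computable g = ∃[ p ] ∀ n → ∃[ t ] p ⊢ ⌜ n ⌝ᴺ ⇓ ⌜ g n ⌝ᴺ [ t ]

record ParamProblem : Set₁ where
  field
    Instance : Set
    encode   : Instance → Tree
    param    : Instance → ℕ
    Yes      : Instance → Set

-- Since size is at least 1, every polynomial in the size is bounded by a constant
-- times a power of it, and the constant can be absorbed into f.

infix 4 _≤ᶠᵖᵗ_

record _≤ᶠᵖᵗ_ (P Q : ParamProblem) : Set where
  private
    module P = ParamProblem P
    module Q = ParamProblem Q
  field
    program      : Program
    f h          : ℕ → ℕ
    c            : ℕ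
    f-computable : Computable f
    h-computable : Computable h
    reduce       : P.Instance → Q.Instance
    equivalent   : ∀ i → P.Yes i ⇔ Q.Yes (reduce i)
    param-bound  : ∀ i → Q.param (reduce i) ≤ h (P.param i)
    computes     : ∀ i → ∃[ t ] (program ⊢ P.encode i ⇓ Q.encode (reduce i) [ t ]
                               × t ≤ f (P.param i) * size (P.encode i) ^ c)

-- Circuits are straight-line programs: the n inputs come first, and a gate reads a
-- set of earlier nodes.  The most recent node has index zero.

data Gate (N : ℕ) : Set where
  NOT    : Fin N → Gate N
  AND OR : (p : Subset N) → Nonempty p → Gate N

infixl 5 _▷_

data Circuit (n : ℕ) : ℕ → Set where
  inputs : Circuit n n
  _▷_    : ∀ {N} → Circuit n N → Gate N → Circuit n (suc N)

select : ∀ {A : Set} {n} → Subset n → Vec A n → List A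
select []          []       = []
select (true ∷ p)  (x ∷ xs) = x ∷ select p xs
select (false ∷ p) (_ ∷ xs) = select p xs

maximum : List ℕ → ℕ
maximum = foldr _⊔_ 0

evalGate : ∀ {N} → Gate N → Vec Bool N → Bool
evalGate (NOT i)   vs = not (lookup vs i)
evalGate (AND p _) vs = and (select p vs)
evalGate (OR p _)  vs = or (select p vs)

eval : ∀ {n N} → Circuit n N → Vec Bool n → Vec Bool N
eval inputs  ρ = ρ
eval (C ▷ g) ρ = let vs = eval C ρ in evalGate g vs ∷ vs

predecessors : ∀ {N} → Gate N → Subset N
predecessors (NOT i)   = ⁅ i ⁆
predecessors (AND p _) = p
predecessors (OR p _)  = p

isLarge : ∀ {N} → Gate N → Bool
isLarge g = 2 <ᵇ ∣ predecessors g ∣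

-- For every node, the maximum number of edges, respectively of large gates, on a
-- path from an input to that node.

depths : ∀ {n N} → Circuit n N → Vec ℕ N
depths inputs  = replicate _ 0
depths (C ▷ g) = let ds = depths C in
  suc (maximum (select (predecessors g) ds)) ∷ ds

wefts : ∀ {n N} → Circuit n N → Vec ℕ N
wefts inputs  = replicate _ 0
wefts (C ▷ g) = let ws = wefts C in
  (if isLarge g then 1 else 0) + maximum (select (predecessors g) ws) ∷ ws

⌜_⌝ᴳ : ∀ {N} → Gate N → Tree
⌜ NOT i ⌝ᴳ   = ⌜ 0 ⌝ᴺ ∙ ⌜ toℕ i ⌝ᴺ
⌜ AND p _ ⌝ᴳ = ⌜ 1 ⌝ᴺ ∙ ⌜ p ⌝ˢ
⌜ OR p _ ⌝ᴳ  = ⌜ 2 ⌝ᴺ ∙ ⌜ p ⌝ˢ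

gates : ∀ {n N} → Circuit n N → Tree
gates inputs  = nil
gates (C ▷ g) = ⌜ g ⌝ᴳ ∙ gates C

record WCSInstance (t d : ℕ) : Set where
  field
    {n N}       : ℕ
    circuit     : Circuit n N
    output      : Fin N
    weft-bound  : lookup (wefts circuit) output ≤ t
    depth-bound : lookup (depths circuit) output ≤ d
    k           : ℕ

WeightedCircuitSatisfiability : (t d : ℕ) → ParamProblem
WeightedCircuitSatisfiability t d = record
  { Instance = WCSInstance t d
  ; encode   = λ I → let open WCSInstance I in
                 ⌜ n ⌝ᴺ ∙ gates circuit ∙ ⌜ toℕ output ⌝ᴺ ∙ ⌜ k ⌝ᴺ
  ; param    = WCSInstance.k
  ; Yes      = λ I → let open WCSInstance I in
                 ∃[ ρ ] ∣ ρ ∣ ≡ k × lookup (eval circuit ρ) output ≡ true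
  }

_∈W[_] : ParamProblem → ℕ → Set
P ∈W[ t ] = ∃[ d ] P ≤ᶠᵖᵗ WeightedCircuitSatisfiability t d

W[_]-Hard : ℕ → ParamProblem → Set₁
W[ t ]-Hard Q = ∀ P → P ∈W[ t ] → P ≤ᶠᵖᵗ Q

record Graph (V : Set) : Set where
  field
    adj    : V → V → Bool
    sym    : ∀ u v → adj u v ≡ adj v u
    irrefl : ∀ v → adj v v ≡ false

  Adj : V → V → Set
  Adj u v = T (adj u v)

Connected : ∀ {V} → Graph V → Set
Connected G = ∀ u v → Star (Graph.Adj G) u v

infixl 6 _∖_

_∖_ : ∀ {n} → Graph (Fin n) → (X : Subset n) → Graph (∃[ v ] v ∉ X)
G ∖ X = record
  { adj    = adj on proj₁
  ; sym    = λ u v → sym (proj₁ u) (proj₁ v)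
  ; irrefl = λ v → irrefl (proj₁ v)
  }
  where open Graph G

GraphClass : Set₁
GraphClass = ∀ {V} → Graph V → Set

-- C selects the clique; the remaining vertices form the independent set.

IsSplit : GraphClass
IsSplit {V} G = Σ[ C ∈ (V → Bool) ]
    (∀ u v → T (C u) → T (C v) → u ≢ v → Adj u v)
  × (∀ u v → T (not (C u)) → T (not (C v)) → ¬ Adj u v)
  where open Graph G

module Firefighting {n} (G : Graph (Fin n)) where
  open Graph G

  record State : Set where
    constructor ⟪_,_⟫
    field
      burning defended : Subset n

  open State public

  spread : State → State
  spread ⟪ B , D ⟫ =
    ⟪ tabulate (λ v → does (v ∈? B ⊎-dec
                            (¬? (v ∈? D) ×-dec
                             any? (λ u → u ∈? B ×-dec T? (adj u v)))))
    , D ⟫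

  defend : Fin n → State → State
  defend v ⟪ B , D ⟫ = ⟪ B , ⁅ v ⁆ ∪ D ⟫

  CanSpread : State → Set
  CanSpread ⟪ B , D ⟫ =
    ∃[ u ] ∃[ v ] u ∈ B × Adj u v × v ∉ B × v ∉ D

  -- The process is deterministic once the defended vertices are chosen, so a
  -- strategy amounts to one complete run.

  data _⟶*_ : State → State → Set where
    stop : ∀ {σ} → ¬ CanSpread σ → σ ⟶* σ
    step : ∀ {σ τ} → CanSpread σ → ∀ v → v ∉ burning σ →
           spread (defend v σ) ⟶* τ → σ ⟶* τ

  CanSave : Fin n → ℕ → Set
  CanSave s k = ∃[ τ ] ⟪ ⁅ s ⁆ , ⊥ ⟫ ⟶* τ × k ≤ ∣ ∁ (burning τ) ∣

record FirefightingInstance (F : GraphClass) : Set where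
  field
    {n}       : ℕ
    G         : Graph (Fin n)
    connected : Connected G
    s         : Fin n
    X         : Subset n
    modulator : F (G ∖ X)
    k         : ℕ

SavingKVertices : GraphClass → ParamProblem
SavingKVertices F = record
  { Instance = FirefightingInstance F
  ; encode   = λ I → let open FirefightingInstance I in
                 ⌜ tabulate (λ u → ⌜ tabulate (Graph.adj G u) ⌝ˢ) ⌝ⱽ
                   ∙ ⌜ toℕ s ⌝ᴺ ∙ ⌜ X ⌝ˢ ∙ ⌜ k ⌝ᴺ
  ; param    = λ I → let open FirefightingInstance I in k + ∣ X ∣
  ; Yes      = λ I → let open FirefightingInstance I in
                 Firefighting.CanSave G s k
  }

{-# OPTIONS --safe #-}
-- Let a fire have to cross K layers, each too wide to be blocked, before it reaches a
-- clique: the firefighter has time to defend K vertices of the clique.  Hang two leaves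
-- on every good c-tuple of clique vertices.  A leaf survives on its own exactly if all
-- members of its tuple are defended, so K + 2 Kᶜ vertices can be saved iff there are K
-- clique vertices all of whose c-tuples are good; the second copy of the leaves outweighs
-- the one vertex that can still be defended while the clique burns.  The layers form a
-- modulator to split graphs with K (K + 1) vertices.
--
-- An assignment of weight k is a sequence of K = k + 1 gaps between consecutive true
-- inputs; unlike in the list of true inputs, the value of every input, also of a false
-- one, is visible in a single gap.  If a circuit of weft 1 and depth d outputs true, then
-- at most 2ᵈ nodes witness the existential claims made about large gates.  With these
-- witnesses fixed and stored in every clique vertex, a wrong assignment is refuted by at
-- most 4ᵈ gaps.  So the clique consists of gaps with witnesses, and a tuple is good if
-- its gaps fit together and do not refute the output.

module Submission where

-- Every claim "this node has value b" is treated for both values b at once, since a negation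
-- exchanges them; "existential" thus means a true disjunction or a false conjunction. The
-- difficulty is fan-in. An existential claim is refuted only by refuting all predecessors, which at
-- a large gate are too many for a tuple of bounded size; stored witnesses leave boundedly many. A
-- universal claim about a large gate could in turn call for witnesses below each of its
-- predecessors, but in weft 1 no large gate lies below it, so none arise.
--
-- Each level of small gates contributes a factor 2 to the number of witnesses and again to the size
-- of a refutation; the one large gate on a path contributes the choice among at most 2ᵈ witnesses.
-- Hence 2ᵈ and 4ᵈ.
--
-- Membership in W[1] fixes d before any instance is seen, so the tuple size c and the number of
-- stored witnesses are constants: listing all hubs and all their c-tuples takes polynomial time,
-- and the new parameter is a function of k alone.

open import Defs

-- Compositional polynomial time for the WHILE language

module PolynomialTime where

  open import Data.Bool.Base using (Bool; true; false; if_then_else_)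
  open import Data.List.Base as List using (List; []; _∷_; length)
  open import Data.Nat.Base
  open import Data.Nat.Properties
  open import Data.Product.Base using (∃-syntax; _×_; _,_; proj₁; proj₂)
  open import Data.Sum.Base using (_⊎_; inj₁; inj₂; [_,_]′)
  open import Data.Unit.Base using (⊤)
  open import Function.Base using (id)
  open import Relation.Binary.PropositionalEquality

  -- Built from natural constants by sums and products only, so every polynomial is monotone: a
  -- bound on an intermediate value can be substituted into the bound of the next program.
  data Pol : Set where
    con     : ℕ → Pol
    var     : Pol
    _⊞_ _⊠_ : Pol → Pol → Pol

  infixl 6 _⊞_
  infixl 7 _⊠_

  ⟦_⟧ : Pol → ℕ → ℕ
  ⟦ con c ⟧ n = c
  ⟦ var ⟧   n = n
  ⟦ p ⊞ q ⟧ n = ⟦ p ⟧ n + ⟦ q ⟧ n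
  ⟦ p ⊠ q ⟧ n = ⟦ p ⟧ n * ⟦ q ⟧ n

  infixr 9 _⊙_

  _⊙_ : Pol → Pol → Pol
  con c   ⊙ r = con c
  var     ⊙ r = r
  (p ⊞ q) ⊙ r = (p ⊙ r) ⊞ (q ⊙ r)
  (p ⊠ q) ⊙ r = (p ⊙ r) ⊠ (q ⊙ r)

  ⟦⊙⟧ : ∀ p r n → ⟦ p ⊙ r ⟧ n ≡ ⟦ p ⟧ (⟦ r ⟧ n)
  ⟦⊙⟧ (con c) r n = refl
  ⟦⊙⟧ var     r n = refl
  ⟦⊙⟧ (p ⊞ q) r n = cong₂ _+_ (⟦⊙⟧ p r n) (⟦⊙⟧ q r n)
  ⟦⊙⟧ (p ⊠ q) r n = cong₂ _*_ (⟦⊙⟧ p r n) (⟦⊙⟧ q r n)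

  ⟦⟧-mono : ∀ p {m n} → m ≤ n → ⟦ p ⟧ m ≤ ⟦ p ⟧ n
  ⟦⟧-mono (con c) _   = ≤-refl
  ⟦⟧-mono var     m≤n = m≤n
  ⟦⟧-mono (p ⊞ q) m≤n = +-mono-≤ (⟦⟧-mono p m≤n) (⟦⟧-mono q m≤n)
  ⟦⟧-mono (p ⊠ q) m≤n = *-mono-≤ (⟦⟧-mono p m≤n) (⟦⟧-mono q m≤n)

  -- An fpt-reduction states its time as a single power of the size. Sums of monomials merge because
  -- exponents may be raised as soon as `1 ≤ n`, which holds for sizes of trees.
  monomial-bound : ∀ p → ∃[ a ] ∃[ b ] ∀ {n} → 1 ≤ n → ⟦ p ⟧ n ≤ a * n ^ b
  monomial-bound (con c) = c , 0 , λ _ → ≤-reflexive (sym (*-identityʳ c))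
  monomial-bound var     = 1 , 1 , λ {n} _ →
    ≤-reflexive (sym (trans (*-identityˡ (n * 1)) (*-identityʳ n)))
  monomial-bound (p ⊞ q) with monomial-bound p | monomial-bound q
  ... | a , b , p≤ | c , d , q≤ = a + c , b + d , λ {n} 1≤n → begin
    ⟦ p ⟧ n + ⟦ q ⟧ n                  ≤⟨ +-mono-≤ (p≤ 1≤n) (q≤ 1≤n) ⟩
    a * n ^ b + c * n ^ d              ≤⟨ +-mono-≤
                                            (*-monoʳ-≤ a (^-monoʳ-≤ n {{>-nonZero 1≤n}} (m≤m+n b d)))
                                            (*-monoʳ-≤ c (^-monoʳ-≤ n {{>-nonZero 1≤n}} (m≤n+m d b))) ⟩
    a * n ^ (b + d) + c * n ^ (b + d)  ≡⟨ *-distribʳ-+ (n ^ (b + d)) a c ⟨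
    (a + c) * n ^ (b + d)              ∎
    where open ≤-Reasoning
  monomial-bound (p ⊠ q) with monomial-bound p | monomial-bound q
  ... | a , b , p≤ | c , d , q≤ = a * c , b + d , λ {n} 1≤n → begin
    ⟦ p ⟧ n * ⟦ q ⟧ n          ≤⟨ *-mono-≤ (p≤ 1≤n) (q≤ 1≤n) ⟩
    a * n ^ b * (c * n ^ d)    ≡⟨ [m*n]*[o*p]≡[m*o]*[n*p] a (n ^ b) c (n ^ d) ⟩
    a * c * (n ^ b * n ^ d)    ≡⟨ cong (a * c *_) (^-distribˡ-+-* n b d) ⟨
    a * c * n ^ (b + d)        ∎
    where open ≤-Reasoning

  1≤size : ∀ x → 1 ≤ size x
  1≤size nil     = s≤s z≤n
  1≤size (x ∙ y) = s≤s z≤n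

  size-hd : ∀ x → size (hd x) ≤ size x
  size-hd nil     = ≤-refl
  size-hd (x ∙ y) = ≤-trans (m≤m+n (size x) (size y)) (n≤1+n _)

  size-tl : ∀ x → size (tl x) ≤ size x
  size-tl nil     = ≤-refl
  size-tl (x ∙ y) = ≤-trans (m≤n+m (size y) (size x)) (n≤1+n _)

  -- Every rule is a basic operation charged by its input or begins with a premise on the same
  -- input. It serves `output≤time`: a loop that exits at once returns its input and has paid for it
  -- only through its test.
  input≤time : ∀ {p x y t} → p ⊢ x ⇓ y [ t ] → size x ≤ t
  input≤time ⇓id            = ≤-refl
  input≤time ⇓nil           = ≤-refl
  input≤time ⇓hd            = ≤-refl
  input≤time ⇓tl            = ≤-refl
  input≤time (⇓seq p q)     = m≤n⇒m≤1+n (m≤n⇒m≤n+o _ (input≤time p))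
  input≤time (⇓pair p q)    = m≤n⇒m≤1+n (m≤n⇒m≤n+o _ (input≤time p))
  input≤time (⇓yes c p)     = m≤n⇒m≤1+n (m≤n⇒m≤n+o _ (input≤time c))
  input≤time (⇓no c q)      = m≤n⇒m≤1+n (m≤n⇒m≤n+o _ (input≤time c))
  input≤time (⇓exit c)      = m≤n⇒m≤1+n (input≤time c)
  input≤time (⇓again c p w) = m≤n⇒m≤1+n (m≤n⇒m≤n+o _ (m≤n⇒m≤n+o _ (input≤time c)))

  output≤time : ∀ {p x y t} → p ⊢ x ⇓ y [ t ] → size y ≤ t
  output≤time ⇓id            = ≤-refl
  output≤time {x = x} ⇓nil   = 1≤size x
  output≤time {x = x} ⇓hd    = size-hd x
  output≤time {x = x} ⇓tl    = size-tl x
  output≤time (⇓seq p q)     = m≤n⇒m≤1+n (m≤n⇒m≤o+n _ (output≤time q))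
  output≤time (⇓pair p q)    = s≤s (+-mono-≤ (output≤time p) (output≤time q))
  output≤time (⇓yes c p)     = m≤n⇒m≤1+n (m≤n⇒m≤o+n _ (output≤time p))
  output≤time (⇓no c q)      = m≤n⇒m≤1+n (m≤n⇒m≤o+n _ (output≤time q))
  output≤time (⇓exit c)      = m≤n⇒m≤1+n (input≤time c)
  output≤time (⇓again {a = a} {b} c p w) = m≤n⇒m≤1+n (m≤n⇒m≤o+n (a + b) (output≤time w))

  infixr 6 _⊗_
  infixr 5 _⊕_

  data Ty : Set where
    𝟙 𝔹 𝐍   : Ty
    [_]     : Ty → Ty
    _⊗_ _⊕_ : Ty → Ty → Ty

  El : Ty → Set
  El 𝟙       = ⊤
  El 𝔹       = Bool
  El 𝐍       = ℕ
  El [ A ]   = List (El A)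
  El (A ⊗ B) = El A × El B
  El (A ⊕ B) = El A ⊎ El B

  -- Chosen to coincide with the encodings in the two problems, with numbers in unary and vectors as
  -- lists. The tag of a sum is a Boolean, so a test tells the two cases apart.
  enc : ∀ {A} → El A → Tree
  enc {𝟙}     _        = nil
  enc {𝔹}     b        = ⌜ b ⌝ᴮ
  enc {𝐍}     n        = ⌜ n ⌝ᴺ
  enc {[ A ]} []       = nil
  enc {[ A ]} (x ∷ xs) = enc x ∙ enc xs
  enc {A ⊗ B} (x , y)  = enc x ∙ enc y
  enc {A ⊕ B} (inj₁ x) = nil ∙ enc x
  enc {A ⊕ B} (inj₂ y) = (nil ∙ nil) ∙ enc y

  ∥_∥ : ∀ {A} → El A → ℕ
  ∥ x ∥ = size (enc x)

  record PolyTime {A B : Ty} (f : El A → El B) : Set where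
    field
      prog  : Program
      bound : Pol
      run   : ∀ x → ∃[ t ] prog ⊢ enc x ⇓ enc (f x) [ t ] × t ≤ ⟦ bound ⟧ ∥ x ∥

  open PolyTime

  module _ {A B : Ty} {f : El A → El B} where

    ∥∥-bound : (F : PolyTime f) → ∀ x → ∥ f x ∥ ≤ ⟦ bound F ⟧ ∥ x ∥
    ∥∥-bound F x with run F x
    ... | _ , r , t≤ = ≤-trans (output≤time r) t≤

    ext : ∀ {g : El A → El B} → (∀ x → f x ≡ g x) → PolyTime f → PolyTime g
    ext f≗g F = record
      { prog  = prog F
      ; bound = bound F
      ; run   = λ x → subst (λ y → ∃[ t ] prog F ⊢ enc x ⇓ enc {B} y [ t ] × t ≤ ⟦ bound F ⟧ ∥ x ∥)
                            (f≗g x) (run F x)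
      }

  coerceP : ∀ {A B} (f : El A → El B) → (∀ x → enc {A} x ≡ enc {B} (f x)) → PolyTime f
  coerceP f same = record
    { prog  = idₚ
    ; bound = var
    ; run   = λ x → _ , subst (λ y → idₚ ⊢ enc x ⇓ y [ _ ]) (same x) ⇓id , ≤-refl
    }

  idP : ∀ {A} → PolyTime {A} id
  idP = coerceP (λ x → x) (λ _ → refl)

  fstP : ∀ {A B} → PolyTime {A ⊗ B} proj₁
  fstP = record { prog = hdₚ ; bound = var ; run = λ _ → _ , ⇓hd , ≤-refl }

  sndP : ∀ {A B} → PolyTime {A ⊗ B} proj₂
  sndP = record { prog = tlₚ ; bound = var ; run = λ _ → _ , ⇓tl , ≤-refl }

  infixr 9 _∘P_

  _∘P_ : ∀ {A B C} {g : El B → El C} {f : El A → El B} →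
         PolyTime g → PolyTime f → PolyTime (λ x → g (f x))
  _∘P_ {f = f} G F = record
    { prog  = prog F ⨾ prog G
    ; bound = con 1 ⊞ (bound F ⊞ (bound G ⊙ bound F))
    ; run   = λ x → let a , r , a≤ = run F x ; b , q , b≤ = run G (f x) in
        _ , ⇓seq r q ,
        s≤s (+-mono-≤ a≤ (≤-trans b≤ (≤-trans (⟦⟧-mono (bound G) (∥∥-bound F x))
                                              (≤-reflexive (sym (⟦⊙⟧ (bound G) (bound F) _))))))
    }

  infixr 4 _,P_

  _,P_ : ∀ {A B C} {f : El A → El B} {g : El A → El C} →
         PolyTime f → PolyTime g → PolyTime (λ x → f x , g x)
  F ,P G = record
    { prog  = ⟨ prog F , prog G ⟩
    ; bound = con 1 ⊞ (bound F ⊞ bound G)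
    ; run   = λ x → let a , r , a≤ = run F x ; b , q , b≤ = run G x in
        _ , ⇓pair r q , s≤s (+-mono-≤ a≤ b≤)
    }

  module _ {Γ A : Ty} {f g : El Γ → El A} where

    ifP : ∀ {c : El Γ → Bool} → PolyTime c → PolyTime f → PolyTime g →
          PolyTime (λ x → if c x then f x else g x)
    ifP {c} C F G = record
      { prog  = ifₚ (prog C) (prog F) (prog G)
      ; bound = con 1 ⊞ (bound C ⊞ (bound F ⊞ bound G))
      ; run   = go
      }
      where
      go : ∀ x → ∃[ t ] ifₚ (prog C) (prog F) (prog G) ⊢ enc x ⇓ enc (if c x then f x else g x) [ t ]
             × t ≤ suc (⟦ bound C ⟧ ∥ x ∥ + (⟦ bound F ⟧ ∥ x ∥ + ⟦ bound G ⟧ ∥ x ∥))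
      go x with c x | run C x
      ... | true  | _ , r , a≤ = let b , q , b≤ = run F x in
        _ , ⇓yes r q , s≤s (+-mono-≤ a≤ (m≤n⇒m≤n+o _ b≤))
      ... | false | _ , r , a≤ = let b , q , b≤ = run G x in
        _ , ⇓no r q , s≤s (+-mono-≤ a≤ (m≤n⇒m≤o+n _ b≤))

  list-case : ∀ {A C : Set} → C → (A → List A → C) → List A → C
  list-case c f []       = c
  list-case c f (x ∷ xs) = f x xs

  list-caseP : ∀ {A Γ B} {f : El Γ → El B} {g : El ((A ⊗ [ A ]) ⊗ Γ) → El B} {l : El Γ → List (El A)} →
               PolyTime f → PolyTime g → PolyTime l →
               PolyTime (λ γ → list-case (f γ) (λ x xs → g ((x , xs) , γ)) (l γ))
  list-caseP {A} {Γ} {B} {f} {g} {l} F G L = record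
    { prog  = prog (L ,P idP) ⨾ branches
    ; bound = con 1 ⊞ (bound (L ,P idP) ⊞ (branchBound ⊙ bound (L ,P idP)))
    ; run   = λ γ →
        let a , r , a≤ = run (L ,P idP) γ
            b , q , b≤ = go (l γ , γ)
        in _ , ⇓seq r q , s≤s (+-mono-≤ a≤
             (≤-trans b≤ (≤-trans (⟦⟧-mono branchBound (∥∥-bound (L ,P idP) γ))
                                  (≤-reflexive (sym (⟦⊙⟧ branchBound (bound (L ,P idP)) _))))))
    }
    where
    branches : Program
    -- The state pairs the list with the environment; its head is nil exactly for the empty list. A
    -- nonempty list is the same tree as the pair of its head and tail, so `prog G` runs on the
    -- state unchanged.
    branches = ifₚ hdₚ (prog G) (tlₚ ⨾ prog F)

    branchBound : Pol
    branchBound = con 1 ⊞ (var ⊞ (bound G ⊞ (con 1 ⊞ (var ⊞ bound F))))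

    go : ∀ (s : El ([ A ] ⊗ Γ)) → ∃[ t ]
         branches ⊢ enc s ⇓ enc (list-case (f (proj₂ s)) (λ x xs → g ((x , xs) , proj₂ s)) (proj₁ s)) [ t ]
         × t ≤ ⟦ branchBound ⟧ ∥ s ∥
    go ([] , γ) with run F γ
    ... | a , r , a≤ = _ , ⇓no ⇓hd (⇓seq ⇓tl r) ,
      s≤s (+-monoʳ-≤ (∥_∥ {[ A ] ⊗ Γ} ([] , γ)) (m≤n⇒m≤o+n (⟦ bound G ⟧ (∥_∥ {[ A ] ⊗ Γ} ([] , γ)))
        (s≤s (+-monoʳ-≤ (∥_∥ {[ A ] ⊗ Γ} ([] , γ)) (≤-trans a≤ (⟦⟧-mono (bound F) (m≤n⇒m≤o+n 2 ≤-refl)))))))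
    go (x ∷ xs , γ) with run G ((x , xs) , γ)
    ... | b , q , b≤ = _ , ⇓yes ⇓hd q , s≤s (+-monoʳ-≤ (∥_∥ {[ A ] ⊗ Γ} (x ∷ xs , γ)) (m≤n⇒m≤n+o _ b≤))

  sum-caseP : ∀ {A B Γ C} {f : El (A ⊗ Γ) → El C} {g : El (B ⊗ Γ) → El C} {c : El Γ → El A ⊎ El B} →
              PolyTime f → PolyTime g → PolyTime c →
              PolyTime (λ γ → [ (λ x → f (x , γ)) , (λ y → g (y , γ)) ]′ (c γ))
  sum-caseP {A} {B} {Γ} {C} {f} {g} {c} F G S = record
    { prog  = prog (S ,P idP) ⨾ branches
    ; bound = con 1 ⊞ (bound (S ,P idP) ⊞ (branchBound ⊙ bound (S ,P idP)))
    ; run   = λ γ →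
        let a , r , a≤ = run (S ,P idP) γ
            b , q , b≤ = go (c γ , γ)
        in _ , ⇓seq r q , s≤s (+-mono-≤ a≤
             (≤-trans b≤ (≤-trans (⟦⟧-mono branchBound (∥∥-bound (S ,P idP) γ))
                                  (≤-reflexive (sym (⟦⊙⟧ branchBound (bound (S ,P idP)) _))))))
    }
    where
    payload branches : Program
    payload  = ⟨ hdₚ ⨾ tlₚ , tlₚ ⟩
    branches = ifₚ (hdₚ ⨾ hdₚ) (payload ⨾ prog G) (payload ⨾ prog F)

    rest : ∀ {D} {h : El D → El C} → PolyTime h → Pol
    rest H = con 1 ⊞ ((con 1 ⊞ ((con 1 ⊞ (var ⊞ var)) ⊞ (var ⊞ con 0))) ⊞ bound H)

    branchBound : Pol
    branchBound = con 1 ⊞ ((con 1 ⊞ (var ⊞ var)) ⊞ (rest G ⊞ rest F))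

    test≤ : ∀ u v → suc (size (u ∙ v) + size u) ≤ suc (size (u ∙ v) + size (u ∙ v))
    test≤ u v = s≤s (+-monoʳ-≤ (size (u ∙ v)) (size-hd (u ∙ v)))

    rest≤ : ∀ {D} {h : El D → El C} (H : PolyTime h) tag u v {a} → a ≤ ⟦ bound H ⟧ (size (u ∙ v)) →
            let s = size ((tag ∙ u) ∙ v) in
            suc (suc (suc (s + size (tag ∙ u)) + s) + a) ≤ ⟦ rest H ⟧ s
    rest≤ H tag u v a≤ = s≤s (+-mono-≤
      (s≤s (+-mono-≤ (test≤ (tag ∙ u) v) (m≤m+n _ 0)))
      (≤-trans a≤ (⟦⟧-mono (bound H) (s≤s (+-monoˡ-≤ (size v) (size-tl (tag ∙ u)))))))

    go : ∀ (s : El ((A ⊕ B) ⊗ Γ)) → ∃[ t ]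
         branches ⊢ enc s ⇓ enc ([ (λ x → f (x , proj₂ s)) , (λ y → g (y , proj₂ s)) ]′ (proj₁ s)) [ t ]
         × t ≤ ⟦ branchBound ⟧ ∥ s ∥
    go (inj₁ x , γ) with run F (x , γ)
    ... | a , r , a≤ = _ , ⇓no (⇓seq ⇓hd ⇓hd) (⇓seq (⇓pair (⇓seq ⇓hd ⇓tl) ⇓tl) r) ,
      s≤s (+-mono-≤ (test≤ (nil ∙ enc x) (enc γ))
                    (m≤n⇒m≤o+n (⟦ rest G ⟧ (∥_∥ {(A ⊕ B) ⊗ Γ} (inj₁ x , γ))) (rest≤ F nil (enc x) (enc γ) a≤)))
    go (inj₂ y , γ) with run G (y , γ)
    ... | a , r , a≤ = _ , ⇓yes (⇓seq ⇓hd ⇓hd) (⇓seq (⇓pair (⇓seq ⇓hd ⇓tl) ⇓tl) r) ,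
      s≤s (+-mono-≤ (test≤ ((nil ∙ nil) ∙ enc y) (enc γ))
                    (m≤n⇒m≤n+o _ (rest≤ G (nil ∙ nil) (enc y) (enc γ) a≤)))

  -- The step also sees the part of the list still to come, which a loop holds in its state anyway;
  -- `upToP` reads its counter off the length of that part.
  tailFold : ∀ {A B : Set} → (A → List A → B → B) → List A → B → B
  tailFold f []       b = b
  tailFold f (x ∷ xs) b = tailFold f xs (f x xs b)

  length≤∥∥ : ∀ {A} (xs : List (El A)) → length xs ≤ ∥_∥ {[ A ]} xs
  length≤∥∥     []       = z≤n
  length≤∥∥ {A} (x ∷ xs) = s≤s (m≤n⇒m≤o+n ∥ x ∥ (length≤∥∥ {A} xs))

  -- Additive growth of the accumulator keeps every intermediate state polynomial.

  module _ {A B Γ : Ty} {step : El ((A ⊗ [ A ]) ⊗ (B ⊗ Γ)) → El B} (F : PolyTime step)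
           (q : Pol)
           (growth : ∀ x xs b γ → ∥ step ((x , xs) , (b , γ)) ∥ ≤ ∥ b ∥ + ⟦ q ⟧ (∥_∥ {[ A ] ⊗ Γ} (x ∷ xs , γ)))
           where

    private
      f : El Γ → El A → List (El A) → El B → El B
      f γ x xs b = step ((x , xs) , (b , γ))

      State : Ty
      State = [ A ] ⊗ (B ⊗ Γ)

      bodyP : PolyTime {(A ⊗ [ A ]) ⊗ (B ⊗ Γ)} {State}
                       (λ s → proj₂ (proj₁ s) , (step s , proj₂ (proj₂ s)))
      bodyP = sndP ∘P fstP ,P (F ,P sndP ∘P sndP)

      loop : Program
      loop = while hdₚ (prog bodyP)

      cost : ℕ → ℕ
      cost S = suc (S + ⟦ bound bodyP ⟧ S)

      -- `L` bounds the remaining list, `Y` the accumulator together with all growth still to come.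
      -- Both stay fixed while the list shrinks, so every iteration is charged the same `cost`.
      loops : ∀ L Y γ xs b → ∥_∥ {[ A ]} xs ≤ L →
              ∥ b ∥ + length xs * ⟦ q ⟧ (suc (L + ∥ γ ∥)) ≤ Y →
              ∃[ t ] loop ⊢ enc {State} (xs , (b , γ)) ⇓ enc {State} ([] , (tailFold (f γ) xs b , γ)) [ t ]
                   × t ≤ suc (length xs) * cost (suc (L + suc (Y + ∥ γ ∥)))
      loops L Y γ [] b ∥xs∥≤L b≤Y = _ , ⇓exit ⇓hd ,
        ≤-trans (s≤s (m≤n⇒m≤n+o _ (s≤s (+-mono-≤ ∥xs∥≤L (s≤s (+-monoˡ-≤ ∥ γ ∥ (m+n≤o⇒m≤o _ b≤Y)))))))
                (m≤m+n _ 0)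
      loops L Y γ (x ∷ xs) b ∥xs∥≤L b≤Y =
        let Q           = ⟦ q ⟧ (suc (L + ∥ γ ∥))
            state≤S     = s≤s (+-mono-≤ ∥xs∥≤L (s≤s (+-monoˡ-≤ ∥ γ ∥ (m+n≤o⇒m≤o _ b≤Y))))
            a , r , a≤  = run bodyP ((x , xs) , (b , γ))
            b′≤Y        = begin
              ∥ f γ x xs b ∥ + length xs * Q  ≤⟨ +-monoˡ-≤ _ (growth x xs b γ) ⟩
              ∥ b ∥ + _ + length xs * Q       ≤⟨ +-monoˡ-≤ (length xs * Q) (+-monoʳ-≤ ∥ b ∥ (⟦⟧-mono q (s≤s (+-monoˡ-≤ ∥ γ ∥ ∥xs∥≤L)))) ⟩
              ∥ b ∥ + Q + length xs * Q       ≡⟨ +-assoc ∥ b ∥ Q _ ⟩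
              ∥ b ∥ + (Q + length xs * Q)     ≤⟨ b≤Y ⟩
              Y                               ∎
            d , w , d≤  = loops L Y γ xs (f γ x xs b)
                                (≤-trans (m≤n⇒m≤o+n (suc ∥ x ∥) ≤-refl) ∥xs∥≤L) b′≤Y
        in _ , ⇓again ⇓hd r w ,
           s≤s (+-mono-≤ (+-mono-≤ state≤S (≤-trans a≤ (⟦⟧-mono (bound bodyP) state≤S))) d≤)
        where open ≤-Reasoning

      growthBound stateBound loopBound : Pol
      growthBound = q ⊙ (con 1 ⊞ (var ⊞ var))
      stateBound  = con 1 ⊞ (var ⊞ (con 1 ⊞ ((var ⊞ var ⊠ growthBound) ⊞ var)))
      loopBound   = (con 1 ⊞ var) ⊠ (con 1 ⊞ (stateBound ⊞ (bound bodyP ⊙ stateBound)))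

      loopP : PolyTime {State} {State}
                (λ s → [] , (tailFold (f (proj₂ (proj₂ s))) (proj₁ s) (proj₁ (proj₂ s)) , proj₂ (proj₂ s)))
      loopP = record { prog = loop ; bound = loopBound ; run = go }
        where
        go : ∀ s → _
        go (xs , b , γ) =
          let L = ∥_∥ {[ A ]} xs
              n = ∥_∥ {State} (xs , b , γ)
              L≤n : L ≤ n
              L≤n = m≤n⇒m≤1+n (m≤m+n L _)
              γ≤n : ∥ γ ∥ ≤ n
              γ≤n = m≤n⇒m≤o+n (suc L) (m≤n⇒m≤1+n (m≤n+m ∥ γ ∥ ∥ b ∥))
              b≤n : ∥ b ∥ ≤ n
              b≤n = m≤n⇒m≤o+n (suc L) (m≤n⇒m≤1+n (m≤m+n ∥ b ∥ ∥ γ ∥))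
              l≤n : length xs ≤ n
              l≤n = ≤-trans (length≤∥∥ {A} xs) L≤n
              Y = ∥ b ∥ + length xs * ⟦ q ⟧ (suc (L + ∥ γ ∥))
              Y≤ : Y ≤ n + n * ⟦ growthBound ⟧ n
              Y≤ = +-mono-≤ b≤n (*-mono-≤ l≤n
                     (≤-trans (⟦⟧-mono q (s≤s (+-mono-≤ L≤n γ≤n)))
                              (≤-reflexive (sym (⟦⊙⟧ q (con 1 ⊞ (var ⊞ var)) n)))))
              S≤ : suc (L + suc (Y + ∥ γ ∥)) ≤ ⟦ stateBound ⟧ n
              S≤ = s≤s (+-mono-≤ L≤n (s≤s (+-mono-≤ Y≤ γ≤n)))
              t , r , t≤ = loops L Y γ xs b ≤-refl ≤-refl
          in t , r , ≤-trans t≤ (*-mono-≤ (s≤s l≤n)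
               (s≤s (+-mono-≤ S≤ (≤-trans (⟦⟧-mono (bound bodyP) S≤)
                                           (≤-reflexive (sym (⟦⊙⟧ (bound bodyP) stateBound n)))))))

    tailFoldP : ∀ {xs : El Γ → List (El A)} {b : El Γ → El B} → PolyTime xs → PolyTime b →
                PolyTime (λ γ → tailFold (λ x ys a → step ((x , ys) , (a , γ))) (xs γ) (b γ))
    tailFoldP XS B = fstP ∘P sndP ∘P loopP ∘P (XS ,P (B ,P idP))

open PolynomialTime

-- Polynomial-time functions on lists and numbers

module Programs where

  open import Data.Bool.Base using (Bool; true; false; not; _∧_; _∨_; if_then_else_)
  open import Data.Bool.Properties using (∧-assoc; ∧-identityʳ; ∧-zeroʳ)
  open import Data.Bool.ListAction using (any; all)
  open import Data.List.Base as List using (List; []; _∷_; length; _++_; reverse; map; filterᵇ; foldr; foldl; concatMap; cartesianProductWith; replicate; upTo; drop; _∷ʳ_; _ʳ++_)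
  open import Data.List.Properties
  open import Data.Nat.Base
  open import Data.Nat.Properties
  open import Data.Product.Base using (_×_; _,_; proj₁; proj₂)
  open import Data.Sum.Base using (inj₁; inj₂)
  open import Data.Unit.Base using (⊤; tt)
  open import Function.Base using (id)
  open import Relation.Binary.PropositionalEquality

  open PolyTime

  []P : ∀ {Γ A} → PolyTime {Γ} {[ A ]} (λ _ → [])
  []P = record { prog = nilₚ ; bound = var ; run = λ _ → _ , ⇓nil , ≤-refl }

  infixr 5 _∷P_

  _∷P_ : ∀ {Γ A} {x : El Γ → El A} {xs : El Γ → List (El A)} →
         PolyTime x → PolyTime xs → PolyTime {Γ} {[ A ]} (λ γ → x γ ∷ xs γ)
  _∷P_ {A = A} X XS = coerceP {A ⊗ [ A ]} {[ A ]} (λ p → proj₁ p ∷ proj₂ p) (λ _ → refl) ∘P (X ,P XS)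

  falseP : ∀ {Γ} → PolyTime {Γ} {𝔹} (λ _ → false)
  falseP = record { prog = nilₚ ; bound = var ; run = λ _ → _ , ⇓nil , ≤-refl }

  trueP : ∀ {Γ} → PolyTime {Γ} {𝔹} (λ _ → true)
  trueP = record
    { prog  = ⟨ nilₚ , nilₚ ⟩
    ; bound = con 1 ⊞ (var ⊞ var)
    ; run   = λ _ → _ , ⇓pair ⇓nil ⇓nil , ≤-refl
    }

  inj₁P : ∀ {A B} → PolyTime {A} {A ⊕ B} inj₁
  inj₁P = record
    { prog  = ⟨ nilₚ , idₚ ⟩
    ; bound = con 1 ⊞ (var ⊞ var)
    ; run   = λ _ → _ , ⇓pair ⇓nil ⇓id , ≤-refl
    }

  inj₂P : ∀ {A B} → PolyTime {B} {A ⊕ B} inj₂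
  inj₂P = record
    { prog  = ⟨ ⟨ nilₚ , nilₚ ⟩ , idₚ ⟩
    ; bound = con 1 ⊞ ((con 1 ⊞ (var ⊞ var)) ⊞ var)
    ; run   = λ _ → _ , ⇓pair (⇓pair ⇓nil ⇓nil) ⇓id , ≤-refl
    }

  notP : PolyTime not
  notP = ext (λ { true → refl ; false → refl }) (ifP idP falseP trueP)

  infixr 6 _∧P_
  infixr 5 _∨P_

  _∧P_ : ∀ {Γ} {f g : El Γ → Bool} → PolyTime f → PolyTime g → PolyTime (λ γ → f γ ∧ g γ)
  _∧P_ {f = f} {g} F G = ext (λ γ → lemma (f γ)) (ifP F G falseP)
    where
    lemma : ∀ a {b} → (if a then b else false) ≡ a ∧ b
    lemma true  = refl
    lemma false = refl

  _∨P_ : ∀ {Γ} {f g : El Γ → Bool} → PolyTime f → PolyTime g → PolyTime (λ γ → f γ ∨ g γ)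
  _∨P_ {f = f} {g} F G = ext (λ γ → lemma (f γ)) (ifP F trueP G)
    where
    lemma : ∀ a {b} → (if a then true else b) ≡ a ∨ b
    lemma true  = refl
    lemma false = refl

  zeroP : ∀ {Γ} → PolyTime {Γ} {𝐍} (λ _ → 0)
  zeroP = record { prog = nilₚ ; bound = var ; run = λ _ → _ , ⇓nil , ≤-refl }

  sucP : PolyTime suc
  sucP = record
    { prog  = ⟨ nilₚ , idₚ ⟩
    ; bound = con 1 ⊞ (var ⊞ var)
    ; run   = λ _ → _ , ⇓pair ⇓nil ⇓id , ≤-refl
    }

  predP : PolyTime pred
  predP = record
    { prog  = tlₚ
    ; bound = var
    ; run   = λ { zero → _ , ⇓tl , ≤-refl ; (suc n) → _ , ⇓tl , ≤-refl }
    }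

  constℕP : ∀ {Γ} c → PolyTime {Γ} {𝐍} (λ _ → c)
  constℕP zero    = zeroP
  constℕP (suc c) = sucP ∘P constℕP c

  -- A unary number is, as a tree, already a list of units; counting loops become folds over it.
  ticks : ℕ → List ⊤
  ticks n = replicate n tt

  ticksP : PolyTime {𝐍} {[ 𝟙 ]} ticks
  ticksP = coerceP ticks same
    where
    same : ∀ n → enc {𝐍} n ≡ enc {[ 𝟙 ]} (ticks n)
    same zero    = refl
    same (suc n) = cong (nil ∙_) (same n)

  is0 : ℕ → Bool
  is0 zero    = true
  is0 (suc _) = false

  is0P : PolyTime is0
  is0P = ext (λ { zero → refl ; (suc n) → refl })
             (list-caseP {Γ = 𝐍} {f = λ _ → true} {g = λ _ → false} trueP falseP ticksP)

  module _ {Γ A B : Ty} {h : El ((A ⊗ [ A ]) ⊗ Γ) → El B} where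

    pushP : ∀ {xs : El Γ → List (El A)} {b : El Γ → List (El B)} →
            PolyTime h → PolyTime xs → PolyTime b →
            PolyTime {Γ} {[ B ]} (λ γ → tailFold (λ x ys a → h ((x , ys) , γ) ∷ a) (xs γ) (b γ))
    pushP H = tailFoldP {A} {[ B ]} {Γ}
      (H ∘P (fstP ,P sndP ∘P sndP) ∷P fstP ∘P sndP)
      (con 1 ⊞ bound H)
      λ x xs b γ → ≤-trans (≤-reflexive (cong suc (+-comm _ (∥_∥ {[ B ]} b))))
        (≤-trans (≤-reflexive (sym (+-suc (∥_∥ {[ B ]} b) _)))
                 (+-monoʳ-≤ (∥_∥ {[ B ]} b) (s≤s (∥∥-bound H ((x , xs) , γ)))))

  reverseP : ∀ {A} → PolyTime {[ A ]} {[ A ]} reverse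
  reverseP = ext (λ xs → pushed xs []) (pushP (fstP ∘P fstP) idP []P)
    where
    pushed : ∀ {A : Set} (xs ys : List A) → tailFold (λ x _ a → x ∷ a) xs ys ≡ xs ʳ++ ys
    pushed []       ys = refl
    pushed (x ∷ xs) ys = pushed xs (x ∷ ys)

  tailFold-map : ∀ {A B : Set} (f : A → B) xs ys → tailFold (λ x _ a → f x ∷ a) xs ys ≡ reverse (map f xs) ++ ys
  tailFold-map f xs ys = trans (go xs ys) (ʳ++-defn (map f xs))
    where
    go : ∀ xs ys → tailFold (λ x _ a → f x ∷ a) xs ys ≡ map f xs ʳ++ ys
    go []       ys = refl
    go (x ∷ xs) ys = go xs (f x ∷ ys)

  module _ {Γ A B : Ty} {h : El (A ⊗ Γ) → El B} {xs : El Γ → List (El A)} where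

    mapP : PolyTime h → PolyTime xs → PolyTime {Γ} {[ B ]} (λ γ → map (λ x → h (x , γ)) (xs γ))
    mapP H XS = ext
      (λ γ → trans (cong reverse (trans (tailFold-map _ (xs γ) []) (++-identityʳ _)))
                   (reverse-involutive (map (λ x → h (x , γ)) (xs γ))))
      (reverseP ∘P pushP (H ∘P (fstP ∘P fstP ,P sndP)) XS []P)

  infixr 5 _++P_

  _++P_ : ∀ {Γ A} {xs ys : El Γ → List (El A)} → PolyTime xs → PolyTime ys →
          PolyTime {Γ} {[ A ]} (λ γ → xs γ ++ ys γ)
  _++P_ {xs = xs} {ys} XS YS = ext
    (λ γ → trans (tailFold-map id (reverse (xs γ)) (ys γ))
                 (cong (_++ ys γ) (trans (cong reverse (map-id (reverse (xs γ)))) (reverse-involutive (xs γ)))))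
    (pushP (fstP ∘P fstP) (reverseP ∘P XS) YS)

  tailFold-foldl : ∀ {A B : Set} (f : A → B → B) xs b → tailFold (λ x _ a → f x a) xs b ≡ foldl (λ a x → f x a) b xs
  tailFold-foldl f []       b = refl
  tailFold-foldl f (x ∷ xs) b = tailFold-foldl f xs (f x b)

  module _ {A B Γ : Ty} {step : El (A ⊗ (B ⊗ Γ)) → El B} (F : PolyTime step) (q : Pol)
           (growth : ∀ x b γ → ∥ step (x , b , γ) ∥ ≤ ∥ b ∥ + ⟦ q ⟧ (∥_∥ {A ⊗ Γ} (x , γ)))
           {xs : El Γ → List (El A)} {b : El Γ → El B}
           where

    foldlP : PolyTime xs → PolyTime b →
             PolyTime (λ γ → foldl (λ a x → step (x , a , γ)) (b γ) (xs γ))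
    foldlP XS B′ = ext (λ γ → tailFold-foldl _ (xs γ) (b γ))
      (tailFoldP {A} {B} {Γ} (F ∘P (fstP ∘P fstP ,P sndP)) q
        (λ x ys a γ → ≤-trans (growth x a γ) (+-monoʳ-≤ ∥ a ∥ (⟦⟧-mono q
          (s≤s (+-monoˡ-≤ ∥ γ ∥ (m≤n⇒m≤1+n (m≤m+n ∥ x ∥ _)))))))
        XS B′)

    foldrP : PolyTime xs → PolyTime b →
             PolyTime (λ γ → foldr (λ x a → step (x , a , γ)) (b γ) (xs γ))
    foldrP XS B′ = ext
      (λ γ → trans (tailFold-foldl _ (reverse (xs γ)) (b γ))
                   (trans (sym (reverse-foldr _ (b γ) (reverse (xs γ))))
                          (cong (foldr _ (b γ)) (reverse-involutive (xs γ)))))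
      (tailFoldP {A} {B} {Γ} (F ∘P (fstP ∘P fstP ,P sndP)) q
        (λ x ys a γ → ≤-trans (growth x a γ) (+-monoʳ-≤ ∥ a ∥ (⟦⟧-mono q
          (s≤s (+-monoˡ-≤ ∥ γ ∥ (m≤n⇒m≤1+n (m≤m+n ∥ x ∥ _)))))))
        (reverseP ∘P XS) B′)

  ∥bool∥≤3 : ∀ b → ∥_∥ {𝔹} b ≤ 3
  ∥bool∥≤3 true  = ≤-refl
  ∥bool∥≤3 false = s≤s z≤n

  module _ {Γ A : Ty} {p : El (A ⊗ Γ) → Bool} {xs : El Γ → List (El A)} where

    anyP : PolyTime p → PolyTime xs → PolyTime (λ γ → any (λ x → p (x , γ)) (xs γ))
    anyP P XS = ext (λ γ → lemma (λ x → p (x , γ)) (xs γ))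
      (foldrP {A} {𝔹} {Γ} (P ∘P (fstP ,P sndP ∘P sndP) ∨P fstP ∘P sndP) (con 3)
              (λ x b γ → m≤n⇒m≤o+n _ (∥bool∥≤3 _)) XS falseP)
      where
      lemma : ∀ (p : El A → Bool) xs → foldr (λ x a → p x ∨ a) false xs ≡ any p xs
      lemma p []       = refl
      lemma p (x ∷ xs) = cong (p x ∨_) (lemma p xs)

    allP : PolyTime p → PolyTime xs → PolyTime (λ γ → all (λ x → p (x , γ)) (xs γ))
    allP P XS = ext (λ γ → lemma (λ x → p (x , γ)) (xs γ))
      (foldrP {A} {𝔹} {Γ} (P ∘P (fstP ,P sndP ∘P sndP) ∧P fstP ∘P sndP) (con 3)
              (λ x b γ → m≤n⇒m≤o+n _ (∥bool∥≤3 _)) XS trueP)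
      where
      lemma : ∀ (p : El A → Bool) xs → foldr (λ x a → p x ∧ a) true xs ≡ all p xs
      lemma p []       = refl
      lemma p (x ∷ xs) = cong (p x ∧_) (lemma p xs)

    filterP : PolyTime p → PolyTime xs →
              PolyTime {Γ} {[ A ]} (λ γ → filterᵇ (λ x → p (x , γ)) (xs γ))
    filterP P XS = ext (λ γ → lemma (λ x → p (x , γ)) (xs γ))
      (foldrP {A} {[ A ]} {Γ} {step = step}
              (ifP (P ∘P (fstP ,P sndP ∘P sndP)) (fstP ∷P fstP ∘P sndP) (fstP ∘P sndP))
              (con 1 ⊞ var) growth XS []P)
      where
      step : El (A ⊗ ([ A ] ⊗ Γ)) → List (El A)
      step s = if p (proj₁ s , proj₂ (proj₂ s)) then proj₁ s ∷ proj₁ (proj₂ s) else proj₁ (proj₂ s)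

      growth : ∀ x b γ → ∥_∥ {[ A ]} (step (x , b , γ)) ≤ ∥_∥ {[ A ]} b + suc (suc (∥ x ∥ + ∥ γ ∥))
      growth x b γ with p (x , γ)
      ... | true  = ≤-trans (≤-reflexive (trans (cong suc (+-comm ∥ x ∥ _)) (sym (+-suc _ ∥ x ∥))))
                            (+-monoʳ-≤ (∥_∥ {[ A ]} b) (s≤s (m≤n⇒m≤1+n (m≤m+n ∥ x ∥ ∥ γ ∥))))
      ... | false = m≤m+n _ _

      lemma : ∀ (p : El A → Bool) xs → foldr (λ x a → if p x then x ∷ a else a) [] xs ≡ filterᵇ p xs
      lemma p []       = refl
      lemma p (x ∷ xs) with p x
      ... | true  = cong (x ∷_) (lemma p xs)
      ... | false = lemma p xs

  ∥++∥ : ∀ {A} (xs ys : List (El A)) → ∥_∥ {[ A ]} (xs ++ ys) ≤ ∥_∥ {[ A ]} ys + ∥_∥ {[ A ]} xs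
  ∥++∥     []       ys = m≤m+n _ 1
  ∥++∥ {A} (x ∷ xs) ys = begin
    suc (∥ x ∥ + ∥_∥ {[ A ]} (xs ++ ys))  ≤⟨ s≤s (+-monoʳ-≤ ∥ x ∥ (∥++∥ {A} xs ys)) ⟩
    suc (∥ x ∥ + (b + a))                 ≡⟨ cong suc (+-assoc ∥ x ∥ b a) ⟨
    suc (∥ x ∥ + b + a)                   ≡⟨ cong (λ z → suc (z + a)) (+-comm ∥ x ∥ b) ⟩
    suc (b + ∥ x ∥ + a)                   ≡⟨ cong suc (+-assoc b ∥ x ∥ a) ⟩
    suc (b + (∥ x ∥ + a))                 ≡⟨ +-suc b _ ⟨
    b + suc (∥ x ∥ + a)                   ∎
    where
    open ≤-Reasoning
    a = ∥_∥ {[ A ]} xs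
    b = ∥_∥ {[ A ]} ys

  module _ {Γ A B : Ty} {h : El (A ⊗ Γ) → List (El B)} {xs : El Γ → List (El A)} where

    concatMapP : PolyTime h → PolyTime xs →
                 PolyTime {Γ} {[ B ]} (λ γ → concatMap (λ x → h (x , γ)) (xs γ))
    concatMapP H XS = ext (λ γ → lemma (λ x → h (x , γ)) (xs γ))
      (foldrP {A} {[ B ]} {Γ} (H ∘P (fstP ,P sndP ∘P sndP) ++P fstP ∘P sndP) (bound H)
              (λ x b γ → ≤-trans (∥++∥ {B} (h (x , γ)) b) (+-monoʳ-≤ (∥_∥ {[ B ]} b) (∥∥-bound H (x , γ))))
              XS []P)
      where
      lemma : ∀ (h : El A → List (El B)) xs → foldr (λ x a → h x ++ a) [] xs ≡ concatMap h xs
      lemma h []       = refl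
      lemma h (x ∷ xs) = cong (h x ++_) (lemma h xs)

  module _ {Γ A B C : Ty} {h : El (A ⊗ (B ⊗ Γ)) → El C} {xs : El Γ → List (El A)} {ys : El Γ → List (El B)} where

    productWithP : PolyTime h → PolyTime xs → PolyTime ys →
                   PolyTime {Γ} {[ C ]} (λ γ → cartesianProductWith (λ x y → h (x , y , γ)) (xs γ) (ys γ))
    productWithP H XS YS = ext (λ γ → lemma (λ x y → h (x , y , γ)) (xs γ) (ys γ))
      (concatMapP (mapP (H ∘P (fstP ∘P sndP ,P (fstP ,P sndP ∘P sndP))) (YS ∘P sndP)) XS)
      where
      lemma : ∀ (h : El A → El B → El C) xs ys →
              concatMap (λ x → map (h x) ys) xs ≡ cartesianProductWith h xs ys
      lemma h []       ys = refl
      lemma h (x ∷ xs) ys = cong (map (h x) ys ++_) (lemma h xs ys)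

  -- Ordered and with repetitions: then there are exactly `length xs ^ c` of them, the number on
  -- which the threshold rests, and short lists can be padded to full tuples.
  tuples : ∀ {A : Set} → ℕ → List A → List (List A)
  tuples zero    xs = [] ∷ []
  tuples (suc c) xs = cartesianProductWith _∷_ xs (tuples c xs)

  -- The exponent `c` is a constant of the program, not an input, which keeps the output polynomial.
  tuplesP : ∀ {Γ A} {xs : El Γ → List (El A)} c → PolyTime xs →
            PolyTime {Γ} {[ [ A ] ]} (λ γ → tuples c (xs γ))
  tuplesP zero    XS = []P ∷P []P
  tuplesP (suc c) XS = productWithP (fstP ∷P fstP ∘P sndP) XS (tuplesP c XS)

  lengthP : ∀ {Γ A} {xs : El Γ → List (El A)} → PolyTime xs → PolyTime (λ γ → length (xs γ))
  lengthP {Γ} {A} {xs} XS = ext (λ γ → lemma (xs γ))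
    (foldrP {A} {𝐍} {Γ} (sucP ∘P fstP ∘P sndP) (con 2) (λ _ n _ → ≤-reflexive (+-comm 2 (∥_∥ {𝐍} n))) XS zeroP)
    where
    lemma : ∀ (xs : List (El A)) → foldr (λ _ n → suc n) 0 xs ≡ length xs
    lemma []       = refl
    lemma (x ∷ xs) = cong suc (lemma xs)

  -- The numbers of remaining ticks are n - 1, ..., 0 in turn; pushing each to the front leaves them
  -- in ascending order.
  upToP : PolyTime {𝐍} {[ 𝐍 ]} upTo
  upToP = ext (λ n → trans (lemma n []) (++-identityʳ (upTo n)))
    (pushP {𝐍} {𝟙} (lengthP (sndP ∘P fstP)) ticksP []P)
    where
    lemma : ∀ n ns → tailFold (λ _ ys a → length ys ∷ a) (ticks n) ns ≡ upTo n ++ ns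
    lemma zero    ns = refl
    lemma (suc n) ns = begin
      tailFold _ (ticks n) (length (ticks n) ∷ ns) ≡⟨ cong (λ m → tailFold _ (ticks n) (m ∷ ns)) (length-replicate n) ⟩
      tailFold _ (ticks n) (n ∷ ns)                ≡⟨ lemma n (n ∷ ns) ⟩
      upTo n ++ (n ∷ ns)                           ≡⟨ ++-assoc (upTo n) (n ∷ []) ns ⟨
      (upTo n ∷ʳ n) ++ ns                          ≡⟨ cong (_++ ns) (upTo-∷ʳ n) ⟩
      upTo (suc n) ++ ns                           ∎
      where open ≡-Reasoning

  module _ {Γ : Ty} {m n : El Γ → ℕ} (M : PolyTime {Γ} {𝐍} m) (N : PolyTime {Γ} {𝐍} n) where

    +P : PolyTime (λ γ → m γ + n γ)
    +P = ext (λ γ → lemma (m γ) (n γ))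
      (foldrP {𝟙} {𝐍} {Γ} (sucP ∘P fstP ∘P sndP) (con 2) (λ _ n _ → ≤-reflexive (+-comm 2 (∥_∥ {𝐍} n)))
              (ticksP ∘P M) N)
      where
      lemma : ∀ m n → foldr (λ _ a → suc a) n (ticks m) ≡ m + n
      lemma zero    n = refl
      lemma (suc m) n = cong suc (lemma m n)

    ∸P : PolyTime (λ γ → m γ ∸ n γ)
    ∸P = ext (λ γ → lemma (m γ) (n γ))
      (foldrP {𝟙} {𝐍} {Γ} (predP ∘P fstP ∘P sndP) (con 0)
              (λ _ a _ → ≤-trans (shrink a) (m≤m+n _ 0)) (ticksP ∘P N) M)
      where
      shrink : ∀ a → ∥_∥ {𝐍} (pred a) ≤ ∥_∥ {𝐍} a
      shrink zero    = ≤-refl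
      shrink (suc a) = m≤n⇒m≤o+n 2 ≤-refl

      lemma : ∀ m n → foldr (λ _ a → pred a) m (ticks n) ≡ m ∸ n
      lemma m zero    = refl
      lemma m (suc n) = trans (cong pred (lemma m n)) (pred[m∸n]≡m∸[1+n] m n)

  module _ {Γ : Ty} {m n : El Γ → ℕ} (M : PolyTime {Γ} {𝐍} m) (N : PolyTime {Γ} {𝐍} n) where

    *P : PolyTime (λ γ → m γ * n γ)
    *P = ext (λ γ → lemma (m γ) (n γ))
      (foldrP {𝟙} {𝐍} {Γ} (+P (N ∘P sndP ∘P sndP) (fstP ∘P sndP)) (bound N)
              (λ _ a γ → ≤-trans (∥+∥ (n γ) a) (+-monoʳ-≤ (∥_∥ {𝐍} a)
                (≤-trans (∥∥-bound N γ) (⟦⟧-mono (bound N) (m≤n⇒m≤o+n 2 ≤-refl)))))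
              (ticksP ∘P M) zeroP)
      where
      ∥+∥ : ∀ m n → ∥_∥ {𝐍} (m + n) ≤ ∥_∥ {𝐍} n + ∥_∥ {𝐍} m
      ∥+∥ zero    n = m≤m+n _ 1
      ∥+∥ (suc m) n = ≤-trans (s≤s (s≤s (∥+∥ m n)))
        (≤-reflexive (sym (trans (+-suc (∥_∥ {𝐍} n) _) (cong suc (+-suc (∥_∥ {𝐍} n) _)))))

      lemma : ∀ m n → foldr (λ _ a → n + a) 0 (ticks m) ≡ m * n
      lemma zero    n = refl
      lemma (suc m) n = cong (n +_) (lemma m n)

    ≤ᵇP : PolyTime (λ γ → m γ ≤ᵇ n γ)
    ≤ᵇP = ext (λ γ → lemma (m γ) (n γ)) (is0P ∘P ∸P M N)
      where
      lemma′ : ∀ m n → is0 (m ∸ n) ≡ (m <ᵇ suc n)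
      lemma′ zero    zero    = refl
      lemma′ zero    (suc n) = refl
      lemma′ (suc m) zero    = refl
      lemma′ (suc m) (suc n) = lemma′ m n

      lemma : ∀ m n → is0 (m ∸ n) ≡ (m ≤ᵇ n)
      lemma zero    zero    = refl
      lemma zero    (suc n) = refl
      lemma (suc m) zero    = refl
      lemma (suc m) (suc n) = lemma′ m n

    <ᵇP : PolyTime (λ γ → m γ <ᵇ n γ)
    <ᵇP = ext (λ γ → lemma (m γ) (n γ)) (notP ∘P is0P ∘P ∸P N M)
      where
      lemma : ∀ m n → not (is0 (n ∸ m)) ≡ (m <ᵇ n)
      lemma zero    zero    = refl
      lemma zero    (suc n) = refl
      lemma (suc m) zero    = refl
      lemma (suc m) (suc n) = lemma m n

    ≡ᵇP : PolyTime (λ γ → m γ ≡ᵇ n γ)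
    ≡ᵇP = ext (λ γ → lemma (m γ) (n γ)) (is0P ∘P ∸P M N ∧P is0P ∘P ∸P N M)
      where
      lemma : ∀ m n → is0 (m ∸ n) ∧ is0 (n ∸ m) ≡ (m ≡ᵇ n)
      lemma zero    zero    = refl
      lemma zero    (suc n) = refl
      lemma (suc m) zero    = refl
      lemma (suc m) (suc n) = lemma m n

  ^P : ∀ {Γ} {m : El Γ → ℕ} → PolyTime {Γ} {𝐍} m → ∀ c → PolyTime {Γ} {𝐍} (λ γ → m γ ^ c)
  ^P M zero    = constℕP 1
  ^P M (suc c) = *P M (^P M c)

  nth : ∀ {A : Set} → A → List A → ℕ → A
  nth d []       _       = d
  nth d (x ∷ xs) zero    = x
  nth d (x ∷ xs) (suc i) = nth d xs i

  dropP : ∀ {Γ A} {xs : El Γ → List (El A)} {i : El Γ → ℕ} →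
          PolyTime i → PolyTime xs → PolyTime {Γ} {[ A ]} (λ γ → drop (i γ) (xs γ))
  dropP {Γ} {A} {xs} {i} I XS = ext (λ γ → lemma (i γ) (xs γ))
    (foldlP {𝟙} {[ A ]} {Γ}
            (list-caseP {f = λ _ → []} {g = λ s → proj₂ (proj₁ s)} []P (sndP ∘P fstP) (fstP ∘P sndP))
            (con 0) (λ _ ys _ → ≤-trans (shrink ys) (m≤m+n _ 0))
            (ticksP ∘P I) XS)
    where
    tail : List (El A) → List (El A)
    tail = list-case [] (λ _ ys → ys)

    shrink : ∀ ys → ∥_∥ {[ A ]} (tail ys) ≤ ∥_∥ {[ A ]} ys
    shrink []       = ≤-refl
    shrink (y ∷ ys) = m≤n⇒m≤o+n (suc ∥ y ∥) ≤-refl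

    lemma : ∀ i ys → foldl (λ zs _ → tail zs) ys (ticks i) ≡ drop i ys
    lemma zero    ys       = refl
    lemma (suc i) []       = trans (lemma i []) (drop-[] i)
    lemma (suc i) (y ∷ ys) = lemma i ys

  nthP : ∀ {Γ A} {d : El Γ → El A} {xs : El Γ → List (El A)} {i : El Γ → ℕ} →
         PolyTime d → PolyTime xs → PolyTime i → PolyTime (λ γ → nth (d γ) (xs γ) (i γ))
  nthP {d = d} {xs} {i} D XS I = ext (λ γ → lemma (d γ) (xs γ) (i γ))
    (list-caseP {g = λ s → proj₁ (proj₁ s)} D (fstP ∘P fstP) (dropP I XS))
    where
    lemma : ∀ {A : Set} (d : A) xs i → list-case d (λ x _ → x) (drop i xs) ≡ nth d xs i
    lemma d []       zero    = refl
    lemma d []       (suc i) = refl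
    lemma d (x ∷ xs) zero    = refl
    lemma d (x ∷ xs) (suc i) = lemma d xs i

  eqList : List ℕ → List ℕ → Bool
  eqList []       []       = true
  eqList []       (_ ∷ _)  = false
  eqList (_ ∷ _)  []       = false
  eqList (x ∷ xs) (y ∷ ys) = (x ≡ᵇ y) ∧ eqList xs ys

  -- A fold over the first list consumes the second. If the second runs out too early, the state
  -- falls to `false , []` and never recovers; if it is too long, the leftover is noticed at the
  -- end.
  eqListP : ∀ {Γ} {xs ys : El Γ → List ℕ} → PolyTime {Γ} {[ 𝐍 ]} xs → PolyTime {Γ} {[ 𝐍 ]} ys →
            PolyTime (λ γ → eqList (xs γ) (ys γ))
  eqListP {Γ} {xs} {ys} XS YS = ext (λ γ → lemma (xs γ) true (ys γ))
    (list-caseP {f = proj₁} {g = λ _ → false} fstP falseP sndP ∘P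
      foldlP {𝐍} {𝔹 ⊗ [ 𝐍 ]} {Γ} {step = λ s → step (proj₁ s) (proj₁ (proj₂ s))}
        (list-caseP {f = λ _ → false , []}
                    {g = λ s → (proj₁ (proj₁ (proj₂ (proj₂ s))) ∧ (proj₁ (proj₂ s) ≡ᵇ proj₁ (proj₁ s))) , proj₂ (proj₁ s)}
                    (falseP ,P []P)
                    (fstP ∘P fstP ∘P sndP ∘P sndP ∧P ≡ᵇP (fstP ∘P sndP) (fstP ∘P fstP) ,P sndP ∘P fstP)
                    (sndP ∘P fstP ∘P sndP))
        (con 3) (λ x a _ → growth x a) XS (trueP ,P YS))
    where
    step : ℕ → Bool × List ℕ → Bool × List ℕ
    step x (b , ys) = list-case (false , []) (λ y zs → b ∧ (x ≡ᵇ y) , zs) ys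

    growth : ∀ x a → ∥_∥ {𝔹 ⊗ [ 𝐍 ]} (step x a) ≤ ∥_∥ {𝔹 ⊗ [ 𝐍 ]} a + 3
    growth x (b , [])     = m≤n+m 3 (∥_∥ {𝔹 ⊗ [ 𝐍 ]} (b , []))
    growth x (b , y ∷ zs) = s≤s (≤-trans (+-mono-≤ (∥bool∥≤3 (b ∧ (x ≡ᵇ y))) ≤-refl)
      (≤-trans (≤-reflexive (+-comm 3 _))
               (+-monoˡ-≤ 3 (m≤n⇒m≤o+n (∥_∥ {𝔹} b) (m≤n⇒m≤o+n (suc (∥_∥ {𝐍} y)) ≤-refl)))))

    result : Bool × List ℕ → Bool
    result a = list-case (proj₁ a) (λ _ _ → false) (proj₂ a)

    dead : ∀ xs ys → result (foldl (λ a x → step x a) (false , ys) xs) ≡ false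
    dead []       []       = refl
    dead []       (_ ∷ _)  = refl
    dead (x ∷ xs) []       = dead xs []
    dead (x ∷ xs) (y ∷ ys) = dead xs ys

    lemma : ∀ xs b ys → result (foldl (λ a x → step x a) (b , ys) xs) ≡ b ∧ eqList xs ys
    lemma []       b []       = sym (∧-identityʳ b)
    lemma []       b (y ∷ ys) = sym (∧-zeroʳ b)
    lemma (x ∷ xs) b []       = trans (dead xs []) (sym (∧-zeroʳ b))
    lemma (x ∷ xs) b (y ∷ ys) = trans (lemma xs (b ∧ (x ≡ᵇ y)) ys) (∧-assoc b (x ≡ᵇ y) (eqList xs ys))

open Programs

-- Composing an fpt-reduction with a polynomial-time reduction

module Reductions where

  open import Data.Nat.Base
  open import Data.Nat.Properties
  open import Data.Product.Base using (∃-syntax; _×_; _,_; proj₁; proj₂)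
  open import Function.Bundles using (_⇔_)
  open import Function.Construct.Composition using (_⇔-∘_)
  open import Relation.Binary.PropositionalEquality

  open PolyTime

  -- `g` has to be monotone because in a composition only an upper bound on the parameter of the
  -- intermediate instance is known.
  record PolyReduction (P Q : ParamProblem) : Set where
    private
      module P = ParamProblem P
      module Q = ParamProblem Q
    field
      {A B}       : Ty
      code        : P.Instance → El A
      encode-code : ∀ i → P.encode i ≡ enc (code i)
      transform   : El A → El B
      transformP  : PolyTime transform
      reduce      : P.Instance → Q.Instance
      encode-red  : ∀ i → Q.encode (reduce i) ≡ enc (transform (code i))
      equivalent  : ∀ i → P.Yes i ⇔ Q.Yes (reduce i)
      g           : ℕ → ℕ
      gP          : PolyTime {𝐍} {𝐍} g
      g-mono      : ∀ {m n} → m ≤ n → g m ≤ g n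
      param-bound : ∀ i → Q.param (reduce i) ≤ g (P.param i)

  *-^-distrib : ∀ c m n → (m * n) ^ c ≡ m ^ c * n ^ c
  *-^-distrib zero    m n = refl
  *-^-distrib (suc c) m n = trans (cong (m * n *_) (*-^-distrib c m n)) ([m*n]*[o*p]≡[m*o]*[n*p] m n (m ^ c) (n ^ c))

  computable-∘ : ∀ {f g : ℕ → ℕ} → PolyTime {𝐍} {𝐍} g → Computable f → Computable (λ n → g (f n))
  computable-∘ {f} G (p , run-f) = p ⨾ prog G , λ n →
    let _ , r = run-f n ; _ , q , _ = run G (f n) in _ , ⇓seq r q

  -- The intermediate instance is no larger than the time `t₁` spent on writing it, so the total
  -- time is polynomial in `t₁`. With a single monomial as bound, the power of f(k) · s^c splits
  -- again into a function of k and a power of s.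
  ≤ᶠᵖᵗ-polyReduction : ∀ {P Q R} → P ≤ᶠᵖᵗ Q → PolyReduction Q R → P ≤ᶠᵖᵗ R
  ≤ᶠᵖᵗ-polyReduction {P} {Q} {R} P≤Q Q≤R = record
    { program      = F.program ⨾ prog G.transformP
    ; f            = λ n → a * F.f n ^ b
    ; h            = λ n → G.g (F.h n)
    ; c            = F.c * b
    ; f-computable = computable-∘ {g = λ n → a * n ^ b} (*P (constℕP a) (^P idP b)) F.f-computable
    ; h-computable = computable-∘ G.gP F.h-computable
    ; reduce       = λ i → G.reduce (F.reduce i)
    ; equivalent   = λ i → G.equivalent (F.reduce i) ⇔-∘ F.equivalent i
    ; param-bound  = λ i → ≤-trans (G.param-bound (F.reduce i)) (G.g-mono (F.param-bound i))
    ; computes     = computes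
    }
    where
    module P = ParamProblem P
    module Q = ParamProblem Q
    module R = ParamProblem R
    module F = _≤ᶠᵖᵗ_ P≤Q
    module G = PolyReduction Q≤R

    total : Pol
    total = con 1 ⊞ (var ⊞ bound G.transformP)

    a b : ℕ
    a = proj₁ (monomial-bound total)
    b = proj₁ (proj₂ (monomial-bound total))

    computes : ∀ i → ∃[ t ] (F.program ⨾ prog G.transformP ⊢ P.encode i ⇓ R.encode (G.reduce (F.reduce i)) [ t ]
                           × t ≤ a * F.f (P.param i) ^ b * size (P.encode i) ^ (F.c * b))
    computes i =
      let j            = F.reduce i
          k            = F.f (P.param i)
          s            = size (P.encode i)
          t₁ , r₁ , t₁≤ = F.computes i
          t₂ , r₂ , t₂≤ = run G.transformP (G.code j)
          x≤t₁ = subst (λ x → size x ≤ t₁) (G.encode-code j) (output≤time r₁)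
      in suc (t₁ + t₂)
       , ⇓seq (subst (λ x → F.program ⊢ P.encode i ⇓ x [ t₁ ]) (G.encode-code j) r₁)
              (subst (λ y → prog G.transformP ⊢ enc (G.code j) ⇓ y [ t₂ ]) (sym (G.encode-red j)) r₂)
       , (begin
            suc (t₁ + t₂)                        ≤⟨ s≤s (+-monoʳ-≤ t₁ (≤-trans t₂≤ (⟦⟧-mono (bound G.transformP) x≤t₁))) ⟩
            ⟦ total ⟧ t₁                         ≤⟨ proj₂ (proj₂ (monomial-bound total)) (≤-trans (1≤size _) (output≤time r₁)) ⟩
            a * t₁ ^ b                           ≤⟨ *-monoʳ-≤ a (^-monoˡ-≤ b t₁≤) ⟩
            a * (k * s ^ F.c) ^ b                ≡⟨ cong (a *_) (*-^-distrib b k (s ^ F.c)) ⟩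
            a * (k ^ b * (s ^ F.c) ^ b)          ≡⟨ *-assoc a (k ^ b) _ ⟨
            a * k ^ b * (s ^ F.c) ^ b            ≡⟨ cong (a * k ^ b *_) (^-*-assoc s F.c b) ⟩
            a * k ^ b * s ^ (F.c * b)            ∎)
      where open ≤-Reasoning

open Reductions

-- Counting with duplicate-free lists; general facts about runs

module Counting where

  open import Data.Bool.Base using (true; false; T)
  open import Data.Bool.Properties using (T?)
  open import Data.Fin.Base using (Fin; zero; suc)
  import Data.Fin.Properties as Fin
  open import Data.Fin.Properties using (any?)
  open import Data.Fin.Subset as Subset using (Subset; ∣_∣; ⁅_⁆; _∪_)
  open import Data.Fin.Subset.Properties as Subset using (_∈?_; x∈p∪q⁺; x∈⁅x⁆; ∣p∣≤n; p⊂q⇒∣p∣<∣q∣; ∣p∣≡n⇒p≡⊤; ∈⊤)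
  open import Data.List.Base as List using (List; []; _∷_; length; _++_; map; filterᵇ; cartesianProductWith; lookup)
  open import Data.List.Membership.Propositional using (_∈_)
  open import Data.List.Membership.Propositional.Properties
  open import Data.List.Properties using (length-map; length-++)
  open import Data.List.Relation.Unary.All as All using (All; []; _∷_)
  open import Data.List.Relation.Unary.All.Properties using (¬Any⇒All¬)
  open import Data.List.Relation.Unary.AllPairs using ([]; _∷_)
  open import Data.List.Relation.Unary.Any as Any using (here; there)
  open import Data.List.Relation.Unary.Unique.Propositional using (Unique)
  import Data.List.Relation.Unary.Unique.Propositional.Properties as Unique
  open import Data.Nat.Base
  open import Data.Nat.Properties
  open import Data.Product.Base using (∃-syntax; _×_; _,_)
  open import Data.Sum.Base using (_⊎_; inj₁; inj₂)
  open import Data.Vec.Base as Vec using ([]; _∷_; here; there)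
  open import Data.Vec.Properties using (lookup∘tabulate; []=⇒lookup; lookup⇒[]=)
  open import Function.Base using (_∘_; case_of_)
  open import Relation.Binary.PropositionalEquality
  open import Relation.Nullary using (¬_; Dec; yes; no; contradiction)
  open import Relation.Nullary.Decidable using (does; ¬?; _×-dec_; _⊎-dec_; decidable-stable; dec-true)

  length-productWith : ∀ {A B C : Set} (f : A → B → C) xs ys → length (cartesianProductWith f xs ys) ≡ length xs * length ys
  length-productWith f []       ys = refl
  length-productWith f (x ∷ xs) ys =
    trans (length-++ (map (f x) ys)) (cong₂ _+_ (length-map (f x) ys) (length-productWith f xs ys))

  module _ {A : Set} where

    length-⊆ : ∀ {xs ys : List A} → Unique xs → (∀ {x} → x ∈ xs → x ∈ ys) → length xs ≤ length ys
    length-⊆ {[]}                 _          _     = z≤n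
    length-⊆ {x ∷ xs} {ys} (x∉xs ∷ uniq) xs⊆ys with ∈-∃++ (xs⊆ys (here refl))
    ... | as , bs , refl = begin
      suc (length xs)             ≤⟨ s≤s (length-⊆ uniq (λ y∈xs → remove as (xs⊆ys (there y∈xs))
                                       (λ { refl → All.lookup x∉xs y∈xs refl }))) ⟩
      suc (length (as ++ bs))     ≡⟨ cong suc (length-++ as) ⟩
      suc (length as + length bs) ≡⟨ +-suc (length as) (length bs) ⟨
      length as + suc (length bs) ≡⟨ length-++ as ⟨
      length (as ++ x ∷ bs)       ∎
      where
      open ≤-Reasoning
      remove : ∀ as {bs y} → y ∈ as ++ x ∷ bs → y ≢ x → y ∈ as ++ bs
      remove []       (here y≡x)  y≢x = contradiction y≡x y≢x
      remove []       (there p)   _   = p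
      remove (a ∷ as) (here y≡a)  _   = here y≡a
      remove (a ∷ as) (there p)   y≢x = there (remove as p y≢x)

    lookup-injective : ∀ {xs : List A} → Unique xs → ∀ {i j} → lookup xs i ≡ lookup xs j → i ≡ j
    lookup-injective (x∉xs ∷ uniq) {zero}  {zero}  _  = refl
    lookup-injective (x∉xs ∷ uniq) {zero}  {suc j} eq = contradiction eq (All.lookup x∉xs (∈-lookup j))
    lookup-injective (x∉xs ∷ uniq) {suc i} {zero}  eq = contradiction (sym eq) (All.lookup x∉xs (∈-lookup i))
    lookup-injective (x∉xs ∷ uniq) {suc i} {suc j} eq = cong suc (lookup-injective uniq eq)

    ∈-tuples⁺ : ∀ {xs : List A} {t} → All (_∈ xs) t → t ∈ tuples (length t) xs
    ∈-tuples⁺ []         = here refl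
    ∈-tuples⁺ (x∈xs ∷ t) = ∈-cartesianProductWith⁺ _∷_ x∈xs (∈-tuples⁺ t)

    ∈-tuples⁻ : ∀ c {xs : List A} {t} → t ∈ tuples c xs → length t ≡ c × All (_∈ xs) t
    ∈-tuples⁻ zero         (here refl) = refl , []
    ∈-tuples⁻ (suc c) {xs} t∈ with ∈-cartesianProductWith⁻ _∷_ xs (tuples c xs) t∈
    ... | x , u , x∈xs , u∈ , refl with ∈-tuples⁻ c u∈
    ... | refl , all = refl , x∈xs ∷ all

    tuples-unique : ∀ c {xs : List A} → Unique xs → Unique (tuples c xs)
    tuples-unique zero    _    = [] ∷ []
    tuples-unique (suc c) uniq =
      Unique.cartesianProductWith⁺ _∷_ (λ { refl → refl , refl }) uniq (tuples-unique c uniq)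

    length-tuples : ∀ c (xs : List A) → length (tuples c xs) ≡ length xs ^ c
    length-tuples zero    xs = refl
    length-tuples (suc c) xs = trans (length-productWith _∷_ xs (tuples c xs)) (cong (length xs *_) (length-tuples c xs))

    -- Turns the final count of saved leaves into a statement about every tuple.
    filterᵇ-full : ∀ p (xs : List A) → length xs ≤ length (filterᵇ p xs) → All (T ∘ p) xs
    filterᵇ-full p xs full = All.tabulate λ {x} x∈xs → decidable-stable (T? (p x)) λ ¬px →
      <⇒≱ (filter-notAll (T? ∘ p) xs (Any.map (λ { refl → ¬px }) x∈xs)) full
      where open import Data.List.Properties using (filter-notAll)

  -- As duplicate-free lists, sets can be compared by `length-⊆`, also after vertex numbers have
  -- been translated into vertices.
  elements : ∀ {n} → Subset n → List (Fin n)
  elements []          = []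
  elements (true ∷ p)  = zero ∷ map suc (elements p)
  elements (false ∷ p) = map suc (elements p)

  length-elements : ∀ {n} (p : Subset n) → length (elements p) ≡ ∣ p ∣
  length-elements []          = refl
  length-elements (true ∷ p)  = cong suc (trans (length-map suc (elements p)) (length-elements p))
  length-elements (false ∷ p) = trans (length-map suc (elements p)) (length-elements p)

  ∈-elements⁺ : ∀ {n} {p : Subset n} {i} → i Subset.∈ p → i ∈ elements p
  ∈-elements⁺ {p = true ∷ p}  here       = here refl
  ∈-elements⁺ {p = true ∷ p}  (there i∈) = there (∈-map⁺ suc (∈-elements⁺ i∈))
  ∈-elements⁺ {p = false ∷ p} (there i∈) = ∈-map⁺ suc (∈-elements⁺ i∈)

  ∈-elements⁻ : ∀ {n} {p : Subset n} {i} → i ∈ elements p → i Subset.∈ p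
  ∈-elements⁻ {p = true ∷ p}  (here refl) = here
  ∈-elements⁻ {p = true ∷ p}  (there i∈) with ∈-map⁻ suc i∈
  ... | _ , j∈ , refl = there (∈-elements⁻ j∈)
  ∈-elements⁻ {p = false ∷ p} i∈ with ∈-map⁻ suc i∈
  ... | _ , j∈ , refl = there (∈-elements⁻ j∈)

  elements-unique : ∀ {n} (p : Subset n) → Unique (elements p)
  elements-unique []          = []
  elements-unique (true ∷ p)  = ¬Any⇒All¬ _ (λ 0∈ → case ∈-map⁻ suc 0∈ of λ { (_ , _ , ()) })
                              ∷ Unique.map⁺ Fin.suc-injective (elements-unique p)
  elements-unique (false ∷ p) = Unique.map⁺ Fin.suc-injective (elements-unique p)

  ∣∪∣≤∣∣+∣∣ : ∀ {n} (p q : Subset n) → ∣ p ∪ q ∣ ≤ ∣ p ∣ + ∣ q ∣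
  ∣∪∣≤∣∣+∣∣ []          []          = z≤n
  ∣∪∣≤∣∣+∣∣ (false ∷ p) (false ∷ q) = ∣∪∣≤∣∣+∣∣ p q
  ∣∪∣≤∣∣+∣∣ (false ∷ p) (true ∷ q)  = ≤-trans (s≤s (∣∪∣≤∣∣+∣∣ p q)) (≤-reflexive (sym (+-suc ∣ p ∣ ∣ q ∣)))
  ∣∪∣≤∣∣+∣∣ (true ∷ p)  (false ∷ q) = s≤s (∣∪∣≤∣∣+∣∣ p q)
  ∣∪∣≤∣∣+∣∣ (true ∷ p)  (true ∷ q)  = s≤s (≤-trans (∣∪∣≤∣∣+∣∣ p q) (+-monoʳ-≤ ∣ p ∣ (n≤1+n ∣ q ∣)))

  ∈-tabulate-does⁺ : ∀ {n} {P : Fin n → Set} (P? : ∀ i → Dec (P i)) {i} → P i → i Subset.∈ Vec.tabulate (λ j → does (P? j))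
  ∈-tabulate-does⁺ P? {i} pi = lookup⇒[]= i _ (trans (lookup∘tabulate _ i) (dec-true (P? i) pi))

  ∈-tabulate-does⁻ : ∀ {n} {P : Fin n → Set} (P? : ∀ i → Dec (P i)) {i} → i Subset.∈ Vec.tabulate (λ j → does (P? j)) → P i
  ∈-tabulate-does⁻ P? {i} i∈ with P? i | trans (sym (lookup∘tabulate (λ j → does (P? j)) i)) ([]=⇒lookup i∈)
  ... | yes pi | _  = pi
  ... | no _   | ()

  module Runs {n} (G : Graph (Fin n)) where
    open Graph G using (adj; Adj)
    open Firefighting G

    private
      _∈ˢ_ : Fin n → Subset n → Set
      _∈ˢ_ = Subset._∈_

      infix 4 _∈ˢ_

    Reached : State → Fin n → Set
    Reached σ v = v ∈ˢ burning σ ⊎ (¬ v ∈ˢ defended σ × ∃[ u ] u ∈ˢ burning σ × Adj u v)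

    reached? : ∀ σ v → Dec (Reached σ v)
    reached? σ v = v ∈? burning σ ⊎-dec (¬? (v ∈? defended σ) ×-dec any? (λ u → u ∈? burning σ ×-dec T? (adj u v)))

    spread⁺ : ∀ σ {v} → Reached σ v → v ∈ˢ burning (spread σ)
    spread⁺ σ = ∈-tabulate-does⁺ (reached? σ)

    spread⁻ : ∀ σ {v} → v ∈ˢ burning (spread σ) → Reached σ v
    spread⁻ σ = ∈-tabulate-does⁻ (reached? σ)

    ⟶*-preserves : (Inv : State → Set) →
                   (∀ σ v → ¬ v ∈ˢ burning σ → Inv σ → Inv (spread (defend v σ))) →
                   ∀ {σ τ} → σ ⟶* τ → Inv σ → Inv τ
    ⟶*-preserves Inv pres (stop _)         inv = inv
    ⟶*-preserves Inv pres (step _ v v∉B r) inv = ⟶*-preserves Inv pres r (pres _ v v∉B inv)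

    burning-mono : ∀ {σ τ} → σ ⟶* τ → ∀ {v} → v ∈ˢ burning σ → v ∈ˢ burning τ
    burning-mono r {v} = ⟶*-preserves (λ ρ → v ∈ˢ burning ρ) (λ σ w _ v∈ → spread⁺ (defend w σ) (inj₁ v∈)) r

    canSpread? : ∀ σ → Dec (CanSpread σ)
    canSpread? σ = any? λ u → any? λ v →
      u ∈? burning σ ×-dec T? (adj u v) ×-dec ¬? (v ∈? burning σ) ×-dec ¬? (v ∈? defended σ)

    -- Only complete runs count as strategies. Defending a vertex that the fire is about to reach
    -- always enlarges the defended set, so a bound `m` on the number of undefended vertices serves
    -- as fuel.
    completable : ∀ σ → ∃[ τ ] σ ⟶* τ
    completable σ = go n σ (m≤m+n n _)
      where
      go : ∀ m σ → n ≤ m + ∣ defended σ ∣ → ∃[ τ ] σ ⟶* τ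
      go m σ n≤ with canSpread? σ
      go m       σ n≤ | no ¬cs = σ , stop ¬cs
      go zero    σ n≤ | yes (_ , v , _ , _ , _ , v∉D) =
        contradiction (subst (v ∈ˢ_) (sym (∣p∣≡n⇒p≡⊤ (≤-antisym (∣p∣≤n (defended σ)) n≤))) ∈⊤) v∉D
      go (suc m) σ n≤ | yes cs@(_ , v , _ , _ , v∉B , v∉D) =
        let τ , r = go m (spread (defend v σ)) (≤-trans n≤ (≤-trans (≤-reflexive (sym (+-suc m _)))
                      (+-monoʳ-≤ m (p⊂q⇒∣p∣<∣q∣ ((λ x∈ → x∈p∪q⁺ (inj₂ x∈)) , v , x∈p∪q⁺ (inj₁ (x∈⁅x⁆ v)) , v∉D)))))
        in τ , step cs v v∉B r

    ∣defend∣ : ∀ v σ → ∣ defended (defend v σ) ∣ ≤ suc ∣ defended σ ∣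
    ∣defend∣ v σ = ≤-trans (∣∪∣≤∣∣+∣∣ ⁅ v ⁆ (defended σ)) (+-monoˡ-≤ _ (≤-reflexive (Subset.∣⁅x⁆∣≡1 v)))

open Counting

-- The layered graph with its clique and leaves

module FireGadget where

  open import Data.Bool.Base using (Bool; true; false; T; not)
  open import Data.Bool.Properties using (T-≡; T?)
  open import Data.Empty using (⊥)
  open import Data.Fin.Base using (Fin; zero; suc)
  open import Data.Fin.Properties using (any?)
  open import Data.Fin.Subset as Subset using (Subset; ∣_∣; ⁅_⁆; ∁)
  open import Data.Fin.Subset.Properties as Subset using (_∈?_; x∈p∪q⁺; x∈p∪q⁻; x∈⁅x⁆; x∈⁅y⁆⇒x≡y; x∉p⇒x∈∁p; x∈∁p⇒x∉p)
  open import Data.List.Base as List using (List; []; _∷_; length; _++_; map; filter; filterᵇ; lookup)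
  open import Data.List.Membership.Propositional using (_∈_; _∉_)
  open import Data.List.Membership.Propositional.Properties
  open import Data.List.Properties using (length-map; length-++; length-filter)
  open import Data.List.Relation.Unary.All as All using (All; []; _∷_)
  open import Data.List.Relation.Unary.AllPairs using ([]; _∷_)
  open import Data.List.Relation.Unary.Any as Any using (here; there)
  open import Data.List.Relation.Unary.Any.Properties using (lookup-index)
  open import Data.List.Relation.Unary.Unique.Propositional using (Unique)
  import Data.List.Relation.Unary.Unique.Propositional.Properties as Unique
  open import Data.Nat.Base
  open import Data.Nat.Properties
  open import Data.Product.Base using (Σ-syntax; ∃-syntax; _×_; _,_; proj₁; proj₂)
  open import Data.Sum.Base using (_⊎_; inj₁; inj₂; [_,_]′)
  open import Data.Unit.Base using (tt)
  open import Data.Vec.Base as Vec using ([]; _∷_; here; there)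
  open import Data.Vec.Properties using (lookup∘tabulate; []=⇒lookup; lookup⇒[]=)
  open import Function.Base using (id; _∘_; case_of_)
  open import Function.Bundles using (mk⇔; Equivalence)
  open import Relation.Binary.Construct.Closure.ReflexiveTransitive as Star using (Star; ε; _◅_; _◅◅_)
  open import Relation.Binary.Definitions using (DecidableEquality)
  open import Relation.Binary.PropositionalEquality
  open import Relation.Nullary using (¬_; Dec; yes; no; contradiction)
  open import Relation.Nullary.Decidable using (does; ¬?; _×-dec_; decidable-stable; does-⇔)

  does⁺ : ∀ {P : Set} (P? : Dec P) → P → T (does P?)
  does⁺ (yes _) _ = tt
  does⁺ (no ¬p) p = ¬p p

  does⁻ : ∀ {P : Set} (P? : Dec P) → T (does P?) → P
  does⁻ (yes p) _ = p

  data Vertex (H : Set) : Set where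
    hub  : H → Vertex H
    leaf : Bool → List H → Vertex H

  module Gadget
    {H : Set} (_≟_ : DecidableEquality H) (level : H → ℕ)
    (K c : ℕ) (0<K : 0 < K) (s : H) (L A : List H)
    (hubs-unique : Unique (s ∷ L ++ A))
    (level-s : level s ≡ 0)
    (level-L : ∀ {h} → h ∈ s ∷ L → level h < K)
    (level-A : ∀ {h} → h ∈ A → level h ≡ K)
    (layer   : ∀ {i} → i < K → Σ[ hs ∈ List H ] Unique hs × length hs ≡ suc K
                                  × ∀ {h} → h ∈ hs → h ∈ s ∷ L × level h ≡ i)
    (good : List H → Bool)
    where

    -- Joining hubs whose levels differ by at most one makes level `K` a clique, lets a single
    -- burning hub ignite its own and the next level, and keeps the fire from climbing more than one
    -- level per step.
    Linked : Vertex H → Vertex H → Set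
    Linked (hub h)    (hub h′)   = h ≢ h′ × level h ≤ suc (level h′) × level h′ ≤ suc (level h)
    Linked (hub h)    (leaf _ t) = h ∈ t
    Linked (leaf _ t) (hub h)    = h ∈ t
    Linked (leaf _ _) (leaf _ _) = ⊥

    _∈ᴸ?_ : ∀ h t → Dec (h ∈ t)
    h ∈ᴸ? t = Any.any? (h ≟_) t

    linked? : ∀ u v → Dec (Linked u v)
    linked? (hub h)    (hub h′)   = ¬? (h ≟ h′) ×-dec (level h ≤? suc (level h′)) ×-dec (level h′ ≤? suc (level h))
    linked? (hub h)    (leaf _ t) = h ∈ᴸ? t
    linked? (leaf _ t) (hub h)    = h ∈ᴸ? t
    linked? (leaf _ _) (leaf _ _) = no id

    linked-sym : ∀ u v → Linked u v → Linked v u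
    linked-sym (hub _)    (hub _)    (h≢ , ≤₁ , ≤₂) = h≢ ∘ sym , ≤₂ , ≤₁
    linked-sym (hub _)    (leaf _ _) h∈t            = h∈t
    linked-sym (leaf _ _) (hub _)    h∈t            = h∈t

    linked-irrefl : ∀ u → ¬ Linked u u
    linked-irrefl (hub _) (h≢ , _) = h≢ refl

    -- Positive, so that every leaf has a neighbour and the graph is connected, and so that
    -- `_^ arity` is strictly monotone in the final count.
    arity : ℕ
    arity = suc c

    goodTuples : List (List H)
    goodTuples = filterᵇ good (tuples arity A)

    -- `hub s` is split off at the front so that the start of the fire is `zero` by computation.
    hubs tailVertices vertices : List (Vertex H)
    hubs         = map hub (s ∷ L ++ A)
    tailVertices = map hub (L ++ A) ++ map (leaf false) goodTuples ++ map (leaf true) goodTuples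
    vertices     = hub s ∷ tailVertices

    threshold : ℕ
    threshold = K + 2 * K ^ arity

    private
      N : ℕ
      N = length vertices

      V : Fin N → Vertex H
      V = lookup vertices

      leaf-injective : ∀ {b} {t u : List H} → leaf b t ≡ leaf b u → t ≡ u
      leaf-injective refl = refl

      A-unique : Unique A
      A-unique = go (s ∷ L) hubs-unique
        where
        go : ∀ xs → Unique (xs ++ A) → Unique A
        go []       u       = u
        go (_ ∷ xs) (_ ∷ u) = go xs u

      goodTuples-unique : Unique goodTuples
      goodTuples-unique = Unique.filter⁺ (T? ∘ good) (tuples-unique arity A-unique)

      copies-unique : ∀ {ts : List (List H)} → Unique ts → Unique (map (leaf false) ts ++ map (leaf true) ts)
      copies-unique uniq = Unique.++⁺ (Unique.map⁺ (leaf-injective {false}) uniq) (Unique.map⁺ (leaf-injective {true}) uniq)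
        λ { (v∈ , w∈) → case ∈-map⁻ (leaf false) v∈ , ∈-map⁻ (leaf true) w∈ of
            λ { ((_ , _ , refl) , (_ , _ , ())) } }

      hubs-leaves-disjoint : ∀ {hs : List H} {ts : List (List H)} {v} →
        ¬ (v ∈ map hub hs × v ∈ map (leaf false) ts ++ map (leaf true) ts)
      hubs-leaves-disjoint {ts = ts} (v∈ , w∈) with ∈-map⁻ hub v∈
      ... | _ , _ , refl with ∈-++⁻ (map (leaf false) ts) w∈
      ... | inj₁ w∈′ = case ∈-map⁻ (leaf false) w∈′ of λ { (_ , _ , ()) }
      ... | inj₂ w∈′ = case ∈-map⁻ (leaf true) w∈′ of λ { (_ , _ , ()) }

      vertices-unique : Unique vertices
      vertices-unique = Unique.++⁺ {xs = hubs} (Unique.map⁺ (λ { refl → refl }) hubs-unique)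
                                   (copies-unique goodTuples-unique) (hubs-leaves-disjoint {ts = goodTuples})

      V-injective : ∀ {i j} → V i ≡ V j → i ≡ j
      V-injective = lookup-injective vertices-unique

      vertex : ∀ {v} → v ∈ vertices → ∃[ i ] V i ≡ v
      vertex v∈ = Any.index v∈ , sym (lookup-index v∈)

      hub∈ : ∀ {h} → h ∈ s ∷ L ++ A → hub h ∈ vertices
      hub∈ h∈ = ∈-++⁺ˡ (∈-map⁺ hub h∈)

      A⊆ : ∀ {h} → h ∈ A → h ∈ s ∷ L ++ A
      A⊆ = ∈-++⁺ʳ (s ∷ L)

      layer⊆ : ∀ {h} → h ∈ s ∷ L → h ∈ s ∷ L ++ A
      layer⊆ = ∈-++⁺ˡ

      leaf∈ : ∀ b {t} → t ∈ goodTuples → leaf b t ∈ vertices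
      leaf∈ false t∈ = ∈-++⁺ʳ hubs (∈-++⁺ˡ (∈-map⁺ (leaf false) t∈))
      leaf∈ true  t∈ = ∈-++⁺ʳ hubs (∈-++⁺ʳ (map (leaf false) goodTuples) (∈-map⁺ (leaf true) t∈))

      hub∈⁻ : ∀ {h} → hub h ∈ vertices → h ∈ s ∷ L ++ A
      hub∈⁻ h∈ with ∈-++⁻ hubs h∈
      ... | inj₁ h∈′ = case ∈-map⁻ hub h∈′ of λ { (_ , h∈″ , refl) → h∈″ }
      ... | inj₂ h∈′ with ∈-++⁻ (map (leaf false) goodTuples) h∈′
      ... | inj₁ h∈″ = case ∈-map⁻ (leaf false) h∈″ of λ { (_ , _ , ()) }
      ... | inj₂ h∈″ = case ∈-map⁻ (leaf true) h∈″ of λ { (_ , _ , ()) }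

      leaf∈⁻ : ∀ {b t} → leaf b t ∈ vertices → t ∈ goodTuples
      leaf∈⁻ t∈ with ∈-++⁻ hubs t∈
      ... | inj₁ t∈′ = case ∈-map⁻ hub t∈′ of λ { (_ , _ , ()) }
      ... | inj₂ t∈′ with ∈-++⁻ (map (leaf false) goodTuples) t∈′
      ... | inj₁ t∈″ = case ∈-map⁻ (leaf false) t∈″ of λ { (_ , t∈‴ , refl) → t∈‴ }
      ... | inj₂ t∈″ = case ∈-map⁻ (leaf true) t∈″ of λ { (_ , t∈‴ , refl) → t∈‴ }

      V-hub : ∀ i {h} → V i ≡ hub h → h ∈ s ∷ L ++ A
      V-hub i eq = hub∈⁻ (subst (_∈ vertices) eq (∈-lookup i))

      V-leaf : ∀ i {b t} → V i ≡ leaf b t → t ∈ goodTuples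
      V-leaf i eq = leaf∈⁻ (subst (_∈ vertices) eq (∈-lookup i))

      good⇒tuple : ∀ {t} → t ∈ goodTuples → t ∈ tuples arity A
      good⇒tuple t∈ = proj₁ (∈-filter⁻ (T? ∘ good) {xs = tuples arity A} t∈)

      good⇒⊆A : ∀ {t} → t ∈ goodTuples → ∀ {h} → h ∈ t → h ∈ A
      good⇒⊆A t∈ = All.lookup (proj₂ (∈-tuples⁻ arity (good⇒tuple t∈)))

      level≤K : ∀ {h} → h ∈ s ∷ L ++ A → level h ≤ K
      level≤K h∈ with ∈-++⁻ (s ∷ L) h∈
      ... | inj₁ h∈L = <⇒≤ (level-L h∈L)
      ... | inj₂ h∈A = ≤-reflexive (level-A h∈A)

    graph : Graph (Fin N)
    graph = record
      { adj    = λ i j → does (linked? (V i) (V j))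
      ; sym    = λ i j → does-⇔ (mk⇔ (linked-sym (V i) (V j)) (linked-sym (V j) (V i))) (linked? (V i) (V j)) (linked? (V j) (V i))
      ; irrefl = λ i → Relation.Nullary.Decidable.dec-false (linked? (V i) (V i)) (linked-irrefl (V i))
      }

    open Graph graph using (Adj)

    private
      adj⁺ : ∀ i j → Linked (V i) (V j) → Adj i j
      adj⁺ i j = does⁺ (linked? (V i) (V j))

      adj⁻ : ∀ i j → Adj i j → Linked (V i) (V j)
      adj⁻ i j = does⁻ (linked? (V i) (V j))

      adj-as : ∀ i j {u v} → V i ≡ u → V j ≡ v → Linked u v → Adj i j
      adj-as i j refl refl = adj⁺ i j

      linked-as : ∀ i j {u v} → V i ≡ u → V j ≡ v → Adj i j → Linked u v
      linked-as i j refl refl = adj⁻ i j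

      hub-path : ∀ m i {h} → V i ≡ hub h → level h ≤ m → Star Adj i zero
      hub-path zero i {h} eq h≤ with h ≟ s
      ... | yes refl = subst (Star Adj i) (V-injective eq) ε
      ... | no h≢s   = adj-as i zero eq refl
                         (h≢s , m≤n⇒m≤1+n (≤-trans h≤ z≤n) , ≤-trans (≤-reflexive level-s) z≤n) ◅ ε
      hub-path (suc m) i {h} eq h≤ with m≤n⇒m<n∨m≡n h≤
      ... | inj₁ h<    = hub-path m i eq (s≤s⁻¹ h<)
      ... | inj₂ h≡1+m with layer {m} (≤-trans (≤-reflexive (sym h≡1+m)) (level≤K (V-hub i eq)))
      ... | h′ ∷ _ , _ , _ , props =
        let h′∈ , h′≡m = props (here refl)
            j , eq′    = vertex (hub∈ (layer⊆ h′∈))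
        in adj-as i j eq eq′ ( (λ { refl → 1+n≢n (trans (sym h≡1+m) h′≡m) })
                         , ≤-reflexive (trans h≡1+m (cong suc (sym h′≡m)))
                         , m≤n⇒m≤1+n (≤-trans (≤-reflexive h′≡m) (≤-trans (n≤1+n m) (≤-reflexive (sym h≡1+m)))))
           ◅ hub-path m j eq′ (≤-reflexive h′≡m)

      to-s : ∀ i → Star Adj i zero
      to-s i = go (V i) refl
        where
        go : ∀ v → V i ≡ v → Star Adj i zero
        go (hub h)    eq = hub-path _ i eq ≤-refl
        go (leaf b t) eq = let t∈ = V-leaf i eq in leaf-path t eq t∈ (proj₁ (∈-tuples⁻ arity {A} (good⇒tuple t∈)))
          where
          leaf-path : ∀ t → V i ≡ leaf b t → t ∈ goodTuples → length t ≡ arity → Star Adj i zero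
          leaf-path (h ∷ _) eq t∈ _ =
            let j , eq′ = vertex (hub∈ (A⊆ (good⇒⊆A t∈ (here refl))))
            in adj-as i j eq eq′ (here refl) ◅ hub-path _ j eq′ ≤-refl

      connected : Connected graph
      connected u v = to-s u ◅◅ Star.reverse (λ {i} {j} a → adj⁺ j i (linked-sym (V i) (V j) (adj⁻ i j a))) (to-s v)

    inLayer : Vertex H → Bool
    inLayer (hub h)    = level h <ᵇ K
    inLayer (leaf _ _) = false

    X : Subset N
    X = Vec.tabulate (inLayer ∘ V)

    private
      ∈X⁺ : ∀ i → T (inLayer (V i)) → i Subset.∈ X
      ∈X⁺ i t = lookup⇒[]= i X (trans (lookup∘tabulate (inLayer ∘ V) i) (Equivalence.to T-≡ t))

      isHub : Vertex H → Bool
      isHub (hub _)    = true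
      isHub (leaf _ _) = false

      split : IsSplit (graph ∖ X)
      split = (λ { (i , _) → isHub (V i) })
            , (λ { (i , i∉) (j , j∉) ci cj i≢j →
                   adj⁺ i j (clique i j (V i) (V j) refl refl ci cj i∉ j∉ λ i≡j → i≢j (Σ-≡ i≡j)) })
            , λ { (i , _) (j , _) ci cj a → independent (V i) (V j) ci cj (adj⁻ i j a) }
        where
        Σ-≡ : ∀ {i j} {i∉ : i Subset.∉ X} {j∉ : j Subset.∉ X} → i ≡ j → (i , i∉) ≡ (j , j∉)
        Σ-≡ {i} refl = refl
        clique : ∀ i j u v → V i ≡ u → V j ≡ v → T (isHub u) → T (isHub v) → i Subset.∉ X → j Subset.∉ X → i ≢ j → Linked u v
        clique i j (hub h) (hub h′) eq eq′ _ _ i∉ j∉ i≢j =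
            (λ { refl → i≢j (V-injective (trans eq (sym eq′))) })
          , ≤-trans (level≤K (V-hub i eq)) (m≤n⇒m≤1+n (high j eq′ j∉))
          , ≤-trans (level≤K (V-hub j eq′)) (m≤n⇒m≤1+n (high i eq i∉))
          where
          high : ∀ i {h} → V i ≡ hub h → i Subset.∉ X → K ≤ level h
          high i eq i∉ = ≮⇒≥ λ h<K → i∉ (∈X⁺ i (subst (T ∘ inLayer) (sym eq) (<⇒<ᵇ h<K)))
        independent : ∀ u v → T (not (isHub u)) → T (not (isHub v)) → ¬ Linked u v
        independent (leaf _ _) (leaf _ _) _ _ ()

    firefighting : FirefightingInstance IsSplit
    firefighting = record
      { G = graph ; connected = connected ; s = zero ; X = X ; modulator = split ; k = threshold }

    ∣X∣≤∣layers∣ : ∣ X ∣ ≤ length (s ∷ L)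
    ∣X∣≤∣layers∣ = begin
      ∣ X ∣                       ≡⟨ length-elements X ⟨
      length (elements X)         ≡⟨ length-map V (elements X) ⟨
      length (map V (elements X)) ≤⟨ length-⊆ (Unique.map⁺ V-injective (elements-unique X)) ⊆layers ⟩
      length (map hub (s ∷ L))    ≡⟨ length-map hub (s ∷ L) ⟩
      length (s ∷ L)              ∎
      where
      open ≤-Reasoning

      in-layers : ∀ i v → V i ≡ v → T (inLayer v) → v ∈ map hub (s ∷ L)
      in-layers i (hub h) eq h<K with ∈-++⁻ (s ∷ L) (V-hub i eq)
      ... | inj₁ h∈L = ∈-map⁺ hub h∈L
      ... | inj₂ h∈A = contradiction (level-A h∈A) (<⇒≢ (<ᵇ⇒< _ _ h<K))

      ∈X⁻ : ∀ i → i Subset.∈ X → T (inLayer (V i))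
      ∈X⁻ i i∈ = subst T (trans (sym ([]=⇒lookup {xs = X} i∈)) (lookup∘tabulate (inLayer ∘ V) i)) tt

      ⊆layers : ∀ {v} → v ∈ map V (elements X) → v ∈ map hub (s ∷ L)
      ⊆layers v∈ with ∈-map⁻ V {xs = elements X} v∈
      ... | i , i∈ , refl = in-layers i (V i) refl
        (∈X⁻ i (∈-elements⁻ {p = X} i∈))

    open Firefighting graph
    open Runs graph

    record Selection (D : List H) : Set where
      field
        unique   : Unique D
        ⊆A       : ∀ {h} → h ∈ D → h ∈ A
        size≡K   : length D ≡ K
        all-good : All (T ∘ good) (tuples arity D)

    private
      _∈ˢ_ _∉ˢ_ : Fin N → Subset N → Set
      _∈ˢ_ = Subset._∈_
      _∉ˢ_ = Subset._∉_

      infix 4 _∈ˢ_ _∉ˢ_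

      hub≟ : ∀ v h → Dec (v ≡ hub h)
      hub≟ (hub h′)   h with h′ ≟ h
      ... | yes refl = yes refl
      ... | no h′≢h  = no λ { refl → h′≢h refl }
      hub≟ (leaf _ _) h = no λ ()

      double-copies : ∀ (ts : List (List H)) → length (map (leaf false) ts ++ map (leaf true) ts) ≡ 2 * length ts
      double-copies ts = trans (length-++ (map (leaf false) ts))
        (trans (cong₂ _+_ (length-map (leaf false) ts) (length-map (leaf true) ts))
               (cong (length ts +_) (sym (+-identityʳ (length ts)))))

      -- From a selection to a saving strategy

      module Save {D : List H} (selection : Selection D) where
        open Selection selection

        saved : List (Vertex H)
        saved = map hub D ++ map (leaf false) (tuples arity D) ++ map (leaf true) (tuples arity D)

        saved-hub : ∀ {h} → hub h ∈ saved → h ∈ D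
        saved-hub h∈ with ∈-++⁻ (map hub D) h∈
        ... | inj₁ h∈′ = case ∈-map⁻ hub h∈′ of λ { (_ , h∈D , refl) → h∈D }
        ... | inj₂ h∈′ with ∈-++⁻ (map (leaf false) (tuples arity D)) h∈′
        ... | inj₁ h∈″ = case ∈-map⁻ (leaf false) h∈″ of λ { (_ , _ , ()) }
        ... | inj₂ h∈″ = case ∈-map⁻ (leaf true) h∈″ of λ { (_ , _ , ()) }

        saved-leaf : ∀ {b t} → leaf b t ∈ saved → t ∈ tuples arity D
        saved-leaf t∈ with ∈-++⁻ (map hub D) t∈
        ... | inj₁ t∈′ = case ∈-map⁻ hub t∈′ of λ { (_ , _ , ()) }
        ... | inj₂ t∈′ with ∈-++⁻ (map (leaf false) (tuples arity D)) t∈′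
        ... | inj₁ t∈″ = case ∈-map⁻ (leaf false) t∈″ of λ { (_ , t∈D , refl) → t∈D }
        ... | inj₂ t∈″ = case ∈-map⁻ (leaf true) t∈″ of λ { (_ , t∈D , refl) → t∈D }

        hub-saved : ∀ {h} → h ∈ D → hub h ∈ saved
        hub-saved h∈D = ∈-++⁺ˡ (∈-map⁺ hub h∈D)

        tuple-good : ∀ {t} → t ∈ tuples arity D → t ∈ goodTuples
        tuple-good {t} t∈ = ∈-filter⁺ (T? ∘ good)
          (let len , all = ∈-tuples⁻ arity {D} t∈ in subst (λ a → t ∈ tuples a A) len (∈-tuples⁺ (All.map ⊆A all)))
          (All.lookup all-good t∈)

        saved⊆vertices : ∀ v → v ∈ saved → v ∈ vertices
        saved⊆vertices (hub h)    v∈ = hub∈ (A⊆ (⊆A (saved-hub v∈)))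
        saved⊆vertices (leaf b t) v∈ = leaf∈ b (tuple-good (saved-leaf v∈))

        Safe : State → Set
        Safe σ = ∀ {i} → i ∈ˢ burning σ → V i ∉ saved

        safe-count : ∀ τ → Safe τ → threshold ≤ ∣ ∁ (burning τ) ∣
        safe-count τ safe = begin
          K + 2 * K ^ arity                           ≡⟨ cong (λ k → k + 2 * k ^ arity) size≡K ⟨
          length D + 2 * length D ^ arity             ≡⟨ cong (λ k → length D + 2 * k) (length-tuples arity D) ⟨
          length D + 2 * length (tuples arity D)      ≡⟨ cong₂ _+_ (length-map hub D) (double-copies (tuples arity D)) ⟨
          length (map hub D) + _                      ≡⟨ length-++ (map hub D) ⟨
          length saved                                ≤⟨ length-⊆ saved-unique ⊆unburned ⟩
          length (map V (elements (∁ (burning τ))))   ≡⟨ length-map V (elements (∁ (burning τ))) ⟩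
          length (elements (∁ (burning τ)))           ≡⟨ length-elements (∁ (burning τ)) ⟩
          ∣ ∁ (burning τ) ∣                           ∎
          where
          open ≤-Reasoning

          saved-unique : Unique saved
          saved-unique = Unique.++⁺ (Unique.map⁺ (λ { refl → refl }) unique)
            (copies-unique (tuples-unique arity unique)) (hubs-leaves-disjoint {ts = tuples arity D})

          ⊆unburned : ∀ {v} → v ∈ saved → v ∈ map V (elements (∁ (burning τ)))
          ⊆unburned {v} v∈ with vertex (saved⊆vertices v v∈)
          ... | i , refl = ∈-map⁺ V (∈-elements⁺ (x∉p⇒x∈∁p λ i∈ → safe {i} i∈ v∈))

        -- `ds` holds the clique vertices still to be defended. The inequality in `low` is the race:
        -- per step the fire climbs at most one level and `ds` loses one element, so the fire stays
        -- below level `K`, and hence off the leaves, as long as `ds` is nonempty.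
        record Progress (ds : List H) (σ : State) : Set where
          field
            guarded : ∀ {h} i → h ∈ D → V i ≡ hub h → i ∈ˢ defended σ ⊎ h ∈ ds
            low     : ∀ {i} → i ∈ˢ burning σ → ∃[ h ] V i ≡ hub h × level h + length ds ≤ K × h ∉ D
            ds⊆D    : ∀ {h} → h ∈ ds → h ∈ D

        open Progress

        progress-safe : ∀ {ds σ} → Progress ds σ → Safe σ
        progress-safe p i∈ vi∈ with low p i∈
        ... | h , eq , _ , h∉D = h∉D (saved-hub (subst (_∈ saved) eq vi∈))

        start : Progress D ⟪ ⁅ zero ⁆ , Subset.⊥ ⟫
        guarded start i h∈D eq = inj₂ h∈D
        low start i∈ with x∈⁅y⁆⇒x≡y zero i∈
        ... | refl = s , refl , ≤-reflexive (cong₂ _+_ level-s size≡K)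
                   , λ s∈D → <⇒≢ 0<K (trans (sym level-s) (level-A (⊆A s∈D)))
        ds⊆D start h∈ = h∈

        advance : ∀ {d ds σ} j → V j ≡ hub d → Progress (d ∷ ds) σ → Progress ds (spread (defend j σ))
        guarded (advance j eqj p) i h∈D eq with guarded p i h∈D eq
        ... | inj₁ i∈          = inj₁ (x∈p∪q⁺ (inj₂ i∈))
        ... | inj₂ (here refl) = inj₁ (x∈p∪q⁺ (inj₁ (subst (_∈ˢ ⁅ j ⁆) (V-injective (trans eqj (sym eq))) (x∈⁅x⁆ j))))
        ... | inj₂ (there h∈)  = inj₂ h∈
        low (advance {d} {ds} {σ} j eqj p) {i} i∈ with spread⁻ (defend j σ) i∈
        ... | inj₁ i∈B = let h , eq , h≤ , h∉D = low p i∈B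
                         in h , eq , ≤-trans (+-monoʳ-≤ (level h) (n≤1+n _)) h≤ , h∉D
        ... | inj₂ (i∉ , u , u∈B , adj) = new (V i) refl (low p u∈B)
          where
          new : ∀ v → V i ≡ v → (∃[ h ] V u ≡ hub h × level h + suc (length ds) ≤ K × h ∉ D) →
                ∃[ h ] V i ≡ hub h × level h + length ds ≤ K × h ∉ D
          new (hub h) eq (h′ , eq′ , h′≤ , _) = h , eq , h≤K , h∉D
            where
            h≤K : level h + length ds ≤ K
            h≤K = ≤-trans (+-monoˡ-≤ (length ds) (proj₂ (proj₂ (linked-as u i eq′ eq adj))))
                          (≤-trans (≤-reflexive (sym (+-suc (level h′) (length ds)))) h′≤)

            h∉D : h ∉ D
            h∉D h∈D with guarded p i h∈D eq
            ... | inj₁ i∈D         = i∉ (x∈p∪q⁺ (inj₂ i∈D))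
            ... | inj₂ (here refl) = i∉ (x∈p∪q⁺ (inj₁ (subst (_∈ˢ ⁅ j ⁆) (V-injective (trans eqj (sym eq))) (x∈⁅x⁆ j))))
            -- A vertex of `D` that is still waiting lies on level `K`, out of reach while `ds` is
            -- nonempty.
            ... | inj₂ (there h∈)  = <⇒≱ (m<m+n (level h) (nonempty h∈)) (≤-trans h≤K (≤-reflexive (sym (level-A (⊆A h∈D)))))
              where
              nonempty : ∀ {xs : List H} → h ∈ xs → 0 < length xs
              nonempty (here _)  = s≤s z≤n
              nonempty (there _) = s≤s z≤n
          new (leaf b t) eq (h′ , eq′ , h′≤ , _) =
            contradiction h′≤ (<⇒≱ (subst (λ l → K < l + suc (length ds))
              (sym (level-A (good⇒⊆A (V-leaf i eq) (linked-as u i eq′ eq adj)))) (m<m+n K (s≤s z≤n))))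
        ds⊆D (advance j eqj p) h∈ = ds⊆D p (there h∈)

        -- Once all of `D` is defended no further planning is required: the neighbours of a saved
        -- leaf all belong to `D`, so the saved set is sealed off and any completion of the run
        -- preserves it.
        Guarded : State → Set
        Guarded σ = (∀ {h} i → h ∈ D → V i ≡ hub h → i ∈ˢ defended σ) × Safe σ

        guarded-step : ∀ σ v → v ∉ˢ burning σ → Guarded σ → Guarded (spread (defend v σ))
        guarded-step σ v _ (guard , safe) =
          (λ i h∈D eq → x∈p∪q⁺ (inj₂ (guard i h∈D eq))) , λ {i} i∈ vi∈ → go i (V i) refl (spread⁻ (defend v σ) i∈) vi∈
          where
          go : ∀ i w → V i ≡ w → Reached (defend v σ) i → ¬ (V i ∈ saved)
          go i w          eq (inj₁ i∈B)            vi∈ = safe i∈B vi∈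
          go i (hub h)    eq (inj₂ (i∉ , _))       vi∈ =
            i∉ (x∈p∪q⁺ (inj₂ (guard i (saved-hub (subst (_∈ saved) eq vi∈)) eq)))
          go i (leaf b t) eq (inj₂ (_ , u , u∈B , adj)) vi∈ = from (V u) refl
            where
            t∈ = saved-leaf (subst (_∈ saved) eq vi∈)

            from : ∀ x → ¬ (V u ≡ x)
            from (hub h) eq′ = safe u∈B (subst (_∈ saved) (sym eq′) (hub-saved
              (All.lookup (proj₂ (∈-tuples⁻ arity {D} t∈)) (linked-as u i eq′ eq adj))))
            from (leaf _ _) eq′ = linked-as u i eq′ eq adj

        follow : ∀ ds σ → Progress ds σ → ∃[ τ ] (σ ⟶* τ × Safe τ)
        follow [] σ p =
          let τ , r = completable σ
          in τ , r , proj₂ (⟶*-preserves Guarded guarded-step r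
               ((λ i h∈D eq → [ id , (λ ()) ]′ (guarded p i h∈D eq)) , progress-safe p))
        follow (d ∷ ds) σ p with canSpread? σ
        -- The process ends as soon as the fire cannot spread, even if part of `D` is still
        -- undefended.
        ... | no ¬cs = σ , stop ¬cs , progress-safe p
        ... | yes cs =
          let j , eq       = vertex (hub∈ (A⊆ (⊆A (ds⊆D p (here refl)))))
              j∉B          = λ j∈ → progress-safe p j∈ (subst (_∈ saved) (sym eq) (hub-saved (ds⊆D p (here refl))))
              τ , r , safe = follow ds (spread (defend j σ)) (advance j eq p)
          in τ , step cs j j∉B r , safe

    selection⇒save : ∀ {D} → Selection D → CanSave zero threshold
    selection⇒save sel = let τ , r , safe = follow _ _ start in τ , r , safe-count τ safe
      where open Save sel

    -- From a saving strategy to a selection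

    private
      -- One time step as the fire sees it. A state in which the fire is stuck is its own successor,
      -- so a run that ends early can be treated like one that waits.
      record Next (σ σ′ : State) : Set where
        field
          burn-mono   : ∀ {i} → i ∈ˢ burning σ → i ∈ˢ burning σ′
          defend-mono : ∀ {i} → i ∈ˢ defended σ → i ∈ˢ defended σ′
          closure     : ∀ {i j} → i ∈ˢ burning σ → Adj i j → j ∉ˢ defended σ′ → j ∈ˢ burning σ′

      open Next

      next-step : ∀ v σ → Next σ (spread (defend v σ))
      burn-mono   (next-step v σ) i∈         = spread⁺ (defend v σ) (inj₁ i∈)
      defend-mono (next-step v σ) i∈         = x∈p∪q⁺ (inj₂ i∈)
      closure     (next-step v σ) i∈ adj j∉D = spread⁺ (defend v σ) (inj₂ (j∉D , _ , i∈ , adj))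

      next-stop : ∀ {σ} → ¬ CanSpread σ → Next σ σ
      burn-mono   (next-stop ¬cs) i∈ = i∈
      defend-mono (next-stop ¬cs) i∈ = i∈
      closure     (next-stop {σ} ¬cs) {j = j} i∈ adj j∉D =
        decidable-stable (j ∈? burning σ) λ j∉B → ¬cs (_ , j , i∈ , adj , j∉B , j∉D)

      -- What holds after `m` steps against every strategy. One burning hub on level `m` is enough
      -- to go on: it is adjacent to all other hubs of levels `m` and `m + 1`.
      record Burnt (m : ℕ) (σ : State) : Set where
        field
          below : ∀ {i h} → V i ≡ hub h → level h < m → i ∉ˢ defended σ → i ∈ˢ burning σ
          front : ∃[ u ] ∃[ h ] u ∈ˢ burning σ × V u ≡ hub h × level h ≡ m

      open Burnt

      AllBurnt : State → Set
      AllBurnt σ = ∀ {i h} → V i ≡ hub h → i ∉ˢ defended σ → i ∈ˢ burning σ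

      burnt-next : ∀ {m σ σ′} → Burnt m σ → Next σ σ′ →
                   ∀ {i h} → V i ≡ hub h → level h ≤ suc m → i ∉ˢ defended σ′ → i ∈ˢ burning σ′
      burnt-next {m} {σ} b n {i} {h} eq h≤ i∉ with level h <? m
      ... | yes h<m = burn-mono n (below b eq h<m (i∉ ∘ defend-mono n))
      ... | no h≮m with front b
      ... | u , h′ , u∈B , eq′ , refl with h′ ≟ h
      ... | yes refl = burn-mono n (subst (_∈ˢ burning σ) (V-injective (trans eq′ (sym eq))) u∈B)
      ... | no h′≢h  = closure n u∈B (adj-as u i eq′ eq (h′≢h , m≤n⇒m≤1+n (≮⇒≥ h≮m) , h≤)) i∉

      burnt-all : ∀ {m σ σ′} → suc m ≡ K → Burnt m σ → Next σ σ′ → AllBurnt σ′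
      burnt-all refl b n {i} eq = burnt-next b n eq (level≤K (V-hub i eq))

      burnt-suc : ∀ {m σ σ′} → suc m < K → ∣ defended σ′ ∣ ≤ K → Burnt m σ → Next σ σ′ → Burnt (suc m) σ′
      below (burnt-suc 1+m<K ∣D∣≤K b n) eq h< = burnt-next b n eq (<⇒≤ h<)
      front (burnt-suc {m} {σ} {σ′} 1+m<K ∣D∣≤K b n) with layer 1+m<K
      ... | hs , uniq , len , props with any? (λ u → ¬? (u ∈? defended σ′) ×-dec in-hs? (V u))
        where
        in-hs? : ∀ v → Dec (∃[ h ] v ≡ hub h × h ∈ hs)
        in-hs? (leaf _ _) = no λ ()
        in-hs? (hub h) with h ∈ᴸ? hs
        ... | yes h∈ = yes (h , refl , h∈)
        ... | no h∉  = no λ { (_ , refl , h∈) → h∉ h∈ }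
      ... | yes (u , u∉ , h , eq , h∈) =
        u , h , burnt-next b n eq (≤-reflexive (proj₂ (props h∈))) u∉ , eq , proj₂ (props h∈)
      ... | no none = contradiction ∣D∣≤K (<⇒≱ (begin-strict
        K                                        <⟨ ≤-refl ⟩
        suc K                                    ≡⟨ len ⟨
        length hs                                ≡⟨ length-map hub hs ⟨
        length (map hub hs)                      ≤⟨ length-⊆ (Unique.map⁺ (λ { refl → refl }) uniq) ⊆defended ⟩
        length (map V (elements (defended σ′)))  ≡⟨ length-map V (elements (defended σ′)) ⟩
        length (elements (defended σ′))          ≡⟨ length-elements (defended σ′) ⟩
        ∣ defended σ′ ∣                          ∎))
        where
        open ≤-Reasoning
        ⊆defended : ∀ {v} → v ∈ map hub hs → v ∈ map V (elements (defended σ′))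
        ⊆defended v∈ with ∈-map⁻ hub v∈
        ... | h , h∈ , refl with vertex (hub∈ (layer⊆ (proj₁ (props h∈))))
        ... | u , eq = subst (_∈ map V (elements (defended σ′))) eq (∈-map⁺ V (∈-elements⁺
          (decidable-stable (u ∈? defended σ′) λ u∉ → none (u , u∉ , h , eq , h∈))))

      burnt-start : Burnt 0 ⟪ ⁅ zero ⁆ , Subset.⊥ ⟫
      below burnt-start _ ()
      front burnt-start = zero , s , x∈⁅x⁆ zero , refl , level-s

      -- A stuck state can be advanced through the `d` remaining levels without changing: if the
      -- fire is stuck, every undefended hub already burns.
      burnt-closed : ∀ {σ} d {m} → suc (m + d) ≡ K → ∣ defended σ ∣ ≤ K → Burnt m σ → Next σ σ → AllBurnt σ
      burnt-closed zero    {m} eq _     b n = burnt-all (trans (cong suc (sym (+-identityʳ m))) eq) b n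
      burnt-closed (suc d) {m} eq ∣D∣≤K b n = burnt-closed d (trans (cong suc (sym (+-suc m d))) eq) ∣D∣≤K
        (burnt-suc (subst (suc m <_) eq (s≤s (m<m+n m (s≤s z≤n)))) ∣D∣≤K b n) n

      -- `E` collects what was defended before the last undefended hubs caught fire, `extra` is the
      -- one move that still helps afterwards; all other survivors are leaves sealed off by `E`.
      Unburned : Subset N → Fin N → Fin N → Set
      Unburned E extra i = i ∈ˢ E ⊎ i ≡ extra ⊎
        ∃[ b ] ∃[ t ] V i ≡ leaf b t × (∀ {u h} → h ∈ t → V u ≡ hub h → u ∈ˢ E)

      record Rescue (τ : State) : Set where
        field
          E        : Subset N
          extra    : Fin N
          ∣E∣≤K    : ∣ E ∣ ≤ K
          unburned : ∀ i → i ∉ˢ burning τ → Unburned E extra i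

      -- When all undefended hubs burn, the very next spread takes every undefended leaf that has an
      -- undefended neighbour. So only one more move can matter.
      endgame : ∀ {σ τ} → AllBurnt σ → ∣ defended σ ∣ ≤ K → σ ⟶* τ → Rescue τ
      endgame {σ} all ∣D∣≤K (stop ¬cs) = record
        -- No move follows here, so `extra` is a dummy.
        { E = defended σ ; extra = zero ; ∣E∣≤K = ∣D∣≤K ; unburned = λ i → go i (V i) refl }
        where
        go : ∀ i v → V i ≡ v → i ∉ˢ burning σ → Unburned (defended σ) zero i
        go i (hub h) eq i∉ = inj₁ (decidable-stable (i ∈? defended σ) λ i∉D → i∉ (all eq i∉D))
        go i (leaf b t) eq i∉ with i ∈? defended σ
        ... | yes i∈D = inj₁ i∈D
        ... | no i∉D  = inj₂ (inj₂ (b , t , eq , λ {u} h∈ eq′ → decidable-stable (u ∈? defended σ) λ u∉D →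
                          i∉ (closure (next-stop ¬cs) (all eq′ u∉D) (adj-as u i eq′ eq h∈) i∉D)))
      endgame {σ} {τ} all ∣D∣≤K (step cs w w∉B r) = record
        { E = defended σ ; extra = w ; ∣E∣≤K = ∣D∣≤K ; unburned = λ i → go i (V i) refl }
        where
        go : ∀ i v → V i ≡ v → i ∉ˢ burning τ → Unburned (defended σ) w i
        go i (hub h) eq i∉ = inj₁ (decidable-stable (i ∈? defended σ) λ i∉D →
          i∉ (burning-mono r (burn-mono (next-step w σ) (all eq i∉D))))
        go i (leaf b t) eq i∉ with i ∈? defended (defend w σ)
        ... | yes i∈D = [ (λ i∈w → inj₂ (inj₁ (x∈⁅y⁆⇒x≡y w i∈w))) , inj₁ ]′ (x∈p∪q⁻ ⁅ w ⁆ (defended σ) i∈D)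
        ... | no i∉D  = inj₂ (inj₂ (b , t , eq , λ {u} h∈ eq′ → decidable-stable (u ∈? defended σ) λ u∉D →
                          i∉ (burning-mono r (closure (next-step w σ) (all eq′ u∉D) (adj-as u i eq′ eq h∈) i∉D))))

      rescue : ∀ {m σ τ} → m < K → ∣ defended σ ∣ ≤ m → Burnt m σ → σ ⟶* τ → Rescue τ
      rescue {m} m<K ∣D∣≤m b r@(stop ¬cs) =
        endgame (burnt-closed (K ∸ suc m) (m+[n∸m]≡n m<K) ∣D∣≤K b (next-stop ¬cs)) ∣D∣≤K r
        where ∣D∣≤K = ≤-trans ∣D∣≤m (<⇒≤ m<K)
      rescue {m} {σ} m<K ∣D∣≤m b (step cs v v∉B r) with m≤n⇒m<n∨m≡n m<K
      ... | inj₁ 1+m<K = rescue 1+m<K ∣D′∣≤ (burnt-suc 1+m<K (≤-trans ∣D′∣≤ m<K) b (next-step v σ)) r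
        where ∣D′∣≤ = ≤-trans (∣defend∣ v σ) (s≤s ∣D∣≤m)
      ... | inj₂ 1+m≡K = endgame (burnt-all 1+m≡K b (next-step v σ)) (≤-trans (≤-trans (∣defend∣ v σ) (s≤s ∣D∣≤m)) m<K) r

      -- With `D` the clique vertices in `E` and `ts` the good tuples over `D`, at most K + 1 + 2 ·
      -- |ts| vertices survive. By parity the threshold forces K^c ≤ |ts|, and |ts| ≤ |D|^c ≤ K^c
      -- makes all of these equal: `D` has `K` elements and only good tuples.
      rescue⇒selection : ∀ {τ} → Rescue τ → threshold ≤ ∣ ∁ (burning τ) ∣ → ∃[ D ] Selection D
      rescue⇒selection {τ} R k≤ = D , record
        { unique   = D-unique
        ; ⊆A       = λ h∈ → proj₁ (∈-filter⁻ inE? {xs = A} h∈)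
        ; size≡K   = ∣D∣≡K
        ; all-good = filterᵇ-full good (tuples arity D) (begin
            length (tuples arity D) ≡⟨ length-tuples arity D ⟩
            length D ^ arity        ≡⟨ cong (_^ arity) ∣D∣≡K ⟩
            K ^ arity               ≤⟨ K^≤ ⟩
            length ts               ∎)
        }
        where
        open Rescue R
        open ≤-Reasoning

        inE? : ∀ h → Dec (∃[ u ] V u ≡ hub h × u ∈ˢ E)
        inE? h = any? λ u → hub≟ (V u) h ×-dec (u ∈? E)

        D : List H
        D = filter inE? A

        D-unique : Unique D
        D-unique = Unique.filter⁺ inE? A-unique

        ts : List (List H)
        ts = filterᵇ good (tuples arity D)

        ∣D∣≤K : length D ≤ K
        ∣D∣≤K = begin
          length D                     ≡⟨ length-map hub D ⟨
          length (map hub D)           ≤⟨ length-⊆ (Unique.map⁺ (λ { refl → refl }) D-unique) ⊆E ⟩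
          length (map V (elements E))  ≡⟨ length-map V (elements E) ⟩
          length (elements E)          ≡⟨ length-elements E ⟩
          ∣ E ∣                        ≤⟨ ∣E∣≤K ⟩
          K                            ∎
          where
          ⊆E : ∀ {v} → v ∈ map hub D → v ∈ map V (elements E)
          ⊆E v∈ with ∈-map⁻ hub v∈
          ... | h , h∈ , refl with proj₂ (∈-filter⁻ inE? {xs = A} h∈)
          ... | u , eq , u∈E = subst (_∈ map V (elements E)) eq (∈-map⁺ V (∈-elements⁺ u∈E))

        leaves : List (Vertex H)
        leaves = map (leaf false) ts ++ map (leaf true) ts

        leaf-copy : ∀ b {t} → t ∈ ts → leaf b t ∈ leaves
        leaf-copy false t∈ = ∈-++⁺ˡ (∈-map⁺ (leaf false) t∈)
        leaf-copy true  t∈ = ∈-++⁺ʳ (map (leaf false) ts) (∈-map⁺ (leaf true) t∈)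

        covered : ∀ {v} → v ∈ map V (elements (∁ (burning τ))) → v ∈ map V (elements E) ++ V extra ∷ leaves
        covered v∈ with ∈-map⁻ V {xs = elements (∁ (burning τ))} v∈
        ... | i , i∈ , refl with unburned i (x∈∁p⇒x∉p (∈-elements⁻ {p = ∁ (burning τ)} i∈))
        ... | inj₁ i∈E = ∈-++⁺ˡ (∈-map⁺ V (∈-elements⁺ i∈E))
        ... | inj₂ (inj₁ refl) = ∈-++⁺ʳ (map V (elements E)) (here refl)
        ... | inj₂ (inj₂ (b , t , eq , comps)) = ∈-++⁺ʳ (map V (elements E)) (there
          (subst (_∈ leaves) (sym eq) (leaf-copy b (∈-filter⁺ (T? ∘ good)
            (subst (λ a → t ∈ tuples a D) (proj₁ (∈-tuples⁻ arity {A} (good⇒tuple t∈)))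
                   (∈-tuples⁺ (All.tabulate λ h∈ →
                     let h∈A    = good⇒⊆A t∈ h∈
                         u , eq = vertex (hub∈ (A⊆ h∈A))
                     in ∈-filter⁺ inE? h∈A (u , eq , comps h∈ eq))))
            (proj₂ (∈-filter⁻ (T? ∘ good) {xs = tuples arity A} t∈))))))
          where
          t∈ : t ∈ goodTuples
          t∈ = V-leaf i eq

        bound : K + 2 * K ^ arity ≤ K + suc (2 * length ts)
        bound = begin
          K + 2 * K ^ arity                            ≤⟨ k≤ ⟩
          ∣ ∁ (burning τ) ∣                            ≡⟨ length-elements (∁ (burning τ)) ⟨
          length (elements (∁ (burning τ)))            ≡⟨ length-map V (elements (∁ (burning τ))) ⟨
          length (map V (elements (∁ (burning τ))))    ≤⟨ length-⊆ (Unique.map⁺ V-injective (elements-unique (∁ (burning τ)))) covered ⟩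
          length (map V (elements E) ++ V extra ∷ leaves) ≡⟨ length-++ (map V (elements E)) ⟩
          length (map V (elements E)) + suc (length leaves)
            ≡⟨ cong₂ (λ a b → a + suc b) (trans (length-map V (elements E)) (length-elements E)) (double-copies ts) ⟩
          ∣ E ∣ + suc (2 * length ts)                  ≤⟨ +-monoˡ-≤ _ ∣E∣≤K ⟩
          K + suc (2 * length ts)                      ∎

        K^≤ : K ^ arity ≤ length ts
        K^≤ = halve (K ^ arity) (length ts) (+-cancelˡ-≤ K _ _ bound)
          where
          halve : ∀ a b → 2 * a ≤ suc (2 * b) → a ≤ b
          halve a b le = ≮⇒≥ λ b<a → <⇒≱ {suc (2 * b)} {2 * a}
            (≤-trans (≤-reflexive (sym (*-suc 2 b))) (*-monoʳ-≤ 2 b<a)) le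

        ∣D∣≡K : length D ≡ K
        ∣D∣≡K = ≤-antisym ∣D∣≤K (≮⇒≥ λ D<K → <⇒≱ (^-monoˡ-< arity D<K)
          (≤-trans K^≤ (≤-trans (length-filter (T? ∘ good) (tuples arity D)) (≤-reflexive (length-tuples arity D)))))

    save⇒selection : CanSave zero threshold → ∃[ D ] Selection D
    save⇒selection (τ , r , k≤) =
      rescue⇒selection (rescue 0<K (≤-reflexive (Subset.∣⊥∣≡0 N)) burnt-start r) k≤

open FireGadget

-- Refuting claims about the nodes of a circuit

module Refutations where

  open import Data.Bool.Base using (Bool; true; false; T; not; if_then_else_)
  open import Data.Bool.Properties using (T-≡; T?; not-involutive; not-¬)
  open import Data.Bool.ListAction using (and; or; any; all)
  open import Data.Fin.Base using (Fin; zero; suc)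
  open import Data.Fin.Properties using (any?)
  open import Data.Fin.Subset as Subset using (Subset; ∣_∣; _∩_)
  open import Data.Fin.Subset.Properties as Subset using (_∈?_; x∈⁅x⁆; x∈p∩q⁺; x∈p∩q⁻; ∣p∩q∣≤∣q∣)
  open import Data.List.Base as List using (List; []; _∷_; length; _++_; map; filterᵇ)
  open import Data.List.Membership.Propositional using (_∈_; find; lose)
  open import Data.List.Membership.Propositional.Properties
  open import Data.List.Properties using (length-map; length-++)
  open import Data.List.Relation.Unary.All as All using (All; []; _∷_)
  import Data.List.Relation.Unary.All.Properties as All
  open import Data.List.Relation.Unary.Any as Any using (Any; here; there)
  import Data.List.Relation.Unary.Any.Properties as Any
  open import Data.List.Relation.Unary.Unique.Propositional using (Unique)
  import Data.List.Relation.Unary.Unique.Propositional.Properties as Unique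
  open import Data.Nat.Base
  open import Data.Nat.Properties
  open import Algebra.Properties.CommutativeSemigroup *-commutativeSemigroup using (x∙yz≈y∙xz)
  open import Data.Product.Base using (∃-syntax; _×_; _,_; proj₁; proj₂)
  open import Data.Unit.Base using (tt)
  open import Data.Vec.Base as Vec using (Vec; []; _∷_; here; there; lookup)
  open import Data.Vec.Properties using (lookup∘tabulate; []=⇒lookup; lookup⇒[]=)
  open import Function.Base using (id; _∘_)
  open import Function.Bundles using (_⇔_; mk⇔; Equivalence)
  open import Relation.Binary.PropositionalEquality
  open import Relation.Nullary using (¬_; Dec; yes; no; contradiction)
  open import Relation.Nullary.Decidable using (¬?; _×-dec_; _→-dec_; decidable-stable)

  open Equivalence using (to; from)

  and-true : ∀ l → and l ≡ true ⇔ (∀ {b} → b ∈ l → b ≡ true)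
  and-true l = mk⇔ (fwd l) (bwd l)
    where
    fwd : ∀ l → and l ≡ true → ∀ {b} → b ∈ l → b ≡ true
    fwd (true ∷ l) eq (here refl) = refl
    fwd (true ∷ l) eq (there b∈)  = fwd l eq b∈

    bwd : ∀ l → (∀ {b} → b ∈ l → b ≡ true) → and l ≡ true
    bwd []      h = refl
    bwd (b ∷ l) h rewrite h (here refl) = bwd l (h ∘ there)

  or-false : ∀ l → or l ≡ false ⇔ (∀ {b} → b ∈ l → b ≡ false)
  or-false l = mk⇔ (fwd l) (bwd l)
    where
    fwd : ∀ l → or l ≡ false → ∀ {b} → b ∈ l → b ≡ false
    fwd (false ∷ l) eq (here refl) = refl
    fwd (false ∷ l) eq (there b∈)  = fwd l eq b∈

    bwd : ∀ l → (∀ {b} → b ∈ l → b ≡ false) → or l ≡ false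
    bwd []      h = refl
    bwd (b ∷ l) h rewrite h (here refl) = bwd l (h ∘ there)

  and-false : ∀ l → and l ≡ false ⇔ false ∈ l
  and-false l = mk⇔ (fwd l) (bwd l)
    where
    fwd : ∀ l → and l ≡ false → false ∈ l
    fwd (true ∷ l)  eq = there (fwd l eq)
    fwd (false ∷ l) eq = here refl

    bwd : ∀ l → false ∈ l → and l ≡ false
    bwd (_ ∷ l)     (here refl) = refl
    bwd (true ∷ l)  (there f∈)  = bwd l f∈
    bwd (false ∷ l) (there f∈)  = refl

  or-true : ∀ l → or l ≡ true ⇔ true ∈ l
  or-true l = mk⇔ (fwd l) (bwd l)
    where
    fwd : ∀ l → or l ≡ true → true ∈ l
    fwd (true ∷ l)  eq = here refl
    fwd (false ∷ l) eq = there (fwd l eq)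

    bwd : ∀ l → true ∈ l → or l ≡ true
    bwd (_ ∷ l)     (here refl) = refl
    bwd (true ∷ l)  (there t∈)  = refl
    bwd (false ∷ l) (there t∈)  = bwd l t∈

  module _ {A : Set} where

    ∈-select⁺ : ∀ {n} {p : Subset n} (xs : Vec A n) {i} → i Subset.∈ p → lookup xs i ∈ select p xs
    ∈-select⁺ (x ∷ xs) here                      = here refl
    ∈-select⁺ {p = true ∷ _}  (x ∷ xs) (there i∈) = there (∈-select⁺ xs i∈)
    ∈-select⁺ {p = false ∷ _} (x ∷ xs) (there i∈) = ∈-select⁺ xs i∈

    ∈-select⁻ : ∀ {n} (p : Subset n) (xs : Vec A n) {x} → x ∈ select p xs → ∃[ i ] i Subset.∈ p × lookup xs i ≡ x
    ∈-select⁻ []          []       ()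
    ∈-select⁻ (true ∷ p)  (x ∷ xs) (here refl) = zero , here , refl
    ∈-select⁻ (true ∷ p)  (x ∷ xs) (there x∈)  = let i , i∈ , eq = ∈-select⁻ p xs x∈ in suc i , there i∈ , eq
    ∈-select⁻ (false ∷ p) (x ∷ xs) x∈          = let i , i∈ , eq = ∈-select⁻ p xs x∈ in suc i , there i∈ , eq

    length-select : ∀ {n} (p : Subset n) (xs : Vec A n) → length (select p xs) ≡ ∣ p ∣
    length-select []          []       = refl
    length-select (true ∷ p)  (x ∷ xs) = cong suc (length-select p xs)
    length-select (false ∷ p) (x ∷ xs) = length-select p xs

  ≤maximum : ∀ {l m} → m ∈ l → m ≤ maximum l
  ≤maximum {x ∷ l} (here refl) = m≤m⊔n x (maximum l)
  ≤maximum {x ∷ l} (there m∈)  = m≤n⇒m≤o⊔n x (≤maximum m∈)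

  any-T : ∀ {A : Set} (f : A → Bool) l → T (any f l) ⇔ (∃[ x ] x ∈ l × T (f x))
  any-T f l = mk⇔ (find ∘ Any.any⁻ f l) λ { (x , x∈ , fx) → Any.any⁺ f (lose x∈ fx) }

  all-T : ∀ {A : Set} (f : A → Bool) l → T (all f l) ⇔ (∀ {x} → x ∈ l → T (f x))
  all-T f l = mk⇔ (All.lookup ∘ All.all⁺ f l) λ h → All.all⁻ f (All.tabulate h)

  -- A value records whether the node is a designated witness and whether the claims that
  -- it evaluates to true, respectively to false, are refuted.

  Val : Set
  Val = Bool × (Bool × Bool)

  witness : Val → Bool
  witness = proj₁

  refutes : Bool → Bool × Bool → Bool
  refutes true  = proj₁
  refutes false = proj₂

  ref : Bool → Val → Bool
  ref b v = refutes b (proj₂ v)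

  -- A disjunctive claim about a large gate has to be supported by a designated witness;
  -- that makes every refutation of it depend on a bounded number of predecessors.

  relevant : List Val → List Val
  relevant vs = if 2 <ᵇ length vs then filterᵇ witness vs else vs

  -- The components concern the claims `true` and `false`. A claim about all predecessors falls with
  -- one of them, a claim about some predecessor only with all relevant ones; at a large gate
  -- without a designated predecessor it falls vacuously.
  gateRef : ∀ {N} → Gate N → Vec Val N → Bool × Bool
  gateRef (NOT i)   vs = ref false (lookup vs i) , ref true (lookup vs i)
  gateRef (AND p _) vs = any (ref true) (select p vs) , all (ref false) (relevant (select p vs))
  gateRef (OR p _)  vs = all (ref true) (relevant (select p vs)) , any (ref false) (select p vs)

  -- The claim that an input has some value is refuted by a statement of the opposite value, hence
  -- the order of the components.
  inputVals : (ℕ → Bool) → (ℕ → Bool → Bool) → ∀ n → Vec Val n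
  inputVals member says zero    = []
  inputVals member says (suc m) = (member m , says m false , says m true) ∷ inputVals member says m

  -- A single bottom-up pass like `eval`, so that a tuple of hubs can be tested in polynomial time.
  vals : ∀ {n N} → (ℕ → Bool) → (ℕ → Bool → Bool) → Circuit n N → Vec Val N
  vals         member says inputs              = inputVals member says _
  vals {N = suc N} member says (C ▷ g) = let vs = vals member says C in (member N , gateRef g vs) ∷ vs

  -- Nodes are numbered upwards from the bottom of the circuit.

  number : ∀ {N} → Fin N → ℕ
  number {suc N} zero    = N
  number         (suc i) = number i

  number<N : ∀ {N} (i : Fin N) → number i < N
  number<N zero    = ≤-refl
  number<N (suc i) = m≤n⇒m≤1+n (number<N i)

  number-injective : ∀ {N} {i j : Fin N} → number i ≡ number j → i ≡ j
  number-injective {i = zero}  {zero}  _  = refl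
  number-injective {i = zero}  {suc j} eq = contradiction (sym eq) (<⇒≢ (number<N j))
  number-injective {i = suc i} {zero}  eq = contradiction eq (<⇒≢ (number<N i))
  number-injective {i = suc i} {suc j} eq = cong suc (number-injective eq)

  -- By duality the six combinations of a gate and a claimed value are of three kinds. Each kind
  -- couples the meaning of the claim with the rule for refuting it, and the inductions below
  -- distinguish nothing else.
  data GateView {N} (g : Gate N) (b : Bool) : Set where
    negation    : ∀ i → i Subset.∈ predecessors g →
                  (∀ vs → evalGate g vs ≡ b ⇔ lookup vs i ≡ not b) →
                  (∀ vs → T (refutes b (gateRef g vs)) ⇔ T (ref (not b) (lookup vs i))) →
                  GateView g b
    conjunctive : (∀ vs → evalGate g vs ≡ b ⇔ (∀ {i} → i Subset.∈ predecessors g → lookup vs i ≡ b)) →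
                  (∀ vs → T (refutes b (gateRef g vs)) ⇔ (∃[ i ] i Subset.∈ predecessors g × T (ref b (lookup vs i)))) →
                  GateView g b
    disjunctive : (∀ vs → evalGate g vs ≡ b ⇔ (∃[ i ] i Subset.∈ predecessors g × lookup vs i ≡ b)) →
                  (∀ vs → T (refutes b (gateRef g vs)) ⇔
                    (∀ {i} → i Subset.∈ predecessors g → (T (isLarge g) → T (witness (lookup vs i))) → T (ref b (lookup vs i)))) →
                  GateView g b

  module _ {N} (p : Subset N) where

    select-all : ∀ {b} {l : List Bool → Bool} → (∀ bs → l bs ≡ b ⇔ (∀ {x} → x ∈ bs → x ≡ b)) →
                 ∀ vs → l (select p vs) ≡ b ⇔ (∀ {i} → i Subset.∈ p → lookup vs i ≡ b)
    select-all {b} spec vs = mk⇔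
      (λ eq {i} i∈ → to (spec _) eq (∈-select⁺ vs i∈))
      (λ (h : ∀ {i} → i Subset.∈ p → lookup vs i ≡ b) →
        from (spec _) λ x∈ → let i , i∈ , eq = ∈-select⁻ p vs x∈ in trans (sym eq) (h i∈))

    select-any : ∀ {b} {l : List Bool → Bool} → (∀ bs → l bs ≡ b ⇔ b ∈ bs) →
                 ∀ vs → l (select p vs) ≡ b ⇔ (∃[ i ] i Subset.∈ p × lookup vs i ≡ b)
    select-any spec vs = mk⇔
      (λ eq → ∈-select⁻ p vs (to (spec _) eq))
      (λ { (i , i∈ , eq) → from (spec _) (subst (_∈ _) eq (∈-select⁺ vs i∈)) })

    ref-any : ∀ b vs → T (any (ref b) (select p vs)) ⇔ (∃[ i ] i Subset.∈ p × T (ref b (lookup vs i)))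
    ref-any b vs = mk⇔
      (λ t → let v , v∈ , r = to (any-T (ref b) _) t ; i , i∈ , eq = ∈-select⁻ p vs v∈
             in i , i∈ , subst (T ∘ ref b) (sym eq) r)
      (λ { (i , i∈ , r) → from (any-T (ref b) _) (_ , ∈-select⁺ vs i∈ , r) })

    ref-all : ∀ b vs → T (all (ref b) (relevant (select p vs))) ⇔
              (∀ {i} → i Subset.∈ p → (T (2 <ᵇ ∣ p ∣) → T (witness (lookup vs i))) → T (ref b (lookup vs i)))
    ref-all b vs rewrite length-select p vs with 2 <ᵇ ∣ p ∣
    ... | true = mk⇔
      (λ t {i} i∈ w → to (all-T (ref b) _) t (∈-filter⁺ (T? ∘ witness) (∈-select⁺ vs i∈) (w tt)))
      (λ h → from (all-T (ref b) _) λ v∈ →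
        let v∈′ , w = ∈-filter⁻ (T? ∘ witness) {xs = select p vs} v∈ ; i , i∈ , eq = ∈-select⁻ p vs v∈′
        in subst (T ∘ ref b) eq (h i∈ λ _ → subst (T ∘ witness) (sym eq) w))
    ... | false = mk⇔
      (λ t {i} i∈ _ → to (all-T (ref b) _) t (∈-select⁺ vs i∈))
      (λ h → from (all-T (ref b) _) λ v∈ →
        let i , i∈ , eq = ∈-select⁻ p vs v∈ in subst (T ∘ ref b) eq (h i∈ λ ()))

  gateView : ∀ {N} (g : Gate N) b → GateView g b
  gateView (NOT i) true  = negation i (x∈⁅x⁆ i)
    (λ vs → mk⇔ (λ eq → trans (sym (not-involutive _)) (cong not eq)) (cong not))
    (λ vs → mk⇔ id id)
  gateView (NOT i) false = negation i (x∈⁅x⁆ i)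
    (λ vs → mk⇔ (λ eq → trans (sym (not-involutive _)) (cong not eq)) (cong not))
    (λ vs → mk⇔ id id)
  gateView (AND p _) true  = conjunctive (select-all p and-true) (ref-any p true)
  gateView (AND p _) false = disjunctive (select-any p and-false) (ref-all p false)
  gateView (OR p _)  true  = disjunctive (select-any p or-true) (ref-all p true)
  gateView (OR p _)  false = conjunctive (select-all p or-false) (ref-any p false)

  Refuted : ∀ {n N} → Circuit n N → (ℕ → Bool) → (ℕ → Bool → Bool) → Fin N → Bool → Set
  Refuted C member says i b = T (ref b (lookup (vals member says C) i))

  refuted? : ∀ {n N} (C : Circuit n N) member says i b → Dec (Refuted C member says i b)
  refuted? C member says i b = T? (ref b (lookup (vals member says C) i))

  lookup-inputVals : ∀ member says n i → lookup (inputVals member says n) i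
                     ≡ (member (number i) , says (number i) false , says (number i) true)
  lookup-inputVals member says (suc n) zero    = refl
  lookup-inputVals member says (suc n) (suc i) = lookup-inputVals member says n i

  refuted-input : ∀ {n} member says (i : Fin n) b → Refuted inputs member says i b ≡ T (says (number i) (not b))
  refuted-input member says i true  = cong (T ∘ ref true) (lookup-inputVals member says _ i)
  refuted-input member says i false = cong (T ∘ ref false) (lookup-inputVals member says _ i)

  witness-number : ∀ {n N} member says (C : Circuit n N) i → witness (lookup (vals member says C) i) ≡ member (number i)
  witness-number member says inputs  i       = cong witness (lookup-inputVals member says _ i)
  witness-number member says (C ▷ g) zero    = refl
  witness-number member says (C ▷ g) (suc i) = witness-number member says C i

  -- Statements help a refutation, while designations hinder it: every further designated
  -- predecessor of an existential claim has to be refuted as well.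
  refuted-mono : ∀ {n N} (C : Circuit n N) {member member′ says says′} →
                 (∀ m → T (member′ m) → T (member m)) →
                 (∀ m b → T (says m b) → T (says′ m b)) →
                 ∀ i b → Refuted C member says i b → Refuted C member′ says′ i b
  refuted-mono inputs {member} {member′} {says} {says′} mem≥ says≤ i b r =
    subst id (sym (refuted-input member′ says′ i b)) (says≤ _ _ (subst id (refuted-input member says i b) r))
  refuted-mono (C ▷ g) mem≥ says≤ (suc i) b r = refuted-mono C mem≥ says≤ i b r
  refuted-mono (C ▷ g) {member} {member′} {says} {says′} mem≥ says≤ zero b r with gateView g b
  ... | negation i _ _ spec = from (spec _) (refuted-mono C mem≥ says≤ i (not b) (to (spec _) r))
  ... | conjunctive _ spec = let i , i∈ , r′ = to (spec _) r in from (spec _) (i , i∈ , refuted-mono C mem≥ says≤ i b r′)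
  ... | disjunctive _ spec = from (spec _) λ {i} i∈ w → refuted-mono C mem≥ says≤ i b
    (to (spec _) r i∈ λ large → subst T (sym (witness-number member says C i))
      (mem≥ _ (subst T (witness-number member′ says′ C i) (w large))))

  -- An unrefuted existential claim has an unrefuted predecessor, designated if the gate is large,
  -- and the induction hypothesis turns it into a true instance. At an input the true value is
  -- stated, so the opposite claim is always refuted.
  unrefuted-sound : ∀ {n N} (C : Circuit n N) {member says} ρ →
                    (∀ i → T (says (number i) (lookup ρ i))) →
                    ∀ i b → ¬ Refuted C member says i b → lookup (eval C ρ) i ≡ b
  unrefuted-sound inputs {member} {says} ρ decides i b ¬r with lookup ρ i | decides i
  unrefuted-sound inputs {member} {says} ρ decides i true  ¬r | true  | _ = refl
  unrefuted-sound inputs {member} {says} ρ decides i false ¬r | false | _ = refl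
  unrefuted-sound inputs {member} {says} ρ decides i true  ¬r | false | s =
    contradiction (subst id (sym (refuted-input member says i true)) s) ¬r
  unrefuted-sound inputs {member} {says} ρ decides i false ¬r | true  | s =
    contradiction (subst id (sym (refuted-input member says i false)) s) ¬r
  unrefuted-sound (C ▷ g) ρ decides (suc i) b ¬r = unrefuted-sound C ρ decides i b ¬r
  unrefuted-sound (C ▷ g) {member} {says} ρ decides zero b ¬r with gateView g b
  ... | negation i _ ev spec = from (ev _) (unrefuted-sound C ρ decides i (not b) (¬r ∘ from (spec _)))
  ... | conjunctive ev spec = from (ev _) λ {i} i∈ → unrefuted-sound C ρ decides i b λ r → ¬r (from (spec _) (i , i∈ , r))
  ... | disjunctive ev spec with any? (λ i → (i ∈? predecessors g) ×-dec
                                            (T? (isLarge g) →-dec T? (witness (lookup (vals member says C) i))) ×-dec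
                                            ¬? (refuted? C member says i b))
  ... | yes (i , i∈ , _ , ¬rᵢ) = from (ev _) (i , i∈ , unrefuted-sound C ρ decides i b ¬rᵢ)
  ... | no none = contradiction
    (from (spec _) λ {i} i∈ w → decidable-stable (refuted? C member says i b) λ ¬rᵢ → none (i , i∈ , w , ¬rᵢ)) ¬r

  -- Finite choice with a length count, by concatenation. It merges both the hubs that refute
  -- several claims and the witnesses that support several claims.
  collect : ∀ {A I : Set} (P : A → Set) (Φ : I → List A → Set) →
            (∀ {i xs ys} → (∀ {x} → x ∈ xs → x ∈ ys) → Φ i xs → Φ i ys) →
            ∀ B is → (∀ {i} → i ∈ is → ∃[ xs ] All P xs × length xs ≤ B × Φ i xs) →
            ∃[ xs ] All P xs × length xs ≤ length is * B × (∀ {i} → i ∈ is → Φ i xs)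
  collect P Φ mono B []       h = [] , [] , z≤n , λ ()
  collect P Φ mono B (i ∷ is) h =
    let xs , pxs , xs≤ , φ  = h (here refl)
        ys , pys , ys≤ , φs = collect P Φ mono B is (h ∘ there)
    in xs ++ ys , All.++⁺ pxs pys , ≤-trans (≤-reflexive (length-++ xs)) (+-mono-≤ xs≤ ys≤)
     , λ { (here refl) → mono ∈-++⁺ˡ φ ; (there j∈) → mono (∈-++⁺ʳ xs) (φs j∈) }

  child-depth : ∀ {n N} (C : Circuit n N) g {i} → i Subset.∈ predecessors g →
                suc (lookup (depths C) i) ≤ lookup (depths (C ▷ g)) zero
  child-depth C g i∈ = s≤s (≤maximum (∈-select⁺ (depths C) i∈))

  child-weft : ∀ {n N} (C : Circuit n N) g {i} → i Subset.∈ predecessors g →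
               (if isLarge g then 1 else 0) + lookup (wefts C) i ≤ lookup (wefts (C ▷ g)) zero
  child-weft C g i∈ = +-monoʳ-≤ (if isLarge g then 1 else 0) (≤maximum (∈-select⁺ (wefts C) i∈))

  large-weft : ∀ {n N w} (C : Circuit n N) g → isLarge g ≡ true → lookup (wefts (C ▷ g)) zero ≤ w →
               ∃[ w′ ] w ≡ suc w′ × (∀ {i} → i Subset.∈ predecessors g → lookup (wefts C) i ≤ w′)
  large-weft {w = w} C g large weft≤ = go w weft≤′
    where
    weft≤′ : suc (maximum (select (predecessors g) (wefts C))) ≤ w
    weft≤′ = subst (λ l → (if l then 1 else 0) + maximum (select (predecessors g) (wefts C)) ≤ w) large weft≤

    go : ∀ w → suc (maximum (select (predecessors g) (wefts C))) ≤ w →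
         ∃[ w′ ] w ≡ suc w′ × (∀ {i} → i Subset.∈ predecessors g → lookup (wefts C) i ≤ w′)
    go (suc w) (s≤s max≤) = w , refl , λ i∈ → ≤-trans (≤maximum (∈-select⁺ (wefts C) i∈)) max≤

  small-fan-in : ∀ {N} (g : Gate N) → isLarge g ≡ false → ∣ predecessors g ∣ ≤ 2
  small-fan-in g small = ≮⇒≥ λ 2<p → subst T small (<⇒<ᵇ 2<p)

  -- Refutations depend on boundedly many hubs

  says-of : ∀ {A : Set} → (A → ℕ → Bool → Bool) → List A → ℕ → Bool → Bool
  says-of say t m b = any (λ a → say a m b) t

  says-of-mono : ∀ {A : Set} (say : A → ℕ → Bool → Bool) {t u} → (∀ {a} → a ∈ t → a ∈ u) →
                 ∀ m b → T (says-of say t m b) → T (says-of say u m b)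
  says-of-mono say t⊆u m b s = let a , a∈ , r = to (any-T _ _) s in from (any-T _ _) (a , t⊆u a∈ , r)

  module _ {A : Set} (say : A → ℕ → Bool → Bool) (W : List ℕ) {M} (1≤M : 1 ≤ M) (∣W∣≤M : length W ≤ M)
           (member : ℕ → Bool) (member⇒∈ : ∀ {m} → T (member m) → m ∈ W) where

    designated : ∀ N → Subset N
    designated N = Vec.tabulate (member ∘ number)

    ∈-designated⁺ : ∀ {N} (i : Fin N) → T (member (number i)) → i Subset.∈ designated N
    ∈-designated⁺ i t = lookup⇒[]= i _ (trans (lookup∘tabulate _ i) (to T-≡ t))

    ∈-designated⁻ : ∀ {N} {i : Fin N} → i Subset.∈ designated N → T (member (number i))
    ∈-designated⁻ {i = i} i∈ = subst T (trans (sym ([]=⇒lookup i∈)) (lookup∘tabulate (member ∘ number) i)) tt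

    ∣designated∣≤M : ∀ N → ∣ designated N ∣ ≤ M
    ∣designated∣≤M N = begin
      ∣ designated N ∣                             ≡⟨ length-elements (designated N) ⟨
      length (elements (designated N))             ≡⟨ length-map number (elements (designated N)) ⟨
      length (map number (elements (designated N))) ≤⟨ length-⊆ (Unique.map⁺ number-injective (elements-unique (designated N))) ⊆W ⟩
      length W                                     ≤⟨ ∣W∣≤M ⟩
      M                                            ∎
      where
      open ≤-Reasoning
      ⊆W : ∀ {m} → m ∈ map number (elements (designated N)) → m ∈ W
      ⊆W m∈ with ∈-map⁻ number m∈
      ... | i , i∈ , refl = member⇒∈ (∈-designated⁻ (∈-elements⁻ {p = designated N} i∈))

    private
      instance
        M≢0 : NonZero M
        M≢0 = >-nonZero 1≤M

    -- A refutation branches only at existential claims: at most twofold at a small gate, which is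
    -- the factor 2 per level, and at most `M`-fold, over designated predecessors, at a large one,
    -- which uses up one unit of weft. The designation stays fixed; only the statements shrink from
    -- `D` to `t`.
    refutation-local : ∀ {n N} (C : Circuit n N) (D : List A) i b w → lookup (wefts C) i ≤ w →
      Refuted C member (says-of say D) i b →
      ∃[ t ] All (_∈ D) t × length t ≤ M ^ w * 2 ^ lookup (depths C) i × Refuted C member (says-of say t) i b
    refutation-local {n} inputs D i b w _ r =
      let a , a∈ , s = to (any-T (λ a → say a (number i) (not b)) D) (subst id (refuted-input member (says-of say D) i b) r)
      in a ∷ [] , a∈ ∷ [] , *-mono-≤ (m^n>0 M w) (m^n>0 2 (lookup (depths {n} inputs) i))
       , subst id (sym (refuted-input member (says-of say (a ∷ [])) i b)) (from (any-T (λ a → say a (number i) (not b)) (a ∷ [])) (a , here refl , s))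
    refutation-local (C ▷ g) D (suc i) b w weft≤ r = refutation-local C D i b w weft≤ r
    refutation-local {N = suc N} (C ▷ g) D zero b w weft≤ r = go (gateView g b)
      where
      d : ℕ
      d = maximum (select (predecessors g) (depths C))

      Result : Set
      Result = ∃[ t ] All (_∈ D) t × length t ≤ M ^ w * (2 * 2 ^ d) × Refuted (C ▷ g) member (says-of say t) zero b

      child≤w : ∀ {i} → i Subset.∈ predecessors g → lookup (wefts C) i ≤ w
      child≤w i∈ = ≤-trans (m≤n+m _ (if isLarge g then 1 else 0)) (≤-trans (child-weft C g i∈) weft≤)

      child≤d : ∀ {i} → i Subset.∈ predecessors g → lookup (depths C) i ≤ d
      child≤d i∈ = s≤s⁻¹ (child-depth C g i∈)

      child : ∀ {i} b w → i Subset.∈ predecessors g → lookup (wefts C) i ≤ w → Refuted C member (says-of say D) i b →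
              ∃[ t ] All (_∈ D) t × length t ≤ M ^ w * 2 ^ d × Refuted C member (says-of say t) i b
      child {i} b w i∈ w≤ r =
        let t , t⊆D , t≤ , rt = refutation-local C D i b w w≤ r
        in t , t⊆D , ≤-trans t≤ (*-monoʳ-≤ (M ^ w) (^-monoʳ-≤ 2 (child≤d i∈))) , rt

      double : M ^ w * 2 ^ d ≤ M ^ w * (2 * 2 ^ d)
      double = *-monoʳ-≤ (M ^ w) (m≤m+n (2 ^ d) _)

      children : ∀ {w} (q : Subset N) → (∀ {i} → i Subset.∈ q → i Subset.∈ predecessors g) →
                 (∀ {i} → i Subset.∈ q → lookup (wefts C) i ≤ w) →
                 (∀ {i} → i Subset.∈ q → Refuted C member (says-of say D) i b) →
                 ∃[ t ] All (_∈ D) t × length t ≤ ∣ q ∣ * (M ^ w * 2 ^ d)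
                      × (∀ {i} → i Subset.∈ q → Refuted C member (says-of say t) i b)
      children {w} q q⊆ w≤ r =
        let t , t⊆D , t≤ , rt = collect (_∈ D) (λ i t → Refuted C member (says-of say t) i b)
                                  (λ {i} sub → refuted-mono C (λ _ → id) (says-of-mono say sub) i b)
                                  (M ^ w * 2 ^ d) (elements q)
                                  (λ i∈ → let i∈q = ∈-elements⁻ {p = q} i∈ in child b w (q⊆ i∈q) (w≤ i∈q) (r i∈q))
        in t , t⊆D , subst (λ l → length t ≤ l * (M ^ w * 2 ^ d)) (length-elements q) t≤ , rt ∘ ∈-elements⁺

      wit : ∀ t i → witness (lookup (vals member (says-of say t) C) i) ≡ member (number i)
      wit t = witness-number member (says-of say t) C

      disj : ∀ l → isLarge g ≡ l →
             (∀ vs → T (refutes b (gateRef g vs)) ⇔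
               (∀ {i} → i Subset.∈ predecessors g → (T (isLarge g) → T (witness (lookup vs i))) → T (ref b (lookup vs i)))) →
             Result
      disj false eq spec =
        let t , t⊆D , t≤ , rt = children (predecessors g) id child≤w
                                  (λ i∈ → to (spec _) r i∈ λ large → contradiction (subst T eq large) id)
        in t , t⊆D
         , ≤-trans t≤ (≤-trans (*-monoˡ-≤ (M ^ w * 2 ^ d) (small-fan-in g eq))
                               (≤-reflexive (x∙yz≈y∙xz 2 (M ^ w) (2 ^ d))))
         , from (spec _) λ i∈ _ → rt i∈
      disj true eq spec with large-weft C g eq weft≤
      ... | w′ , refl , w≤ =
        let t , t⊆D , t≤ , rt = children {w′} q (λ i∈ → proj₁ (x∈p∩q⁻ (predecessors g) (designated N) i∈))
                                  (λ i∈ → w≤ (proj₁ (x∈p∩q⁻ (predecessors g) (designated N) i∈)))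
                                  (λ {i} i∈ → let i∈p , i∈W = x∈p∩q⁻ (predecessors g) (designated N) i∈ in
                                     to (spec _) r i∈p λ _ → subst T (sym (wit D i)) (∈-designated⁻ i∈W))
        in t , t⊆D
         , ≤-trans t≤ (≤-trans (*-monoˡ-≤ (M ^ w′ * 2 ^ d) (≤-trans (∣p∩q∣≤∣q∣ (predecessors g) (designated N)) (∣designated∣≤M N)))
                      (≤-trans (≤-reflexive (sym (*-assoc M (M ^ w′) (2 ^ d)))) double))
         , from (spec _) λ {i} i∈ large → rt (x∈p∩q⁺ (i∈ , ∈-designated⁺ i (subst T (wit t i) (large (subst T (sym eq) tt)))))
        where
        q : Subset N
        q = predecessors g ∩ designated N

      go : GateView g b → Result
      go (negation i i∈ _ spec) =
        let t , t⊆D , t≤ , rt = child (not b) w i∈ (child≤w i∈) (to (spec _) r) in t , t⊆D , ≤-trans t≤ double , from (spec _) rt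
      go (conjunctive _ spec) =
        let i , i∈ , r′ = to (spec _) r
            t , t⊆D , t≤ , rt = child b w i∈ (child≤w i∈) r′
        in t , t⊆D , ≤-trans t≤ double , from (spec _) (i , i∈ , rt)
      go (disjunctive _ spec) = disj (isLarge g) refl spec

  -- Witnesses that protect a true claim from refutation

  Consistent : ∀ {n} → (ℕ → Bool → Bool) → Vec Bool n → Set
  Consistent says ρ = ∀ j b → T (says (number j) b) → lookup ρ j ≡ b

  -- Quantifying over all designations that include `W` makes the notion monotone in `W`, so
  -- witnesses for several claims can be pooled and padded.
  Supports : ∀ {n N} → Circuit n N → Vec Bool n → List ℕ → Fin N → Bool → Set
  Supports C ρ W i b = ∀ member says → (∀ {m} → m ∈ W → T (member m)) → Consistent says ρ → ¬ Refuted C member says i b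

  -- A true existential claim about a large gate designates one predecessor that makes it true. A
  -- universal claim about a large gate inherits the witnesses of unboundedly many predecessors;
  -- with `w ≤ 1` these have weft 0, where the bound w · 2^depth is 0. Universal claims about small
  -- gates account for the doubling.
  support : ∀ {n N} (C : Circuit n N) ρ i b w → w ≤ 1 → lookup (wefts C) i ≤ w → lookup (eval C ρ) i ≡ b →
            ∃[ W ] All (_< N) W × length W ≤ w * 2 ^ lookup (depths C) i × Supports C ρ W i b
  support inputs ρ i b w _ _ ev = [] , [] , z≤n , λ member says _ consistent r →
    not-¬ ev (consistent i (not b) (subst id (refuted-input member says i b) r))
  support (C ▷ g) ρ (suc i) b w w≤1 weft≤ ev =
    let W , W<N , W≤ , sup = support C ρ i b w w≤1 weft≤ ev in W , All.map m≤n⇒m≤1+n W<N , W≤ , sup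
  support {N = suc N} (C ▷ g) ρ zero b w w≤1 weft≤ ev = go (gateView g b)
    where
    d : ℕ
    d = maximum (select (predecessors g) (depths C))

    Result : Set
    Result = ∃[ W ] All (_< suc N) W × length W ≤ w * (2 * 2 ^ d) × Supports (C ▷ g) ρ W zero b

    child : ∀ {i b w} → i Subset.∈ predecessors g → w ≤ 1 → lookup (wefts C) i ≤ w → lookup (eval C ρ) i ≡ b →
            ∃[ W ] All (_< suc N) W × length W ≤ w * 2 ^ d × Supports C ρ W i b
    child {i} {b} {w} i∈ w≤1 weft≤ ev =
      let W , W<N , W≤ , sup = support C ρ i b w w≤1 weft≤ ev
      in W , All.map m≤n⇒m≤1+n W<N , ≤-trans W≤ (*-monoʳ-≤ w (^-monoʳ-≤ 2 (s≤s⁻¹ (child-depth C g i∈)))) , sup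

    children : ∀ {w} → w ≤ 1 → (∀ {i} → i Subset.∈ predecessors g → lookup (wefts C) i ≤ w) →
               (∀ {i} → i Subset.∈ predecessors g → lookup (eval C ρ) i ≡ b) →
               ∃[ W ] All (_< suc N) W × length W ≤ ∣ predecessors g ∣ * (w * 2 ^ d)
                    × (∀ {i} → i Subset.∈ predecessors g → Supports C ρ W i b)
    children {w} w≤1 weft≤ ev =
      let W , W<N , W≤ , sup = collect (_< suc N) (λ i W → Supports C ρ W i b)
                               (λ sub sup member says W∋ → sup member says (W∋ ∘ sub)) (w * 2 ^ d) (elements (predecessors g))
                               (λ i∈ → let i∈p = ∈-elements⁻ {p = predecessors g} i∈
                                       in child i∈p w≤1 (weft≤ i∈p) (ev i∈p))
      in W , W<N , subst (λ l → length W ≤ l * (w * 2 ^ d)) (length-elements (predecessors g)) W≤ , sup ∘ ∈-elements⁺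

    child≤w : ∀ {i} → i Subset.∈ predecessors g → lookup (wefts C) i ≤ w
    child≤w i∈ = ≤-trans (m≤n+m _ (if isLarge g then 1 else 0)) (≤-trans (child-weft C g i∈) weft≤)

    single : w * 2 ^ d ≤ w * (2 * 2 ^ d)
    single = *-monoʳ-≤ w (m≤m+n (2 ^ d) _)

    conj : ∀ l → isLarge g ≡ l → (∀ {i} → i Subset.∈ predecessors g → lookup (eval C ρ) i ≡ b) →
           (∀ vs → T (refutes b (gateRef g vs)) ⇔ (∃[ i ] i Subset.∈ predecessors g × T (ref b (lookup vs i)))) → Result
    conj false eq ev spec =
      let W , W<N , W≤ , sup = children w≤1 child≤w ev
      in W , W<N , ≤-trans W≤ (≤-trans (*-monoˡ-≤ (w * 2 ^ d) (small-fan-in g eq)) (≤-reflexive (x∙yz≈y∙xz 2 w (2 ^ d))))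
       , λ member says W∋ cons r → let i , i∈ , r′ = to (spec _) r in sup i∈ member says W∋ cons r′
    conj true eq ev spec with large-weft C g eq weft≤
    ... | w′ , refl , w≤ with n≤0⇒n≡0 (s≤s⁻¹ w≤1)
    ... | refl =
      let W , W<N , W≤ , sup = children z≤n w≤ ev
      in W , W<N , ≤-trans W≤ (≤-trans (≤-reflexive (*-zeroʳ ∣ predecessors g ∣)) z≤n)
       , λ member says W∋ cons r → let i , i∈ , r′ = to (spec _) r in sup i∈ member says W∋ cons r′

    disj : ∀ l → isLarge g ≡ l → (∃[ i ] i Subset.∈ predecessors g × lookup (eval C ρ) i ≡ b) →
           (∀ vs → T (refutes b (gateRef g vs)) ⇔
             (∀ {i} → i Subset.∈ predecessors g → (T (isLarge g) → T (witness (lookup vs i))) → T (ref b (lookup vs i)))) → Result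
    disj false eq (i , i∈ , ev) spec =
      let W , W<N , W≤ , sup = child i∈ w≤1 (child≤w i∈) ev
      in W , W<N , ≤-trans W≤ single
       , λ member says W∋ cons r → sup member says W∋ cons (to (spec _) r i∈ λ large → contradiction (subst T eq large) id)
    disj true eq (i , i∈ , ev) spec with large-weft C g eq weft≤
    ... | w′ , refl , w≤ with n≤0⇒n≡0 (s≤s⁻¹ w≤1)
    ... | refl =
      let W , W<N , W≤ , sup = child i∈ z≤n (w≤ i∈) ev
      in number i ∷ W , m≤n⇒m≤1+n (number<N i) ∷ W<N , +-mono-≤ (m^n>0 2 (suc d)) W≤
       , λ member says W∋ cons r → sup member says (W∋ ∘ there) cons
           (to (spec _) r i∈ λ _ → subst T (sym (witness-number member says C i)) (W∋ (here refl)))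

    go : GateView g b → Result
    go (negation i i∈ ev-spec spec) =
      let W , W<N , W≤ , sup = child i∈ w≤1 (child≤w i∈) (to (ev-spec _) ev)
      in W , W<N , ≤-trans W≤ single , λ member says W∋ cons r → sup member says W∋ cons (to (spec _) r)
    go (conjunctive ev-spec spec) = conj (isLarge g) refl (to (ev-spec _) ev) spec
    go (disjunctive ev-spec spec) = disj (isLarge g) refl (to (ev-spec _) ev) spec

open Refutations

-- Assignments as tilings by gaps

module Tilings where

  open import Data.Bool.Base using (Bool; true; false; T; _∧_)
  open import Data.Bool.Properties using (T?; T-∧)
  open import Data.Bool.ListAction using (any)
  open import Data.Fin.Base using (Fin; zero; suc)
  open import Data.Fin.Subset as Subset using (∣_∣)
  open import Data.List.Base as List using (List; []; _∷_; length; map)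
  open import Data.List.Membership.Propositional using (_∈_)
  open import Data.List.Membership.Propositional.Properties
  import Data.List.Membership.DecPropositional as DecMembership
  open import Data.List.Properties using (length-map; length-upTo)
  open import Data.List.Relation.Unary.All as All using (All; []; _∷_)
  import Data.List.Relation.Unary.All.Properties as All
  open import Data.List.Relation.Unary.AllPairs using ([]; _∷_)
  open import Data.List.Relation.Unary.Any as Any using (here; there)
  open import Data.List.Relation.Unary.Unique.Propositional using (Unique)
  open import Data.Nat.Base
  open import Data.Nat.Properties
  open import Data.Product.Base using (∃-syntax; _×_; _,_; proj₁; proj₂)
  open import Data.Sum.Base using (inj₁; inj₂)
  open import Data.Unit.Base using (tt)
  open import Data.Vec.Base as Vec using (Vec; []; _∷_; lookup)
  open import Function.Base using (id; _∘_)
  open import Function.Bundles using (_⇔_; mk⇔; Equivalence)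
  open import Relation.Binary.Definitions using (DecidableEquality; tri<; tri≈; tri>)
  open import Relation.Binary.PropositionalEquality
  open import Relation.Nullary using (¬_; Dec; contradiction)
  open import Relation.Nullary.Decidable using (_×-dec_; _→-dec_; map′; decidable-stable)

  open Equivalence using (to; from)

  eqList-sound : ∀ xs ys → T (eqList xs ys) → xs ≡ ys
  eqList-sound []       []       _ = refl
  eqList-sound (x ∷ xs) (y ∷ ys) t =
    let x≡y , xs≡ys = to T-∧ t in cong₂ _∷_ (≡ᵇ⇒≡ x y x≡y) (eqList-sound xs ys xs≡ys)

  eqList-refl : ∀ xs → T (eqList xs xs)
  eqList-refl []       = tt
  eqList-refl (x ∷ xs) = from T-∧ (≡⇒≡ᵇ x x refl , eqList-refl xs)

  -- Defined through `eqList` so that `does` reduces to a function already known to run in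
  -- polynomial time.
  _≟ᴸ_ : DecidableEquality (List ℕ)
  xs ≟ᴸ ys = map′ (eqList-sound xs ys) (λ { refl → eqList-refl xs }) (T? (eqList xs ys))

  -- A hub carries its level, a slot number, the end points of a gap and the designated
  -- witnesses.  The gap (a , b) of slot i states that, counting inputs upwards from 1,
  -- the inputs strictly between a and b are false and that input b, if it exists, is the
  -- i-th true one, counted from 0.

  Hub : Set
  Hub = ℕ × (ℕ × (ℕ × (ℕ × List ℕ)))

  level slot lo hi : Hub → ℕ
  level = proj₁
  slot  = proj₁ ∘ proj₂
  lo    = proj₁ ∘ proj₂ ∘ proj₂
  hi    = proj₁ ∘ proj₂ ∘ proj₂ ∘ proj₂

  witnesses : Hub → List ℕ
  witnesses = proj₂ ∘ proj₂ ∘ proj₂ ∘ proj₂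

  _≟ᴴ_ : DecidableEquality Hub
  u ≟ᴴ v = map′ (λ { (refl , refl , refl , refl , refl) → refl })
                (λ { refl → refl , refl , refl , refl , refl })
                (level u ≟ level v ×-dec slot u ≟ slot v ×-dec lo u ≟ lo v ×-dec hi u ≟ hi v ×-dec witnesses u ≟ᴸ witnesses v)

  -- Input `m` sits at position `suc m`, as 0 is the lower end of the whole interval. A gap speaks
  -- about its interior and its upper end; its lower end belongs to the gap below, and an upper end
  -- n + 1 is no input.
  say : Hub → ℕ → Bool → Bool
  say u m true  = hi u ≡ᵇ suc m
  say u m false = (lo u <ᵇ suc m) ∧ (suc m <ᵇ hi u)

  member : List Hub → ℕ → Bool
  member t m = any (λ u → any (λ w → m ≡ᵇ w) (witnesses u)) t

  member-∈ : ∀ t m → T (member t m) ⇔ (∃[ u ] u ∈ t × m ∈ witnesses u)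
  member-∈ t m = mk⇔
    (λ x → let u , u∈ , y = to (any-T _ t) x ; w , w∈ , m≡w = to (any-T _ (witnesses u)) y
           in u , u∈ , subst (_∈ witnesses u) (sym (≡ᵇ⇒≡ m w m≡w)) w∈)
    (λ { (u , u∈ , m∈) → from (any-T _ t) (u , u∈ , from (any-T _ (witnesses u)) (m , m∈ , ≡⇒≡ᵇ m m refl)) })

  member-mono : ∀ {t u} m → (∀ {h} → h ∈ t → h ∈ u) → T (member t m) → T (member u m)
  member-mono {t} {u} m t⊆u x = let h , h∈ , m∈ = to (member-∈ t m) x in from (member-∈ u m) (h , t⊆u h∈ , m∈)

  -- All slots 0 , … , K − 1 together have to tile the interval from 0 to n + 1.

  Fits : ℕ → ℕ → Hub → Hub → Set
  Fits K n u v =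
      witnesses u ≡ witnesses v
    × lo u < hi u
    × slot u < K
    × (slot u ≡ 0 → lo u ≡ 0)
    × (suc (slot u) ≡ K → hi u ≡ suc n)
    × (slot u ≡ slot v → u ≡ v)
    × (slot u < slot v → hi u ≤ lo v)
    × (suc (slot u) ≡ slot v → hi u ≡ lo v)

  fits? : ∀ K n u v → Dec (Fits K n u v)
  fits? K n u v =
          witnesses u ≟ᴸ witnesses v
    ×-dec lo u <? hi u
    ×-dec slot u <? K
    ×-dec (slot u ≟ 0 →-dec lo u ≟ 0)
    ×-dec (suc (slot u) ≟ K →-dec hi u ≟ suc n)
    ×-dec (slot u ≟ slot v →-dec u ≟ᴴ v)
    ×-dec (slot u <? slot v →-dec hi u ≤? lo v)
    ×-dec (suc (slot u) ≟ slot v →-dec hi u ≟ lo v)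

  -- Pigeonhole. It will show that `K` hubs with distinct slots below `K` occupy every slot.
  unique-bounded⇒∈ : ∀ {m xs} → Unique xs → (∀ {x} → x ∈ xs → x < m) → length xs ≡ m → ∀ {i} → i < m → i ∈ xs
  unique-bounded⇒∈ {m} {xs} uniq <m len {i} i<m = decidable-stable (i ∈? xs) λ i∉ →
    1+n≰n (subst₂ (λ a b → suc a ≤ b) len (length-upTo m)
      (length-⊆ (All.¬Any⇒All¬ xs i∉ ∷ uniq) λ { (here refl) → ∈-upTo⁺ i<m ; (there x∈) → ∈-upTo⁺ (<m x∈) }))
    where open DecMembership _≟_ using (_∈?_)

  bits : (ℕ → Bool) → ∀ n → Vec Bool n
  bits f zero    = []
  bits f (suc n) = f n ∷ bits f n

  lookup-bits : ∀ f n i → lookup (bits f n) i ≡ f (number i)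
  lookup-bits f (suc n) zero    = refl
  lookup-bits f (suc n) (suc i) = lookup-bits f n i

  module Tiling {k n} (D : List Hub) (unique : Unique D) (∣D∣≡K : length D ≡ suc k)
                (level≡ : ∀ {u v} → u ∈ D → v ∈ D → level u ≡ level v)
                (fits : ∀ {u v} → u ∈ D → v ∈ D → Fits (suc k) n u v) where

    private
      same-slot : ∀ {u v} → u ∈ D → v ∈ D → slot u ≡ slot v → u ≡ v
      same-slot u∈ v∈ = let _ , _ , _ , _ , _ , same , _ = fits u∈ v∈ in same

      ordered : ∀ {u v} → u ∈ D → v ∈ D → slot u < slot v → hi u ≤ lo v
      ordered u∈ v∈ = let _ , _ , _ , _ , _ , _ , ord , _ = fits u∈ v∈ in ord

      adjacent : ∀ {u v} → u ∈ D → v ∈ D → suc (slot u) ≡ slot v → hi u ≡ lo v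
      adjacent u∈ v∈ = let _ , _ , _ , _ , _ , _ , _ , adj = fits u∈ v∈ in adj

      lo<hi : ∀ {u} → u ∈ D → lo u < hi u
      lo<hi u∈ = let _ , lt , _ = fits u∈ u∈ in lt

      slot<K : ∀ {u} → u ∈ D → slot u < suc k
      slot<K u∈ = let _ , _ , s< , _ = fits u∈ u∈ in s<

      first : ∀ {u} → u ∈ D → slot u ≡ 0 → lo u ≡ 0
      first u∈ = let _ , _ , _ , f , _ = fits u∈ u∈ in f

      last : ∀ {u} → u ∈ D → suc (slot u) ≡ suc k → hi u ≡ suc n
      last u∈ = let _ , _ , _ , _ , l , _ = fits u∈ u∈ in l

      slots-unique : ∀ {xs} → (∀ {u} → u ∈ xs → u ∈ D) → Unique xs → Unique (map slot xs)
      slots-unique {[]}     _  _            = []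
      slots-unique {x ∷ xs} ⊆D (x∉ ∷ uniq) = All.map⁺ (All.tabulate λ u∈ eq →
        All.lookup x∉ u∈ (same-slot (⊆D (here refl)) (⊆D (there u∈)) eq)) ∷ slots-unique (⊆D ∘ there) uniq

    at-slot : ∀ {i} → i < suc k → ∃[ u ] u ∈ D × slot u ≡ i
    at-slot i<K with ∈-map⁻ slot (unique-bounded⇒∈ (slots-unique id unique) bounded (trans (length-map slot D) ∣D∣≡K) i<K)
      where
      bounded : ∀ {x} → x ∈ map slot D → x < suc k
      bounded x∈ with ∈-map⁻ slot x∈
      ... | u , u∈ , refl = slot<K u∈
    ... | u , u∈ , eq = u , u∈ , sym eq

    truth : ℕ → Bool
    truth m = says-of say D m true

    private
      truth-hi : ∀ {m u} → u ∈ D → hi u ≡ suc m → T (truth m)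
      truth-hi {m} {u} u∈ eq = from (any-T _ D) (u , u∈ , ≡⇒≡ᵇ (hi u) (suc m) eq)

      -- The gap of any other slot lies entirely below or above that of `u`, so it cannot end in the
      -- interior of `u`.
      truth-inside : ∀ {m u} → u ∈ D → lo u ≤ m → suc m < hi u → ¬ T (truth m)
      truth-inside {m} {u} u∈ lo≤ <hi t with to (any-T _ D) t
      ... | v , v∈ , e with ≡ᵇ⇒≡ (hi v) (suc m) e | <-cmp (slot u) (slot v)
      ... | hi≡ | tri< u<v _ _ = <⇒≱ (≤-<-trans (ordered u∈ v∈ u<v) (lo<hi v∈)) (≤-trans (≤-reflexive hi≡) (<⇒≤ <hi))
      ... | hi≡ | tri≈ _ u≡v _ = <⇒≢ <hi (sym (trans (cong hi (same-slot u∈ v∈ u≡v)) hi≡))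
      ... | hi≡ | tri> _ _ v<u = <⇒≱ (≤-trans (s≤s lo≤) (≤-reflexive (sym hi≡))) (ordered v∈ u∈ v<u)

      count-true : ∀ m → T (truth m) → ∣ bits truth (suc m) ∣ ≡ suc ∣ bits truth m ∣
      count-true m t with truth m
      ... | true = refl

      count-false : ∀ m → ¬ T (truth m) → ∣ bits truth (suc m) ∣ ≡ ∣ bits truth m ∣
      count-false m ¬t with truth m
      ... | true  = contradiction tt ¬t
      ... | false = refl

    -- A sweep upwards through the positions, in which the slot of the current gap counts the true
    -- inputs passed so far. At an upper end the sweep enters the next slot; this fails only for the
    -- last slot, whose gap ends at n + 1 and is not exhausted by `m ≤ n`.
    locate : ∀ m → m ≤ n → ∃[ u ] u ∈ D × lo u ≤ m × m < hi u × ∣ bits truth m ∣ ≡ slot u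
    locate zero _ =
      let u , u∈ , s0 = at-slot (s≤s z≤n)
      in u , u∈ , ≤-reflexive (first u∈ s0) , ≤-<-trans z≤n (lo<hi u∈) , sym s0
    locate (suc m) m<n with locate m (<⇒≤ m<n)
    ... | u , u∈ , lo≤ , <hi , count with m≤n⇒m<n∨m≡n <hi
    ... | inj₁ 1+m<hi = u , u∈ , m≤n⇒m≤1+n lo≤ , 1+m<hi , trans (count-false m (truth-inside u∈ lo≤ 1+m<hi)) count
    ... | inj₂ 1+m≡hi with m≤n⇒m<n∨m≡n (slot<K u∈)
    ... | inj₂ last-slot = contradiction (trans 1+m≡hi (last u∈ last-slot)) (<⇒≢ (s≤s m<n))
    ... | inj₁ 1+s<K =
      let v , v∈ , sv = at-slot 1+s<K
          hi≡lo       = adjacent u∈ v∈ (sym sv)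
      in v , v∈ , ≤-reflexive (sym (trans 1+m≡hi hi≡lo)) , subst (_< hi v) (sym (trans 1+m≡hi hi≡lo)) (lo<hi v∈)
       , trans (count-true m (truth-hi u∈ (sym 1+m≡hi))) (trans (cong suc count) (sym sv))

    -- Position `n` lies in the gap of the last slot, because every earlier gap ends at `n` or
    -- below.
    weight : ∣ bits truth n ∣ ≡ k
    weight with locate n ≤-refl | at-slot {k} ≤-refl
    ... | u , u∈ , lo≤ , n<hi , count | v , v∈ , sv with m≤n⇒m<n∨m≡n (s≤s⁻¹ (slot<K u∈))
    ... | inj₂ su = trans count su
    ... | inj₁ su<k = contradiction
      (≤-<-trans (ordered u∈ v∈ (subst (slot u <_) (sym sv) su<k))
                 (≤-trans (lo<hi v∈) (≤-reflexive (last v∈ (cong suc sv)))))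
      (<⇒≱ (s≤s n<hi))

    -- A false input is in the interior of the gap located there: as the upper end it would be true.
    decides : ∀ (i : Fin n) → T (says-of say D (number i) (lookup (bits truth n) i))
    decides i rewrite lookup-bits truth n i with truth (number i) in eq
    ... | true  = subst T (sym eq) tt
    ... | false with locate (number i) (<⇒≤ (number<N i))
    ... | u , u∈ , lo≤ , <hi , _ with m≤n⇒m<n∨m≡n <hi
    ... | inj₁ 1+m<hi = from (any-T _ D) (u , u∈ , from T-∧ (<⇒<ᵇ (s≤s lo≤) , <⇒<ᵇ 1+m<hi))
    ... | inj₂ 1+m≡hi = contradiction (truth-hi u∈ (sym 1+m≡hi)) (subst (¬_ ∘ T) (sym eq) id)

  -- Conversely, the gaps of an assignment, read upwards: the closed gaps, the number of
  -- true inputs and the start of the gap that is still open.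

  module Gaps (L : ℕ) (W : List ℕ) where

    gaps : ∀ {m} → Vec Bool m → List Hub × ℕ × ℕ
    gaps []                    = [] , 0 , 0
    gaps {suc m} (true ∷ ρ)    = let us , i , a = gaps ρ in (L , i , a , suc m , W) ∷ us , suc i , suc m
    gaps (false ∷ ρ)           = gaps ρ

    closed : ∀ {m} → Vec Bool m → List Hub
    closed ρ = proj₁ (gaps ρ)

    open-slot open-lo : ∀ {m} → Vec Bool m → ℕ
    open-slot ρ = proj₁ (proj₂ (gaps ρ))
    open-lo ρ   = proj₂ (proj₂ (gaps ρ))

    open-slot≡∣ρ∣ : ∀ {m} (ρ : Vec Bool m) → open-slot ρ ≡ ∣ ρ ∣
    open-slot≡∣ρ∣ []          = refl
    open-slot≡∣ρ∣ (true ∷ ρ)  = cong suc (open-slot≡∣ρ∣ ρ)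
    open-slot≡∣ρ∣ (false ∷ ρ) = open-slot≡∣ρ∣ ρ

    length-closed : ∀ {m} (ρ : Vec Bool m) → length (closed ρ) ≡ ∣ ρ ∣
    length-closed []          = refl
    length-closed (true ∷ ρ)  = cong suc (length-closed ρ)
    length-closed (false ∷ ρ) = length-closed ρ

    open-lo≤ : ∀ {m} (ρ : Vec Bool m) → open-lo ρ ≤ m
    open-lo≤ []          = z≤n
    open-lo≤ (true ∷ ρ)  = ≤-refl
    open-lo≤ (false ∷ ρ) = m≤n⇒m≤1+n (open-lo≤ ρ)

    open-first : ∀ {m} (ρ : Vec Bool m) → open-slot ρ ≡ 0 → open-lo ρ ≡ 0
    open-first []          _  = refl
    open-first (false ∷ ρ) eq = open-first ρ eq

    record Closed (i a : ℕ) (u : Hub) : Set where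
      field
        slot<  : slot u < i
        lo<hi  : lo u < hi u
        hi≤    : hi u ≤ a
        first  : slot u ≡ 0 → lo u ≡ 0
        last   : suc (slot u) ≡ i → hi u ≡ a
        wits   : witnesses u ≡ W
        level≡ : level u ≡ L

    open Closed public

    closed-props : ∀ {m} (ρ : Vec Bool m) {u} → u ∈ closed ρ → Closed (open-slot ρ) (open-lo ρ) u
    closed-props (false ∷ ρ) u∈          = closed-props ρ u∈
    closed-props (true ∷ ρ)  (here refl) = record
      { slot< = ≤-refl ; lo<hi = s≤s (open-lo≤ ρ) ; hi≤ = ≤-refl ; first = open-first ρ
      ; last = λ _ → refl ; wits = refl ; level≡ = refl }
    closed-props (true ∷ ρ)  (there u∈)  = let c = closed-props ρ u∈ in record
      { slot<  = m≤n⇒m≤1+n (slot< c)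
      ; lo<hi  = lo<hi c
      ; hi≤    = ≤-trans (hi≤ c) (m≤n⇒m≤1+n (open-lo≤ ρ))
      ; first  = first c
      ; last   = λ eq → contradiction (suc-injective eq) (<⇒≢ (slot< c))
      ; wits   = wits c
      ; level≡ = level≡ c
      }

    closed-unique : ∀ {m} (ρ : Vec Bool m) → Unique (closed ρ)
    closed-unique []          = []
    closed-unique (true ∷ ρ)  = All.tabulate (λ u∈ eq → <⇒≢ (slot< (closed-props ρ u∈)) (cong slot (sym eq))) ∷ closed-unique ρ
    closed-unique (false ∷ ρ) = closed-unique ρ

    Tiled : Hub → Hub → Set
    Tiled u v = (slot u ≡ slot v → u ≡ v) × (slot u < slot v → hi u ≤ lo v) × (suc (slot u) ≡ slot v → hi u ≡ lo v)

    tiled : ∀ {m} (ρ : Vec Bool m) {u v} → u ∈ closed ρ → v ∈ closed ρ → Tiled u v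
    tiled (false ∷ ρ) u∈ v∈ = tiled ρ u∈ v∈
    tiled (true ∷ ρ) (here refl) (here refl) = (λ _ → refl) , (λ s< → contradiction s< 1+n≰n) , λ eq → contradiction eq 1+n≢n
    tiled (true ∷ ρ) (here refl) (there v∈)  =
      let c = closed-props ρ v∈
      in (λ eq → contradiction (sym eq) (<⇒≢ (slot< c)))
       , (λ s< → contradiction (slot< c) (<⇒≱ (m<n⇒m<1+n s<)))
       , λ eq → contradiction (slot< c) (<⇒≱ (subst (open-slot ρ <_) (cong suc eq) (s≤s (n≤1+n _))))
    tiled (true ∷ ρ) (there u∈)  (here refl) =
      let c = closed-props ρ u∈
      in (λ eq → contradiction eq (<⇒≢ (slot< c))) , (λ _ → hi≤ c) , last c
    tiled (true ∷ ρ) (there u∈)  (there v∈)  = tiled ρ u∈ v∈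

    open-false : ∀ {m} (ρ : Vec Bool m) j → open-lo ρ ≤ number j → lookup ρ j ≡ false
    open-false (true ∷ ρ)  zero    a≤ = contradiction a≤ 1+n≰n
    open-false (true ∷ ρ)  (suc j) a≤ = contradiction (≤-trans a≤ (<⇒≤ (number<N j))) 1+n≰n
    open-false (false ∷ ρ) zero    a≤ = refl
    open-false (false ∷ ρ) (suc j) a≤ = open-false ρ j a≤

    say-lo : ∀ {u m} → T (say u m false) → lo u ≤ m
    say-lo {u} {m} t = s≤s⁻¹ (<ᵇ⇒< (lo u) (suc m) (proj₁ (to T-∧ t)))

    say-hi : ∀ {u m} b → T (say u m b) → suc m ≤ hi u
    say-hi {u} {m} true  t = ≤-reflexive (sym (≡ᵇ⇒≡ (hi u) (suc m) t))
    say-hi {u} {m} false t = <⇒≤ (<ᵇ⇒< (suc m) (hi u) (proj₂ (to (T-∧ {lo u <ᵇ suc m}) t)))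

    say-consistent : ∀ {m} (ρ : Vec Bool m) {u} → u ∈ closed ρ → ∀ j b → T (say u (number j) b) → lookup ρ j ≡ b
    say-consistent {suc m} (x ∷ ρ) {u} u∈ zero b t = at-top x u∈ b t
      where
      at-top : ∀ x → u ∈ closed (x ∷ ρ) → ∀ b → T (say u m b) → x ≡ b
      at-top false u∈          b     t = contradiction (≤-trans (say-hi {u} b t) (≤-trans (hi≤ (closed-props ρ u∈)) (open-lo≤ ρ))) 1+n≰n
      at-top true  (here refl) true  t = refl
      at-top true  (here refl) false t = contradiction (<ᵇ⇒< (suc m) (suc m) (proj₂ (to (T-∧ {open-lo ρ <ᵇ suc m}) t))) 1+n≰n
      at-top true  (there u∈)  b     t = contradiction (≤-trans (say-hi {u} b t) (≤-trans (hi≤ (closed-props ρ u∈)) (open-lo≤ ρ))) 1+n≰n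
    say-consistent (false ∷ ρ) u∈          (suc j) b     t = say-consistent ρ u∈ j b t
    say-consistent (true ∷ ρ)  (there u∈)  (suc j) b     t = say-consistent ρ u∈ j b t
    say-consistent (true ∷ ρ)  (here refl) (suc j) true  t =
      contradiction (suc-injective (≡ᵇ⇒≡ _ _ t)) (≢-sym (<⇒≢ (number<N j)))
    say-consistent (true ∷ ρ)  {u} (here refl) (suc j) false t = open-false ρ j (say-lo {u} t)

    closed-fits : ∀ {n} (ρ : Vec Bool n) {u v} → u ∈ closed (true ∷ ρ) → v ∈ closed (true ∷ ρ) →
                  Fits (suc ∣ ρ ∣) n u v
    closed-fits ρ {u} u∈ v∈ =
      let c = closed-props (true ∷ ρ) u∈
          same , ord , adj = tiled (true ∷ ρ) u∈ v∈
          K≡ = cong suc (open-slot≡∣ρ∣ ρ)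
      in trans (wits c) (sym (wits (closed-props (true ∷ ρ) v∈)))
       , lo<hi c , subst (slot u <_) K≡ (slot< c) , first c , (λ eq → last c (trans eq (sym K≡))) , same , ord , adj

open Tilings

-- The gadget of a circuit and its correctness

module CircuitReduction where

  open import Data.Bool.Base using (Bool; true; false; T; not; _∧_)
  open import Data.Bool.Properties using (T-∧)
  open import Data.Bool.ListAction using (all)
  open import Data.Fin.Base using (zero; suc)
  open import Data.Fin.Subset as Subset using (∣_∣)
  open import Data.List.Base as List using (List; []; _∷_; length; _++_; map; upTo; replicate; cartesianProductWith; drop)
  open import Data.List.Membership.Propositional using (_∈_)
  open import Data.List.Membership.Propositional.Properties
  open import Data.List.Properties using (length-map; length-upTo; length-++; length-replicate)
  open import Data.List.Relation.Unary.All as All using (All; []; _∷_)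
  import Data.List.Relation.Unary.All.Properties as All
  open import Data.List.Relation.Unary.Any as Any using (here; there)
  open import Data.List.Relation.Unary.Unique.Propositional using (Unique)
  import Data.List.Relation.Unary.Unique.Propositional.Properties as Unique
  open import Data.Nat.Base
  open import Data.Nat.Properties
  open import Data.Product.Base using (Σ-syntax; ∃-syntax; _×_; _,_; proj₁; proj₂)
  open import Data.Unit.Base using (tt)
  open import Data.Vec.Base as Vec using (Vec; []; _∷_; lookup)
  open import Function.Base using (case_of_)
  open import Function.Bundles using (Equivalence)
  open import Relation.Binary.PropositionalEquality
  open import Relation.Nullary using (¬_; contradiction)
  open import Relation.Nullary.Decidable using (does)

  open Equivalence using (to; from)

  n≤N : ∀ {n N} → Circuit n N → n ≤ N
  n≤N inputs  = ≤-refl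
  n≤N (C ▷ g) = m≤n⇒m≤1+n (n≤N C)

  T-not⁻ : ∀ {b} → T (not b) → ¬ T b
  T-not⁻ {false} _ ()

  T-not⁺ : ∀ {b} → ¬ T b → T (not b)
  T-not⁺ {true}  ¬t = contradiction tt ¬t
  T-not⁺ {false} _  = tt

  pad : ∀ {A : Set} c (x : A) {D t} → x ∈ D → All (_∈ D) t → length t ≤ c →
        ∃[ u ] u ∈ tuples c D × (∀ {y} → y ∈ t → y ∈ u)
  pad c x {D} {t} x∈D t⊆D t≤c = t ++ replicate (c ∸ length t) x
    , subst (λ l → t ++ replicate (c ∸ length t) x ∈ tuples l D)
            (trans (length-++ t) (trans (cong (length t +_) (length-replicate (c ∸ length t))) (m+[n∸m]≡n t≤c)))
            (∈-tuples⁺ (All.++⁺ t⊆D (All.replicate⁺ (c ∸ length t) x∈D)))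
    , ∈-++⁺ˡ

  pairs : ∀ {A B : Set} → List A → List B → List (A × B)
  pairs = cartesianProductWith _,_

  pairs-unique : ∀ {A B : Set} {xs : List A} {ys : List B} → Unique xs → Unique ys → Unique (pairs xs ys)
  pairs-unique = Unique.cartesianProductWith⁺ _,_ λ { refl → refl , refl }

  -- With M witnesses, a refutation of the output depends on at most M · 2ᵈ hubs; tuples
  -- leave room for two more so that they also see every pair of hubs.

  witnessCount : ℕ → ℕ
  witnessCount d = 2 ^ d

  tupleSize : ℕ → ℕ
  tupleSize d = suc (suc (witnessCount d * 2 ^ d))

  -- The slot merely tells the hubs of one layer apart, and the remaining fields are dummies; the
  -- level separates them from the gaps.
  layerHub : ℕ → ℕ → Hub
  layerHub i j = i , j , 0 , 0 , []

  layerHubs : ℕ → List Hub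
  layerHubs K = cartesianProductWith layerHub (upTo K) (upTo (suc K))

  -- All r^(3 + M) candidates are listed, meaningful or not; unsuitable ones are excluded only by
  -- the tuples that contain them.
  slotHubs : ℕ → ℕ → ℕ → List Hub
  slotHubs M K r = map (K ,_) (pairs (upTo r) (pairs (upTo r) (pairs (upTo r) (tuples M (upTo r)))))

  module Reduction (d : ℕ) (I : WCSInstance 1 d) where
    open WCSInstance I

    K r M : ℕ
    K = suc k
    -- A common range for slots up to `k`, end points up to n + 1 ≤ N + 1, node numbers below `N`,
    -- and the number 0 used for padding.
    r = suc (suc (N + k))
    M = witnessCount d

    allFit : List Hub → Bool
    allFit t = all (λ u → all (λ v → does (fits? K n u v)) t) t

    refuted : List Hub → Bool
    refuted t = ref true (lookup (vals (member t) (says-of say t) circuit) output)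

    good : List Hub → Bool
    good t = allFit t ∧ not (refuted t)

    A L : List Hub
    A = slotHubs M K r
    -- The start `layerHub 0 0` heads the list, so `s ∷ L` is `layerHubs K` by computation.
    L = drop 1 (layerHubs K)

    private
      s : Hub
      s = layerHub 0 0

      A-level : ∀ {h} → h ∈ A → level h ≡ K
      A-level h∈ with ∈-map⁻ (K ,_) h∈
      ... | _ , _ , refl = refl

      A-witnesses : ∀ {h} → h ∈ A → length (witnesses h) ≡ M
      A-witnesses h∈ with ∈-map⁻ (K ,_) h∈
      ... | _ , p∈ , refl with ∈-cartesianProductWith⁻ _,_ (upTo r) _ p∈
      ... | _ , _ , _ , q∈ , refl with ∈-cartesianProductWith⁻ _,_ (upTo r) _ q∈
      ... | _ , _ , _ , w∈ , refl with ∈-cartesianProductWith⁻ _,_ (upTo r) _ w∈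
      ... | _ , _ , _ , W∈ , refl = proj₁ (∈-tuples⁻ M W∈)

      ∈A : ∀ {h} → level h ≡ K → slot h < r → lo h < r → hi h < r → witnesses h ∈ tuples M (upTo r) → h ∈ A
      ∈A refl s< l< h< W∈ = ∈-map⁺ (K ,_) (∈-cartesianProductWith⁺ _,_ (∈-upTo⁺ s<)
        (∈-cartesianProductWith⁺ _,_ (∈-upTo⁺ l<) (∈-cartesianProductWith⁺ _,_ (∈-upTo⁺ h<) W∈)))

      L-level : ∀ {h} → h ∈ s ∷ L → level h < K
      L-level h∈ with ∈-cartesianProductWith⁻ layerHub (upTo K) (upTo (suc K)) h∈
      ... | _ , _ , i∈ , _ , refl = ∈-upTo⁻ i∈

      hubs-unique : Unique (s ∷ L ++ A)
      hubs-unique = Unique.++⁺ {xs = s ∷ L}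
        (Unique.cartesianProductWith⁺ layerHub (λ { refl → refl , refl }) (Unique.upTo⁺ K) (Unique.upTo⁺ (suc K)))
        (Unique.map⁺ (λ { refl → refl }) (pairs-unique (Unique.upTo⁺ r) (pairs-unique (Unique.upTo⁺ r)
          (pairs-unique (Unique.upTo⁺ r) (tuples-unique M (Unique.upTo⁺ r))))))
        λ { (h∈L , h∈A) → <⇒≢ (L-level h∈L) (A-level h∈A) }

      layer : ∀ {i} → i < K → Σ[ hs ∈ List Hub ] Unique hs × length hs ≡ suc K
                                  × ∀ {h} → h ∈ hs → h ∈ s ∷ L × level h ≡ i
      layer {i} i<K = map (layerHub i) (upTo (suc K))
        , Unique.map⁺ (λ { refl → refl }) (Unique.upTo⁺ (suc K))
        , trans (length-map (layerHub i) (upTo (suc K))) (length-upTo (suc K))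
        , λ h∈ → case ∈-map⁻ (layerHub i) h∈ of λ { (j , j∈ , refl) →
            ∈-cartesianProductWith⁺ layerHub {upTo K} {upTo (suc K)} (∈-upTo⁺ i<K) j∈ , refl }

    module G = Gadget _≟ᴴ_ level K (suc (M * 2 ^ d)) (s≤s z≤n) s L A hubs-unique refl L-level A-level layer good

    private
      good-fits : ∀ t → T (good t) → ∀ {u v} → u ∈ t → v ∈ t → Fits K n u v
      good-fits t g {u} {v} u∈ v∈ = does⁻ (fits? K n u v)
        (to (all-T _ t) (to (all-T _ t) (proj₁ (to (T-∧ {allFit t}) g)) u∈) v∈)

      good-unrefuted : ∀ t → T (good t) → ¬ T (refuted t)
      good-unrefuted t g = T-not⁻ (proj₂ (to (T-∧ {allFit t}) g))

    satisfiable⇒save : (∃[ ρ ] ∣ ρ ∣ ≡ k × lookup (eval circuit ρ) output ≡ true) →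
                       Firefighting.CanSave G.graph zero G.threshold
    satisfiable⇒save (ρ , refl , sat) = G.selection⇒save record
      { unique   = closed-unique ρ⁺
      ; ⊆A       = λ {u} u∈ → let c = closed-props ρ⁺ u∈ in ∈A {u} (level≡ c)
                     (≤-trans (slot< c) (≤-trans (≤-reflexive (open-slot≡∣ρ∣ ρ⁺)) (s≤s (m≤n⇒m≤1+n (m≤n+m k N)))))
                     (<-trans (lo<hi c) (hi<r u c))
                     (hi<r u c)
                     (subst (_∈ tuples M (upTo r)) (sym (wits c)) W∈)
      ; size≡K   = length-closed ρ⁺
      ; all-good = All.tabulate tuple-good
      }
      where
      supported : ∃[ W ] All (_< N) W × length W ≤ 1 * 2 ^ lookup (depths circuit) output × Supports circuit ρ W output true
      supported = support circuit ρ output true 1 ≤-refl weft-bound sat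

      W₀ W : List ℕ
      W₀ = proj₁ supported
      -- Hubs carry exactly `M` witnesses. Designating node 0 in addition is harmless, since
      -- `Supports` covers all larger designations.
      W  = W₀ ++ replicate (M ∸ length W₀) 0

      ∣W₀∣≤M : length W₀ ≤ M
      ∣W₀∣≤M = ≤-trans (proj₁ (proj₂ (proj₂ supported)))
        (≤-trans (≤-reflexive (*-identityˡ _)) (^-monoʳ-≤ 2 depth-bound))

      W∈ : W ∈ tuples M (upTo r)
      W∈ = subst (λ l → W ∈ tuples l (upTo r))
        (trans (length-++ W₀) (trans (cong (length W₀ +_) (length-replicate (M ∸ length W₀))) (m+[n∸m]≡n ∣W₀∣≤M)))
        (∈-tuples⁺ (All.++⁺ (All.map (λ w<N → ∈-upTo⁺ (m≤n⇒m≤1+n (m≤n⇒m≤1+n (m≤n⇒m≤n+o k w<N)))) (proj₁ (proj₂ supported)))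
                            (All.replicate⁺ (M ∸ length W₀) (∈-upTo⁺ (s≤s z≤n)))))

      open Gaps K W

      ρ⁺ : Vec Bool (suc n)
      -- A true sentinel on top closes the last gap at n + 1, which gives k + 1 gaps; input `j` of
      -- `ρ` becomes entry `suc j`.
      ρ⁺ = true ∷ ρ

      hi<r : ∀ u {i} → Closed i (suc n) u → hi u < r
      hi<r u c = s≤s (≤-trans (hi≤ c) (s≤s (m≤n⇒m≤n+o k (n≤N circuit))))

      tuple-good : ∀ {t} → t ∈ tuples (tupleSize d) (closed ρ⁺) → T (good t)
      tuple-good {t} t∈ = from (T-∧ {allFit t})
        ( from (all-T _ t) (λ {u} u∈ → from (all-T _ t) λ {v} v∈ → does⁺ (fits? K n u v) (closed-fits ρ (t⊆ u∈) (t⊆ v∈)))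
        , T-not⁺ (proj₂ (proj₂ (proj₂ supported)) (member t) (says-of say t) member-W₀
            λ j b said → let u , u∈ , sd = to (any-T _ t) said in say-consistent ρ⁺ {u} (t⊆ u∈) (suc j) b sd))
        where
        t⊆ : ∀ {u} → u ∈ t → u ∈ closed ρ⁺
        t⊆ = All.lookup (proj₂ (∈-tuples⁻ (tupleSize d) t∈))

        -- Every gap carries all the witnesses, so the first entry of the tuple already designates
        -- them; tuples are nonempty.
        member-W₀ : ∀ {m} → m ∈ W₀ → T (member t m)
        member-W₀ {m} m∈ = head t t⊆ (proj₁ (∈-tuples⁻ (tupleSize d) {closed ρ⁺} t∈))
          where
          head : ∀ t → (∀ {u} → u ∈ t → u ∈ closed ρ⁺) → length t ≡ tupleSize d → T (member t m)
          head (u ∷ t) t⊆ _ = from (member-∈ (u ∷ t) m)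
            (u , here refl , subst (m ∈_) (sym (wits (closed-props ρ⁺ (t⊆ (here refl))))) (∈-++⁺ˡ m∈))

    selection⇒satisfiable : ∀ {D} → G.Selection D → ∃[ ρ ] ∣ ρ ∣ ≡ k × lookup (eval circuit ρ) output ≡ true
    selection⇒satisfiable {D} selection = bits truth n , weight
        , unrefuted-sound circuit {member D} {says-of say D} (bits truth n) decides output true unrefuted
      where
      open G.Selection selection

      padded : ∀ {t x} → x ∈ D → All (_∈ D) t → length t ≤ tupleSize d →
               ∃[ u ] u ∈ tuples (tupleSize d) D × (∀ {y} → y ∈ t → y ∈ u)
      padded = pad (tupleSize d) _

      fits : ∀ {u v} → u ∈ D → v ∈ D → Fits K n u v
      fits u∈ v∈ =
        let t , t∈ , ⊆t = padded u∈ (u∈ ∷ v∈ ∷ []) (s≤s (s≤s z≤n))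
        in good-fits t (All.lookup all-good t∈) (⊆t (here refl)) (⊆t (there (here refl)))

      open Tiling D unique size≡K (λ u∈ v∈ → trans (A-level (⊆A u∈)) (sym (A-level (⊆A v∈)))) fits

      -- All hubs of `D` carry the same `M` witnesses, so a refutation by `D` can be cut down to at
      -- most M · 2^d hubs. Padded to a full tuple it survives, as the tuple states more than these
      -- hubs and designates no more than `D`; but the tuple is good.
      unrefuted : ¬ Refuted circuit (member D) (says-of say D) output true
      unrefuted r =
        let u , u∈ , _       = at-slot {0} (s≤s z≤n)
            t , t⊆D , t≤ , rt = refutation-local say (witnesses u) (m^n>0 2 d) (≤-reflexive (A-witnesses (⊆A u∈)))
                                  (member D)
                                  (λ {m} m∈ → let v , v∈ , m∈v = to (member-∈ D m) m∈
                                              in subst (m ∈_) (proj₁ (fits v∈ u∈)) m∈v)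
                                  circuit D output true 1 weft-bound r
            t≤M = ≤-trans t≤ (*-mono-≤ (≤-reflexive (*-identityʳ M)) (^-monoʳ-≤ 2 depth-bound))
            t⁺ , t⁺∈ , ⊆t⁺ = padded u∈ t⊆D (m≤n⇒m≤1+n (m≤n⇒m≤1+n t≤M))
        in good-unrefuted t⁺ (All.lookup all-good t⁺∈)
             (refuted-mono circuit (λ m → member-mono {t⁺} {D} m (All.lookup (proj₂ (∈-tuples⁻ (tupleSize d) {D} t⁺∈))))
                                   (says-of-mono say ⊆t⁺) output true rt)

    save⇒satisfiable : Firefighting.CanSave G.graph zero G.threshold →
                       ∃[ ρ ] ∣ ρ ∣ ≡ k × lookup (eval circuit ρ) output ≡ true
    save⇒satisfiable saved = selection⇒satisfiable (proj₂ (G.save⇒selection saved))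

    paramBound : G.threshold + ∣ G.X ∣ ≤ (K + 2 * K ^ tupleSize d) + K * suc K
    paramBound = +-monoʳ-≤ G.threshold (≤-trans G.∣X∣≤∣layers∣
      (≤-reflexive (trans (length-productWith layerHub (upTo K) (upTo (suc K)))
                          (cong₂ _*_ (length-upTo K) (length-upTo (suc K))))))

open CircuitReduction

-- Polynomial-time tests on hubs, gates and circuits

module CircuitPrograms where

  open import Data.Bool.Base using (Bool; true; false; if_then_else_)
  open import Data.Bool.ListAction using (any; all)
  open import Data.Fin.Base using (zero; suc; toℕ)
  open import Data.Fin.Subset using (Subset)
  open import Data.List.Base as List using (List; []; _∷_; length; map; foldr; foldl; reverse; upTo; downFrom; replicate; _ʳ++_)
  open import Data.List.Properties using (reverse-upTo; reverse-involutive; length-replicate; ʳ++-defn; ++-identityʳ)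
  open import Data.Nat.Base
  open import Data.Nat.Properties
  open import Data.Product.Base using (_×_; _,_; proj₁; proj₂)
  open import Data.Vec.Base as Vec using (Vec; []; _∷_)
  import Data.Vec.Properties as Vec
  open import Relation.Binary.PropositionalEquality
  open import Relation.Nullary.Decidable using (does)

  hubT gateT valT vertexT wcsT : Ty
  hubT    = 𝐍 ⊗ 𝐍 ⊗ 𝐍 ⊗ 𝐍 ⊗ [ 𝐍 ]
  gateT   = 𝐍 ⊗ [ 𝔹 ]
  valT    = 𝔹 ⊗ 𝔹 ⊗ 𝔹
  vertexT = hubT ⊕ (𝔹 ⊗ [ hubT ])
  wcsT    = 𝐍 ⊗ [ gateT ] ⊗ 𝐍 ⊗ 𝐍

  -- Nested pairs serve as environments: `v0` and `v1` are de Bruijn variables, `rest1` and `rest2`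
  -- are weakenings.
  v0 : ∀ {A Γ} → PolyTime {A ⊗ Γ} proj₁
  v0 = fstP

  v1 : ∀ {A B Γ} → PolyTime {A ⊗ B ⊗ Γ} (λ γ → proj₁ (proj₂ γ))
  v1 = fstP ∘P sndP

  rest1 : ∀ {A Γ} → PolyTime {A ⊗ Γ} proj₂
  rest1 = sndP

  rest2 : ∀ {A B Γ} → PolyTime {A ⊗ B ⊗ Γ} (λ γ → proj₂ (proj₂ γ))
  rest2 = sndP ∘P sndP

  module _ {Γ : Ty} {u : El Γ → Hub} (U : PolyTime {Γ} {hubT} u) where

    levelP : PolyTime (λ γ → level (u γ))
    levelP = fstP ∘P U

    slotP : PolyTime (λ γ → slot (u γ))
    slotP = fstP ∘P sndP ∘P U

    loP : PolyTime (λ γ → lo (u γ))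
    loP = fstP ∘P sndP ∘P sndP ∘P U

    hiP : PolyTime (λ γ → hi (u γ))
    hiP = fstP ∘P sndP ∘P sndP ∘P sndP ∘P U

    witnessesP : PolyTime {Γ} {[ 𝐍 ]} (λ γ → witnesses (u γ))
    witnessesP = sndP ∘P sndP ∘P sndP ∘P sndP ∘P U

    sayP : ∀ {m : El Γ → ℕ} → PolyTime {Γ} {𝐍} m → ∀ b → PolyTime (λ γ → say (u γ) (m γ) b)
    sayP M true  = ≡ᵇP hiP (sucP ∘P M)
    sayP M false = <ᵇP loP (sucP ∘P M) ∧P <ᵇP (sucP ∘P M) hiP

  module _ {Γ : Ty} {u v : El Γ → Hub} (U : PolyTime {Γ} {hubT} u) (V : PolyTime {Γ} {hubT} v) where

    ≟ᴴP : PolyTime (λ γ → does (u γ ≟ᴴ v γ))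
    ≟ᴴP = ≡ᵇP (levelP U) (levelP V) ∧P ≡ᵇP (slotP U) (slotP V) ∧P ≡ᵇP (loP U) (loP V) ∧P ≡ᵇP (hiP U) (hiP V)
          ∧P eqListP (witnessesP U) (witnessesP V)

    -- Follows `fits?` factor by factor: by computation, `does` turns a decided product into a
    -- conjunction and a decided implication into `not _ ∨ _`.
    fitsP : ∀ {K n : El Γ → ℕ} → PolyTime {Γ} {𝐍} K → PolyTime {Γ} {𝐍} n →
            PolyTime (λ γ → does (fits? (K γ) (n γ) (u γ) (v γ)))
    fitsP K N =
         eqListP (witnessesP U) (witnessesP V)
      ∧P <ᵇP (loP U) (hiP U)
      ∧P <ᵇP (slotP U) K
      ∧P (notP ∘P ≡ᵇP (slotP U) zeroP ∨P ≡ᵇP (loP U) zeroP)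
      ∧P (notP ∘P ≡ᵇP (sucP ∘P slotP U) K ∨P ≡ᵇP (hiP U) (sucP ∘P N))
      ∧P (notP ∘P ≡ᵇP (slotP U) (slotP V) ∨P ≟ᴴP)
      ∧P (notP ∘P <ᵇP (slotP U) (slotP V) ∨P ≤ᵇP (hiP U) (loP V))
      ∧P (notP ∘P ≡ᵇP (sucP ∘P slotP U) (slotP V) ∨P ≡ᵇP (hiP U) (loP V))

  module _ {Γ : Ty} {t : El Γ → List Hub} {m : El Γ → ℕ} (TP : PolyTime {Γ} {[ hubT ]} t) (M : PolyTime {Γ} {𝐍} m) where

    memberP : PolyTime (λ γ → member (t γ) (m γ))
    memberP = anyP (anyP (≡ᵇP (M ∘P rest2) v0) (witnessesP v0)) TP

    says-ofP : ∀ b → PolyTime (λ γ → says-of say (t γ) (m γ) b)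
    says-ofP b = anyP (sayP v0 (M ∘P rest1) b) TP

  RawGate : Set
  RawGate = ℕ × List Bool

  -- One type for all gates: the unary index of a negation is the same tree as a list of that many
  -- `false`, and `length` recovers it.
  rawGate : ∀ {N} → Gate N → RawGate
  rawGate (NOT i)   = 0 , replicate (toℕ i) false
  rawGate (AND p _) = 1 , Vec.toList p
  rawGate (OR p _)  = 2 , Vec.toList p

  rawGates : ∀ {n N} → Circuit n N → List RawGate
  rawGates inputs  = []
  rawGates (C ▷ g) = rawGate g ∷ rawGates C

  selectStep : List Val × List Val → Bool → List Val × List Val
  selectStep (out , vs) b = list-case (out , []) (λ v vs → (if b then v ∷ out else out) , vs) vs

  rawSelect : List Bool → List Val → List Val
  rawSelect bs vs = reverse (proj₁ (foldl selectStep ([] , vs) bs))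

  rawSelect-select : ∀ {N} (p : Subset N) (vs : Vec Val N) → rawSelect (Vec.toList p) (Vec.toList vs) ≡ select p vs
  rawSelect-select p vs = trans (cong reverse (trans (go p vs []) (trans (ʳ++-defn (select p vs)) (++-identityʳ _))))
                                (reverse-involutive (select p vs))
    where
    go : ∀ {N} (p : Subset N) (vs : Vec Val N) out →
         proj₁ (foldl selectStep (out , Vec.toList vs) (Vec.toList p)) ≡ select p vs ʳ++ out
    go []          []       out = refl
    go (true ∷ p)  (v ∷ vs) out = go p vs (v ∷ out)
    go (false ∷ p) (v ∷ vs) out = go p vs out

  module _ {Γ : Ty} {bs : El Γ → List Bool} {vs : El Γ → List Val}
           (BS : PolyTime {Γ} {[ 𝔹 ]} bs) (VS : PolyTime {Γ} {[ valT ]} vs) where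

    rawSelectP : PolyTime {Γ} {[ valT ]} (λ γ → rawSelect (bs γ) (vs γ))
    rawSelectP = reverseP ∘P fstP ∘P
      foldlP {𝔹} {[ valT ] ⊗ [ valT ]} {Γ} {step = λ s → selectStep (proj₁ (proj₂ s)) (proj₁ s)}
        (list-caseP {A = valT} {B = [ valT ] ⊗ [ valT ]}
           {g = λ s → (if proj₁ (proj₂ s) then proj₁ (proj₁ s) ∷ proj₁ (proj₁ (proj₂ (proj₂ s))) else proj₁ (proj₁ (proj₂ (proj₂ s)))) , proj₂ (proj₁ s)}
           (fstP ∘P v1 ,P []P)
           (ifP (v0 ∘P rest1) (fstP ∘P fstP ∷P fstP ∘P v1 ∘P rest1) (fstP ∘P v1 ∘P rest1) ,P sndP ∘P fstP)
           (sndP ∘P v1))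
        -- A value is either dropped or moved from one component to the other, so the pair never
        -- grows.
        (con 0) (λ b a _ → ≤-trans (growth b a) (m≤m+n _ 0))
        BS ([]P ,P VS)
      where
      growth : ∀ b a → ∥_∥ {[ valT ] ⊗ [ valT ]} (selectStep a b) ≤ ∥_∥ {[ valT ] ⊗ [ valT ]} a
      growth b     (out , [])     = ≤-refl
      growth true  (out , v ∷ vs) = s≤s (≤-reflexive (begin
        suc (x + o) + y  ≡⟨ cong (λ z → suc z + y) (+-comm x o) ⟩
        suc (o + x) + y  ≡⟨ cong suc (+-assoc o x y) ⟩
        suc (o + (x + y)) ≡⟨ +-suc o (x + y) ⟨
        o + suc (x + y)  ∎))
        where
        open ≡-Reasoning
        x = ∥_∥ {valT} v
        o = ∥_∥ {[ valT ]} out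
        y = ∥_∥ {[ valT ]} vs
      growth false (out , v ∷ vs) = s≤s (+-monoʳ-≤ (∥_∥ {[ valT ]} out) (m≤n⇒m≤o+n (suc (∥_∥ {valT} v)) ≤-refl))

  -- Default for an index out of range, which does not occur on codes of circuits.
  noVal : Val
  noVal = false , false , false

  noValP : ∀ {Γ} → PolyTime {Γ} {valT} (λ _ → noVal)
  noValP = falseP ,P falseP ,P falseP

  refP : ∀ {Γ} {v : El Γ → Val} b → PolyTime {Γ} {valT} v → PolyTime (λ γ → ref b (v γ))
  refP true  V = fstP ∘P sndP ∘P V
  refP false V = sndP ∘P sndP ∘P V

  relevantP : ∀ {Γ} {vs : El Γ → List Val} → PolyTime {Γ} {[ valT ]} vs → PolyTime {Γ} {[ valT ]} (λ γ → relevant (vs γ))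
  relevantP VS = ifP (<ᵇP (constℕP 2) (lengthP VS)) (filterP (fstP ∘P v0) VS) VS

  rawGateRef : RawGate → List Val → Bool × Bool
  rawGateRef (tag , arg) vs =
    let v = nth noVal vs (length arg) ; sel = rawSelect arg vs in
    if is0 tag then (ref false v , ref true v)
    else if is0 (pred tag) then (any (ref true) sel , all (ref false) (relevant sel))
    else (all (ref true) (relevant sel) , any (ref false) sel)

  rawGateRefP : ∀ {Γ} {g : El Γ → RawGate} {vs : El Γ → List Val} →
                PolyTime {Γ} {gateT} g → PolyTime {Γ} {[ valT ]} vs → PolyTime {Γ} {𝔹 ⊗ 𝔹} (λ γ → rawGateRef (g γ) (vs γ))
  rawGateRefP {Γ} {g} {vs} G VS =
    ifP (is0P ∘P fstP ∘P G) (refP false V ,P refP true V)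
        (ifP (is0P ∘P predP ∘P fstP ∘P G)
             (anyP (refP true v0) S ,P allP (refP false v0) (relevantP S))
             (allP (refP true v0) (relevantP S) ,P anyP (refP false v0) S))
    where
    V : PolyTime {Γ} {valT} (λ γ → nth noVal (vs γ) (length (proj₂ (g γ))))
    V = nthP noValP VS (lengthP (sndP ∘P G))

    S : PolyTime {Γ} {[ valT ]} (λ γ → rawSelect (proj₂ (g γ)) (vs γ))
    S = rawSelectP (sndP ∘P G) VS

  nth-lookup : ∀ {A : Set} {N} (d : A) (xs : Vec A N) i → nth d (Vec.toList xs) (toℕ i) ≡ Vec.lookup xs i
  nth-lookup d (x ∷ xs) zero    = refl
  nth-lookup d (x ∷ xs) (suc i) = nth-lookup d xs i

  rawGateRef-gateRef : ∀ {N} (g : Gate N) vs → rawGateRef (rawGate g) (Vec.toList vs) ≡ gateRef g vs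
  rawGateRef-gateRef (NOT i)   vs rewrite length-replicate (toℕ i) {false} | nth-lookup noVal vs i = refl
  rawGateRef-gateRef (AND p _) vs rewrite rawSelect-select p vs = refl
  rawGateRef-gateRef (OR p _)  vs rewrite rawSelect-select p vs = refl

  -- The number of a node is the number of values computed before it. Gates and inputs are listed
  -- from the top down, hence the right fold and the reversal.
  rawVals : List Hub → ℕ → List RawGate → List Val
  rawVals t n gs = foldr (λ g vs → (member t (length vs) , rawGateRef g vs) ∷ vs)
                         (map (λ m → member t m , says-of say t m false , says-of say t m true) (reverse (upTo n))) gs

  rawVals-vals : ∀ {n N} t (C : Circuit n N) → rawVals t n (rawGates C) ≡ Vec.toList (vals (member t) (says-of say t) C)
  rawVals-vals t (_▷_ {N} C g) rewrite rawVals-vals t C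
    | Vec.length-toList (vals (member t) (says-of say t) C)
    | rawGateRef-gateRef g (vals (member t) (says-of say t) C) = refl
  rawVals-vals {n} t inputs = trans (cong (map _) (reverse-upTo n)) (go n)
    where
    go : ∀ n → map (λ m → member t m , says-of say t m false , says-of say t m true) (downFrom n)
             ≡ Vec.toList (inputVals (member t) (says-of say t) n)
    go zero    = refl
    go (suc n) = cong ((member t n , says-of say t n false , says-of say t n true) ∷_) (go n)

  ∥val∥≤11 : ∀ v → ∥_∥ {valT} v ≤ 11
  ∥val∥≤11 (a , b , c) = s≤s (+-mono-≤ (∥bool∥≤3 a) (s≤s (+-mono-≤ (∥bool∥≤3 b) (∥bool∥≤3 c))))

  rawValsP : ∀ {Γ} {t : El Γ → List Hub} {n : El Γ → ℕ} {gs : El Γ → List RawGate} →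
             PolyTime {Γ} {[ hubT ]} t → PolyTime {Γ} {𝐍} n → PolyTime {Γ} {[ gateT ]} gs →
             PolyTime {Γ} {[ valT ]} (λ γ → rawVals (t γ) (n γ) (gs γ))
  rawValsP {Γ} {t} TP N GS =
    foldrP {gateT} {[ valT ]} {Γ}
           ((memberP (TP ∘P rest2) (lengthP v1) ,P rawGateRefP v0 v1) ∷P v1)
           -- A value has size at most 11, and the new list cell adds one.
           (con 12)
           (λ g vs γ → ≤-trans (s≤s (+-monoˡ-≤ _ (∥val∥≤11 (member (t γ) (length vs) , rawGateRef g vs))))
                               (≤-reflexive (+-comm 12 (∥_∥ {[ valT ]} vs))))
           GS
           (mapP (memberP (TP ∘P rest1) v0 ,P says-ofP (TP ∘P rest1) v0 false ,P says-ofP (TP ∘P rest1) v0 true)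
                 (reverseP ∘P upToP ∘P N))

open CircuitPrograms

-- The reduction as a program on codes of instances

open import Data.Bool.Base using (Bool; true; false; not; _∧_; _∨_)
open import Data.Bool.ListAction using (any; all)
open import Data.Fin.Base using (zero; suc; toℕ)
open import Data.Fin.Subset using (Subset)
open import Data.List.Base as List using (List; []; _∷_; length; _++_; map; upTo; filterᵇ; lookup)
open import Data.List.Properties using (map-∘; map-++; map-cong)
import Data.List.Relation.Unary.Any as Any
open import Data.Nat.Base
open import Data.Nat.Properties
open import Data.Product.Base using (_×_; _,_; proj₁; proj₂)
open import Data.Sum.Base using (_⊎_; inj₁; inj₂; [_,_]′)
open import Data.Vec.Base as Vec using (Vec; []; _∷_)
open import Function.Base using (_∘_)
open import Function.Bundles using (mk⇔)
open import Relation.Binary.PropositionalEquality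
open import Relation.Nullary.Decidable using (does)

open PolyTime

RawInstance : Set
RawInstance = ℕ × List RawGate × ℕ × ℕ

rawGood : List Hub → RawInstance → Bool
rawGood t (n , gs , out , k) =
  all (λ u → all (λ v → does (fits? (suc k) n u v)) t) t ∧ not (ref true (nth noVal (rawVals t n gs) out))

rawGoodP : PolyTime {[ hubT ] ⊗ wcsT} (λ γ → rawGood (proj₁ γ) (proj₂ γ))
rawGoodP =
  allP (allP (fitsP v1 v0 (sucP ∘P sndP ∘P sndP ∘P sndP ∘P instP) (fstP ∘P instP)) (fstP ∘P rest1)) fstP
  ∧P notP ∘P refP true (nthP noValP (rawValsP fstP (fstP ∘P sndP) (fstP ∘P sndP ∘P sndP)) (fstP ∘P sndP ∘P sndP ∘P sndP))
  where
  instP : PolyTime {hubT ⊗ hubT ⊗ [ hubT ] ⊗ wcsT} (λ γ → proj₂ (proj₂ (proj₂ γ)))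
  instP = sndP ∘P rest2

RawVertex : Set
RawVertex = Hub ⊎ (Bool × List Hub)

rawVertex : Vertex Hub → RawVertex
rawVertex (hub h)    = inj₁ h
rawVertex (leaf b t) = inj₂ (b , t)

pairsP : ∀ {Γ A B} {xs : El Γ → List (El A)} {ys : El Γ → List (El B)} →
         PolyTime {Γ} {[ A ]} xs → PolyTime {Γ} {[ B ]} ys → PolyTime {Γ} {[ A ⊗ B ]} (λ γ → pairs (xs γ) (ys γ))
pairsP XS YS = productWithP (fstP ,P v1) XS YS

layerHubsP : PolyTime {𝐍} {[ hubT ]} layerHubs
layerHubsP = productWithP (v0 ,P v1 ,P zeroP ,P zeroP ,P []P) upToP (upToP ∘P sucP)

slotHubsP : ∀ M → PolyTime {𝐍 ⊗ 𝐍} {[ hubT ]} (λ γ → slotHubs M (proj₁ γ) (proj₂ γ))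
slotHubsP M = mapP (fstP ∘P sndP ,P fstP) (pairsP range (pairsP range (pairsP range (tuplesP M range))))
  where
  range : PolyTime {𝐍 ⊗ 𝐍} {[ 𝐍 ]} (λ γ → upTo (proj₂ γ))
  range = upToP ∘P sndP

-- The number of nodes is not part of the encoding; it is recovered as the number of gates plus the
-- number of inputs.
rawSlotHubs : ℕ → RawInstance → List Hub
rawSlotHubs d (n , gs , _ , k) = slotHubs (witnessCount d) (suc k) (suc (suc (length gs + n + k)))

rawSlotHubsP : ∀ d → PolyTime {wcsT} {[ hubT ]} (rawSlotHubs d)
rawSlotHubsP d = slotHubsP (witnessCount d) ∘P
  (sucP ∘P kP ,P sucP ∘P sucP ∘P +P (+P (lengthP (fstP ∘P sndP)) fstP) kP)
  where
  kP : PolyTime {wcsT} {𝐍} (λ γ → proj₂ (proj₂ (proj₂ γ)))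
  kP = sndP ∘P sndP ∘P sndP

rawGoodTuples : ℕ → RawInstance → List (List Hub)
rawGoodTuples d i = filterᵇ (λ t → rawGood t i) (tuples (tupleSize d) (rawSlotHubs d i))

rawGoodTuplesP : ∀ d → PolyTime {wcsT} {[ [ hubT ] ]} (rawGoodTuples d)
rawGoodTuplesP d = filterP rawGoodP (tuplesP (tupleSize d) (rawSlotHubsP d))

rawVertices : ℕ → RawInstance → List RawVertex
rawVertices d i@(_ , _ , _ , k) =
  map inj₁ (layerHubs (suc k) ++ rawSlotHubs d i) ++
  map (λ t → inj₂ (false , t)) (rawGoodTuples d i) ++ map (λ t → inj₂ (true , t)) (rawGoodTuples d i)

rawVerticesP : ∀ d → PolyTime {wcsT} {[ vertexT ]} (rawVertices d)
rawVerticesP d =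
  mapP (inj₁P ∘P v0) ((layerHubsP ∘P sucP ∘P sndP ∘P sndP ∘P sndP) ++P rawSlotHubsP d)
  ++P mapP (inj₂P ∘P (falseP ,P v0)) (rawGoodTuplesP d)
  ++P mapP (inj₂P ∘P (trueP ,P v0)) (rawGoodTuplesP d)

rawAdj : RawVertex → RawVertex → Bool
rawAdj u v =
  [ (λ h → [ (λ h′ → not (does (h ≟ᴴ h′)) ∧ (level h ≤ᵇ suc (level h′)) ∧ (level h′ ≤ᵇ suc (level h)))
           , (λ l → any (λ x → does (h ≟ᴴ x)) (proj₂ l)) ]′ v)
  , (λ l → [ (λ h → any (λ x → does (h ≟ᴴ x)) (proj₂ l)) , (λ _ → false) ]′ v) ]′ u

rawAdjP : PolyTime {vertexT ⊗ vertexT} (λ γ → rawAdj (proj₁ γ) (proj₂ γ))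
rawAdjP = sum-caseP {hubT} {𝔹 ⊗ [ hubT ]}
  (sum-caseP {hubT} {𝔹 ⊗ [ hubT ]}
    (notP ∘P ≟ᴴP v1 v0 ∧P ≤ᵇP (levelP v1) (sucP ∘P levelP v0) ∧P ≤ᵇP (levelP v0) (sucP ∘P levelP v1))
    (anyP (≟ᴴP (fstP ∘P rest2) v0) (sndP ∘P v0))
    (sndP ∘P sndP))
  (sum-caseP {hubT} {𝔹 ⊗ [ hubT ]}
    (anyP (≟ᴴP (fstP ∘P sndP) v0) (sndP ∘P v1))
    falseP
    (sndP ∘P sndP))
  fstP

rawInLayer : ℕ → RawVertex → Bool
rawInLayer K = [ (λ h → level h <ᵇ K) , (λ _ → false) ]′

threshold : ℕ → ℕ → ℕ
threshold d K = K + 2 * K ^ tupleSize d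

thresholdP : ∀ {Γ} {K : El Γ → ℕ} d → PolyTime {Γ} {𝐍} K → PolyTime {Γ} {𝐍} (λ γ → threshold d (K γ))
thresholdP d K = +P K (*P (constℕP 2) (^P K (tupleSize d)))

fireT : Ty
fireT = [ [ 𝔹 ] ] ⊗ 𝐍 ⊗ [ 𝔹 ] ⊗ 𝐍

transform : ℕ → RawInstance → El fireT
transform d i@(_ , _ , _ , k) =
  let vs = rawVertices d i in
  map (λ u → map (λ v → rawAdj u v) vs) vs , 0 , map (rawInLayer (suc k)) vs , threshold d (suc k)

transformP : ∀ d → PolyTime {wcsT} {fireT} (transform d)
transformP d =
  mapP (mapP (rawAdjP ∘P (v1 ,P v0)) (rawVerticesP d ∘P sndP)) (rawVerticesP d)
  ,P zeroP
  ,P mapP (sum-caseP {hubT} {𝔹 ⊗ [ hubT ]} (<ᵇP (levelP v0) (sucP ∘P sndP ∘P sndP ∘P sndP ∘P rest2)) falseP fstP) (rawVerticesP d)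
  ,P thresholdP d (sucP ∘P sndP ∘P sndP ∘P sndP)

encode-bits : ∀ {A : Set} (f : A → Bool) xs → ⌜ Vec.tabulate (f ∘ lookup xs) ⌝ˢ ≡ enc {[ 𝔹 ]} (map f xs)
encode-bits f []       = refl
encode-bits f (x ∷ xs) = cong (⌜ f x ⌝ᴮ ∙_) (encode-bits f xs)

encode-rows : ∀ {A : Set} (g : A → Tree) (f : A → List Bool) → (∀ x → g x ≡ enc {[ 𝔹 ]} (f x)) →
              ∀ xs → ⌜ Vec.tabulate (g ∘ lookup xs) ⌝ⱽ ≡ enc {[ [ 𝔹 ] ]} (map f xs)
encode-rows g f eq []       = refl
encode-rows g f eq (x ∷ xs) = cong₂ _∙_ (eq x) (encode-rows g f eq xs)

encode-subset : ∀ {N} (p : Subset N) → ⌜ p ⌝ˢ ≡ enc {[ 𝔹 ]} (Vec.toList p)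
encode-subset []      = refl
encode-subset (b ∷ p) = cong (⌜ b ⌝ᴮ ∙_) (encode-subset p)

encode-ℕ : ∀ n → ⌜ n ⌝ᴺ ≡ enc {[ 𝔹 ]} (List.replicate n false)
encode-ℕ zero    = refl
encode-ℕ (suc n) = cong (nil ∙_) (encode-ℕ n)

encode-gate : ∀ {N} (g : Gate N) → ⌜ g ⌝ᴳ ≡ enc {gateT} (rawGate g)
encode-gate (NOT i)   = cong (⌜ 0 ⌝ᴺ ∙_) (encode-ℕ (toℕ i))
encode-gate (AND p _) = cong (⌜ 1 ⌝ᴺ ∙_) (encode-subset p)
encode-gate (OR p _)  = cong (⌜ 2 ⌝ᴺ ∙_) (encode-subset p)

encode-gates : ∀ {n N} (C : Circuit n N) → gates C ≡ enc {[ gateT ]} (rawGates C)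
encode-gates inputs  = refl
encode-gates (C ▷ g) = cong₂ _∙_ (encode-gate g) (encode-gates C)

length-rawGates : ∀ {n N} (C : Circuit n N) → length (rawGates C) + n ≡ N
length-rawGates inputs  = refl
length-rawGates (C ▷ g) = cong suc (length-rawGates C)

filterᵇ-cong : ∀ {A : Set} {p q : A → Bool} → (∀ x → p x ≡ q x) → ∀ xs → filterᵇ p xs ≡ filterᵇ q xs
filterᵇ-cong {p = p} {q} p≗q [] = refl
filterᵇ-cong {p = p} {q} p≗q (x ∷ xs) with p x | q x | p≗q x
... | true  | _ | refl = cong (x ∷_) (filterᵇ-cong p≗q xs)
... | false | _ | refl = filterᵇ-cong p≗q xs

module _ (d : ℕ) (I : WCSInstance 1 d) where
  open WCSInstance I
  private
    module R = Reduction d I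

  rawInstance : RawInstance
  rawInstance = n , rawGates circuit , toℕ output , k

  rawGood-good : ∀ t → rawGood t rawInstance ≡ R.good t
  rawGood-good t = cong (λ b → R.allFit t ∧ not b) (cong (ref true)
    (trans (cong (λ vs → nth noVal vs (toℕ output)) (rawVals-vals t circuit)) (nth-lookup noVal (vals (member t) (says-of say t) circuit) output)))

  rawSlotHubs-A : rawSlotHubs d rawInstance ≡ R.A
  rawSlotHubs-A = cong (λ N → slotHubs (witnessCount d) (suc k) (suc (suc (N + k)))) (length-rawGates circuit)

  rawGoodTuples-goodTuples : rawGoodTuples d rawInstance ≡ R.G.goodTuples
  rawGoodTuples-goodTuples = trans
    (filterᵇ-cong rawGood-good (tuples (tupleSize d) (rawSlotHubs d rawInstance)))
    (cong (λ A → filterᵇ R.good (tuples (tupleSize d) A)) rawSlotHubs-A)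

  rawVertices-vertices : rawVertices d rawInstance ≡ map rawVertex R.G.vertices
  rawVertices-vertices = begin
    map inj₁ (layerHubs (suc k) ++ rawSlotHubs d rawInstance) ++ copies (rawGoodTuples d rawInstance)
      ≡⟨ cong₂ (λ A ts → map inj₁ (layerHubs (suc k) ++ A) ++ copies ts) rawSlotHubs-A rawGoodTuples-goodTuples ⟩
    map inj₁ hs ++ map (λ t → inj₂ (false , t)) ts ++ map (λ t → inj₂ (true , t)) ts
      ≡⟨ cong₂ _++_ (map-∘ hs) (cong₂ _++_ (map-∘ ts) (map-∘ ts)) ⟩
    map rawVertex (map hub hs) ++ map rawVertex (map (leaf false) ts) ++ map rawVertex (map (leaf true) ts)
      ≡⟨ cong (map rawVertex (map hub hs) ++_) (map-++ rawVertex (map (leaf false) ts) (map (leaf true) ts)) ⟨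
    map rawVertex (map hub hs) ++ map rawVertex (map (leaf false) ts ++ map (leaf true) ts)
      ≡⟨ map-++ rawVertex (map hub hs) _ ⟨
    map rawVertex R.G.vertices ∎
    where
    open ≡-Reasoning
    copies : List (List Hub) → List RawVertex
    copies ts = map (λ t → inj₂ (false , t)) ts ++ map (λ t → inj₂ (true , t)) ts
    hs = layerHubs (suc k) ++ R.A
    ts = R.G.goodTuples

  rawAdj-linked : ∀ u v → rawAdj (rawVertex u) (rawVertex v) ≡ does (R.G.linked? u v)
  rawAdj-linked (hub h)    (hub h′)   = refl
  rawAdj-linked (hub h)    (leaf _ t) = go t
    where
    go : ∀ t → any (λ x → does (h ≟ᴴ x)) t ≡ does (Any.any? (h ≟ᴴ_) t)
    go []      = refl
    go (x ∷ t) = cong (does (h ≟ᴴ x) ∨_) (go t)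
  rawAdj-linked (leaf b t) (hub h)    = rawAdj-linked (hub h) (leaf b t)
  rawAdj-linked (leaf _ _) (leaf _ _) = refl

  rawInLayer-inLayer : ∀ v → rawInLayer (suc k) (rawVertex v) ≡ R.G.inLayer v
  rawInLayer-inLayer (hub h)    = refl
  rawInLayer-inLayer (leaf _ _) = refl

  encode-wcs : ParamProblem.encode (WeightedCircuitSatisfiability 1 d) I ≡ enc {wcsT} rawInstance
  encode-wcs = cong (λ gs → ⌜ n ⌝ᴺ ∙ gs ∙ ⌜ toℕ output ⌝ᴺ ∙ ⌜ k ⌝ᴺ) (encode-gates circuit)

  encode-fire : ParamProblem.encode (SavingKVertices IsSplit) R.G.firefighting ≡ enc {fireT} (transform d rawInstance)
  encode-fire = cong₂ (λ m x → m ∙ nil ∙ x ∙ ⌜ R.G.threshold ⌝ᴺ)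
    (trans (encode-rows (λ u → ⌜ Vec.tabulate (λ j → does (R.G.linked? u (lookup V j))) ⌝ˢ)
                        (λ u → map (λ v → does (R.G.linked? u v)) V)
                        (λ u → encode-bits (λ v → does (R.G.linked? u v)) V) V)
           (cong (enc {[ [ 𝔹 ] ]}) (begin
             map (λ u → map (λ v → does (R.G.linked? u v)) V) V
               ≡⟨ map-cong (λ u → map-cong (λ v → rawAdj-linked u v) V) V ⟨
             map (λ u → map (λ v → rawAdj (rawVertex u) (rawVertex v)) V) V
               ≡⟨ map-cong (λ u → map-∘ V) V ⟩
             map (λ u → map (rawAdj (rawVertex u)) (map rawVertex V)) V
               ≡⟨ map-∘ V ⟩
             map (λ u → map (rawAdj u) (map rawVertex V)) (map rawVertex V)
               ≡⟨ cong (λ vs → map (λ u → map (rawAdj u) vs) vs) rawVertices-vertices ⟨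
             map (λ u → map (rawAdj u) vs) vs ∎)))
    (trans (encode-bits R.G.inLayer V)
           (cong (enc {[ 𝔹 ]}) (begin
             map R.G.inLayer V                              ≡⟨ map-cong rawInLayer-inLayer V ⟨
             map (rawInLayer (suc k) ∘ rawVertex) V         ≡⟨ map-∘ V ⟩
             map (rawInLayer (suc k)) (map rawVertex V)     ≡⟨ cong (map (rawInLayer (suc k))) rawVertices-vertices ⟨
             map (rawInLayer (suc k)) vs                    ∎)))
    where
    open ≡-Reasoning
    V  = R.G.vertices
    vs = rawVertices d rawInstance

wcs-reduction : ∀ d → PolyReduction (WeightedCircuitSatisfiability 1 d) (SavingKVertices IsSplit)
wcs-reduction d = record
  { A           = wcsT
  ; B           = fireT
  ; code        = rawInstance d
  ; encode-code = encode-wcs d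
  ; transform   = transform d
  ; transformP  = transformP d
  ; reduce      = λ I → Reduction.G.firefighting d I
  ; encode-red  = encode-fire d
  ; equivalent  = λ I → mk⇔ (Reduction.satisfiable⇒save d I) (Reduction.save⇒satisfiable d I)
  ; g           = λ k → threshold d (suc k) + suc k * suc (suc k)
  ; gP          = +P (thresholdP d sucP) (*P sucP (sucP ∘P sucP))
  ; g-mono      = λ m≤n → let m≤n′ = s≤s m≤n in +-mono-≤
                    (+-mono-≤ m≤n′ (*-monoʳ-≤ 2 (^-monoˡ-≤ (tupleSize d) m≤n′)))
                    (*-mono-≤ m≤n′ (s≤s m≤n′))
  ; param-bound = λ I → Reduction.paramBound d I
  }

-- Membership in W[1] supplies the depth `d`, and for fixed `d` all exponents in the reduction are
-- constants.
corollary4 : W[ 1 ]-Hard (SavingKVertices IsSplit)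
corollary4 P (d , P≤WCS) = ≤ᶠᵖᵗ-polyReduction P≤WCS (wcs-reduction d)
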